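{- Let $p_{\mathrm{lbl}}(n)$ be the number of $(3+1)$-free partial orders on $\{1,\dots,n\}$ and $p_{\mathrm{unl}}(n)$ the number of isomorphism classes of $(3+1)$-free posets with $n$ elements. Let $b_{\mathrm{lbl}}(n)=\sum_{i=0}^n\binom{n}{i}2^{i(n-i)}$ be the number of bicoloured graphs on $n$ labelled vertices and $b_{\mathrm{unl}}(n)$ the number of isomorphism classes of bicoloured graphs on $n$ vertices. Then, as $n\to\infty$, (i) $p_{\mathrm{lbl}}(n)\sim b_{\mathrm{lbl}}(n)$, and (ii) $p_{\mathrm{unl}}(n)\sim b_{\mathrm{unl}}(n)$.
   Context: A poset $P$ is $(3+1)$-free if there are no $a,b,c,d\in P$ with $a<b<c$ and $d$ incomparable to each of $a,b,c$. A bicoloured graph on a vertex set $V$ is a triple $(A,B,E)$ with $A\subseteq V$, $B=V\setminus A$ (ordered bipartition) and $E\subseteq A\times B$; isomorphisms of bicoloured graphs must map $A$ to $A$ and $B$ to $B$. -}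

module Defs where

open import Data.Bool.Base using (Bool; true; false)
open import Data.Fin.Base using (Fin; zero; suc)
import Data.Fin.Properties as Fin
open import Data.Fin.Permutation as Perm using (Permutation′; permutation; _⟨$⟩ʳ_; _⟨$⟩ˡ_)
open import Data.Fin.Subset using (Subset; _∈_; _∉_; ∣_∣; ∁)
open import Data.Fin.Subset.Properties using (_∈?_; ∣∁p∣≡n∸∣p∣; drop-there; x∈∁p⇒x∉p; x∉p⇒x∈∁p)
import Data.Integer.Base as ℤ
open import Data.List.Base as List using (List; []; _∷_; _++_; map; length; filter; deduplicate; cartesianProduct; cartesianProductWith; upTo; applyUpTo)
open import Data.List.Membership.Propositional using (lose) renaming (_∈_ to _∈ˡ_)
open import Data.List.Membership.Propositional.Properties using (∈-cartesianProductWith⁺; ∈-cartesianProduct⁺; ∈-filter⁺; ∈-allFin; ∈-lookup)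
import Data.List.Properties as List
open import Data.List.Relation.Unary.All as All using (All; []; _∷_)
import Data.List.Relation.Unary.All.Properties as All
open import Data.List.Relation.Unary.AllPairs using ([]; _∷_)
open import Data.List.Relation.Unary.Any as Any using (Any; here; there)
import Data.List.Relation.Unary.Any.Properties as Any
open import Data.List.Relation.Unary.Unique.Propositional using (Unique)
import Data.List.Relation.Unary.Unique.Propositional.Properties as Unique
import Data.List.Relation.Unary.Unique.Setoid as Setoid-Unique
import Data.List.Relation.Unary.Unique.DecSetoid.Properties as DecSetoid-Unique
open import Data.Nat.Base using (ℕ; zero; suc; _+_; _*_; _∸_; _^_; _≥_; z≤n; NonZero)
open import Data.Nat.Combinatorics using (_C_; nCk+nC[k+1]≡[n+1]C[k+1]; k>n⇒nCk≡0; nCn≡1; nCk≡nC[n∸k])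
open import Data.Nat.ListAction using (sum)
open import Data.Nat.ListAction.Properties using (sum-++)
import Data.Nat.Properties as ℕ
open import Algebra.Properties.CommutativeSemigroup ℕ.+-commutativeSemigroup using (interchange; x∙yz≈y∙xz)
open import Data.Product.Base using (Σ; Σ-syntax; ∃-syntax; _×_; _,_; proj₁; proj₂)
open import Data.Rational.Base using (ℚ; 0ℚ; 1ℚ; _/_; _-_; _<_) renaming (∣_∣ to ∣_∣ℚ)
open import Data.Vec.Base using (Vec; []; _∷_; lookup; tabulate; here; there)
open import Data.Vec.Properties using (lookup∘tabulate; ∷-injective)
open import Function.Base using (_∘_)
open import Function.Bundles using (_⇔_; mk⇔; Equivalence; Bijection)
import Function.Properties.Equivalence as ⇔
open import Level using (0ℓ)
open import Relation.Binary.Bundles using (Setoid; DecSetoid)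
open import Relation.Binary.Core using (Rel)
import Relation.Binary.Construct.On as On
open import Relation.Binary.Definitions using () renaming (Decidable to Decidable₂)
open import Relation.Binary.PropositionalEquality as ≡ using (_≡_; _≢_; refl; sym; trans; cong; cong₂; subst; subst₂; module ≡-Reasoning)
open import Relation.Binary.Structures using (IsEquivalence; IsPartialOrder)
open import Relation.Nullary using (¬_; Dec; yes; no; does; contradiction)
open import Relation.Nullary.Decidable using (map′; _×-dec_; _→-dec_; ¬?)
open import Relation.Unary using (Pred; Decidable)

-- f n / g n → 1 as n → ∞, the quotient being
-- defined (g n ≠ 0) for all large n.
infix 4 _∼_
_∼_ : (ℕ → ℕ) → (ℕ → ℕ) → Set
f ∼ g = ∀ (ε : ℚ) → 0ℚ < ε → ∃[ N ] (∀ n → n ≥ N →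
  Σ[ g≢0 ∈ NonZero (g n) ] ∣ _/_ (ℤ.+ f n) (g n) {{g≢0}} - 1ℚ ∣ℚ < ε)

-- Relations on Fin n, stored as the vector of the sets { j | i R j }, so
-- that propositional equality of codes is equality of relations.
FinRel : ℕ → Set
FinRel n = Vec (Subset n) n

⟦_⟧ : ∀ {n} → FinRel n → Rel (Fin n) 0ℓ
⟦ R ⟧ i j = j ∈ lookup R i

⟦_⟧? : ∀ {n} (R : FinRel n) → Decidable₂ ⟦ R ⟧
⟦ R ⟧? i j = j ∈? lookup R i

-- Here _≤_ is the reflexive order relation.
module _ {n : ℕ} (_≤_ : Rel (Fin n) 0ℓ) where

  StrictlyBelow : Rel (Fin n) 0ℓ
  StrictlyBelow a b = a ≤ b × a ≢ b

  Incomparable : Rel (Fin n) 0ℓ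
  Incomparable a b = ¬ (a ≤ b) × ¬ (b ≤ a)

  ThreePlusOneFree : Set
  ThreePlusOneFree = ¬ (∃[ a ] ∃[ b ] ∃[ c ] ∃[ d ]
    (StrictlyBelow a b × StrictlyBelow b c ×
     Incomparable d a × Incomparable d b × Incomparable d c))

  IsThreePlusOneFreePoset : Set
  IsThreePlusOneFreePoset = IsPartialOrder _≡_ _≤_ × ThreePlusOneFree

  module _ (_≤?_ : Decidable₂ _≤_) where

    isPartialOrder? : Dec (IsPartialOrder _≡_ _≤_)
    isPartialOrder? = map′
      (λ (r , t , a) → record
        { isPreorder = record
          { isEquivalence = ≡.isEquivalence
          ; reflexive     = λ { refl → r _ }
          ; trans         = t _ _ _
          }
        ; antisym = a _ _
        })
      (λ po → (λ _ → IsPartialOrder.refl po) , (λ _ _ _ → IsPartialOrder.trans po)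
        , (λ _ _ → IsPartialOrder.antisym po))
      (Fin.all? (λ i → i ≤? i)
        ×-dec Fin.all? (λ i → Fin.all? λ j → Fin.all? λ k → i ≤? j →-dec j ≤? k →-dec i ≤? k)
        ×-dec Fin.all? (λ i → Fin.all? λ j → i ≤? j →-dec j ≤? i →-dec i Fin.≟ j))

    isThreePlusOneFreePoset? : Dec IsThreePlusOneFreePoset
    isThreePlusOneFreePoset? = isPartialOrder? ×-dec ¬?
      (Fin.any? λ a → Fin.any? λ b → Fin.any? λ c → Fin.any? λ d →
        a <? b ×-dec b <? c ×-dec d ∥? a ×-dec d ∥? b ×-dec d ∥? c)
      where
      _<?_ : Decidable₂ StrictlyBelow
      a <? b = a ≤? b ×-dec ¬? (a Fin.≟ b)
      _∥?_ : Decidable₂ Incomparable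
      a ∥? b = ¬? (a ≤? b) ×-dec ¬? (b ≤? a)

IsPosetCode : ∀ {n} → Pred (FinRel n) 0ℓ
IsPosetCode R = IsThreePlusOneFreePoset ⟦ R ⟧

isPosetCode? : ∀ {n} → Decidable (IsPosetCode {n})
isPosetCode? R = isThreePlusOneFreePoset? ⟦ R ⟧ ⟦ R ⟧?

-- Bicoloured graphs (A , B , E) on Fin n, with B the complement of A and
-- E ⊆ A × B; only A and E are stored.
GraphCode : ℕ → Set
GraphCode n = Subset n × FinRel n

IsBicolouredGraph : ∀ {n} → Pred (GraphCode n) 0ℓ
IsBicolouredGraph (A , E) = ∀ i j → ⟦ E ⟧ i j → i ∈ A × j ∉ A

isBicolouredGraph? : ∀ {n} → Decidable (IsBicolouredGraph {n})
isBicolouredGraph? (A , E) = Fin.all? λ i → Fin.all? λ j →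
  ⟦ E ⟧? i j →-dec (i ∈? A ×-dec ¬? (j ∈? A))

PreservesRel : ∀ {n} → Permutation′ n → Rel (FinRel n) 0ℓ
PreservesRel π R S = ∀ i j → ⟦ R ⟧ i j ⇔ ⟦ S ⟧ (π ⟨$⟩ʳ i) (π ⟨$⟩ʳ j)

PreservesSet : ∀ {n} → Permutation′ n → Rel (Subset n) 0ℓ
PreservesSet π A A′ = ∀ i → i ∈ A ⇔ (π ⟨$⟩ʳ i) ∈ A′

infix 4 _≅ₚ_ _≅ᵍ_

_≅ₚ_ : ∀ {n} → Rel (FinRel n) 0ℓ
R ≅ₚ S = ∃[ π ] PreservesRel π R S

_≅ᵍ_ : ∀ {n} → Rel (GraphCode n) 0ℓ
(A , E) ≅ᵍ (A′ , E′) = ∃[ π ] (PreservesSet π A A′ × PreservesRel π E E′)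

vectors : ∀ {A : Set} → List A → ∀ n → List (Vec A n)
vectors xs zero    = [] ∷ []
vectors xs (suc n) = cartesianProductWith _∷_ xs (vectors xs n)

∈-vectors : ∀ {A : Set} {xs : List A} → (∀ x → x ∈ˡ xs) → ∀ {n} (v : Vec A n) → v ∈ˡ vectors xs n
∈-vectors all []      = here refl
∈-vectors all (x ∷ v) = ∈-cartesianProductWith⁺ _∷_ (all x) (∈-vectors all v)

vectors-! : ∀ {A : Set} {xs : List A} → Unique xs → ∀ n → Unique (vectors xs n)
vectors-! xs! zero    = [] ∷ []
vectors-! xs! (suc n) = Unique.cartesianProductWith⁺ _∷_ ∷-injective xs! (vectors-! xs! n)

bools : List Bool
bools = true ∷ false ∷ []

∈-bools : ∀ b → b ∈ˡ bools
∈-bools true  = here refl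
∈-bools false = there (here refl)

bools-! : Unique bools
bools-! = ((λ ()) ∷ []) ∷ [] ∷ []

subsets : ∀ n → List (Subset n)
subsets = vectors bools

relations : ∀ n → List (FinRel n)
relations n = vectors (subsets n) n

∈-relations : ∀ {n} (R : FinRel n) → R ∈ˡ relations n
∈-relations = ∈-vectors (∈-vectors ∈-bools)

relations-! : ∀ n → Unique (relations n)
relations-! n = vectors-! (vectors-! bools-! n) n

graphCodes : ∀ n → List (GraphCode n)
graphCodes n = cartesianProduct (subsets n) (relations n)

∈-graphCodes : ∀ {n} (G : GraphCode n) → G ∈ˡ graphCodes n
∈-graphCodes (A , E) = ∈-cartesianProduct⁺ (∈-vectors ∈-bools A) (∈-relations E)

graphCodes-! : ∀ n → Unique (graphCodes n)
graphCodes-! n = Unique.cartesianProduct⁺ (vectors-! bools-! n) (relations-! n)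

⇔-dec : ∀ {A B : Set} → Dec A → Dec B → Dec (A ⇔ B)
⇔-dec a? b? = map′ (λ (f , g) → mk⇔ f g) (λ e → Equivalence.to e , Equivalence.from e)
  ((a? →-dec b?) ×-dec (b? →-dec a?))

-- A property of permutations that depends only on the underlying map is
-- decided by running through all pairs of mutually inverse maps.
anyPermutation? : ∀ {n} (P : (Fin n → Fin n) → Set) →
  (∀ {f g} → (∀ i → f i ≡ g i) → P f → P g) → (∀ f → Dec (P f)) →
  Dec (∃[ π ] P (π ⟨$⟩ʳ_))
anyPermutation? {n} P resp P? = map′ to from
  (Any.any? (λ f → Any.any? (λ g → good? f g) maps) maps)
  where
  maps = vectors (List.allFin n) n
  Good : Vec (Fin n) n → Vec (Fin n) n → Set
  Good f g = (∀ i → lookup f (lookup g i) ≡ i) × (∀ i → lookup g (lookup f i) ≡ i) × P (lookup f)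
  good? : ∀ f g → Dec (Good f g)
  good? f g = Fin.all? (λ i → lookup f (lookup g i) Fin.≟ i)
    ×-dec Fin.all? (λ i → lookup g (lookup f i) Fin.≟ i) ×-dec P? (lookup f)
  to : Any (λ f → Any (Good f) maps) maps → ∃[ π ] P (π ⟨$⟩ʳ_)
  to any with f , any′ ← Any.satisfied any with g , fg , gf , p ← Any.satisfied any′ =
    permutation (lookup f) (lookup g) fg gf , p
  from : ∃[ π ] P (π ⟨$⟩ʳ_) → Any (λ f → Any (Good f) maps) maps
  from (π , p) = lose (∈-vectors ∈-allFin f) (lose (∈-vectors ∈-allFin g)
    ( (λ i → trans (f≗ _) (trans (cong (π ⟨$⟩ʳ_) (g≗ i)) (Perm.inverseʳ π)))
    , (λ i → trans (g≗ _) (trans (cong (π ⟨$⟩ˡ_) (f≗ i)) (Perm.inverseˡ π)))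
    , resp (λ i → sym (f≗ i)) p))
    where
    f = tabulate (π ⟨$⟩ʳ_)
    g = tabulate (π ⟨$⟩ˡ_)
    f≗ = lookup∘tabulate (π ⟨$⟩ʳ_)
    g≗ = lookup∘tabulate (π ⟨$⟩ˡ_)

_≅ₚ?_ : ∀ {n} → Decidable₂ (_≅ₚ_ {n})
R ≅ₚ? S = anyPermutation? (λ f → ∀ i j → ⟦ R ⟧ i j ⇔ ⟦ S ⟧ (f i) (f j))
  (λ f≗g p i j → subst₂ (λ x y → ⟦ R ⟧ i j ⇔ ⟦ S ⟧ x y) (f≗g i) (f≗g j) (p i j))
  (λ f → Fin.all? λ i → Fin.all? λ j → ⇔-dec (⟦ R ⟧? i j) (⟦ S ⟧? (f i) (f j)))

_≅ᵍ?_ : ∀ {n} → Decidable₂ (_≅ᵍ_ {n})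
(A , E) ≅ᵍ? (A′ , E′) = anyPermutation?
  (λ f → (∀ i → i ∈ A ⇔ f i ∈ A′) × (∀ i j → ⟦ E ⟧ i j ⇔ ⟦ E′ ⟧ (f i) (f j)))
  (λ f≗g (p , q) → (λ i → subst (λ x → i ∈ A ⇔ x ∈ A′) (f≗g i) (p i))
    , (λ i j → subst₂ (λ x y → ⟦ E ⟧ i j ⇔ ⟦ E′ ⟧ x y) (f≗g i) (f≗g j) (q i j)))
  (λ f → Fin.all? (λ i → ⇔-dec (i ∈? A) (f i ∈? A′))
    ×-dec Fin.all? λ i → Fin.all? λ j → ⇔-dec (⟦ E ⟧? i j) (⟦ E′ ⟧? (f i) (f j)))

preservesRel-sym : ∀ {n} (π : Permutation′ n) {R S} → PreservesRel π R S → PreservesRel (Perm.flip π) S R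
preservesRel-sym π {R} {S} p i j =
  ⇔.sym (subst₂ (λ x y → ⟦ R ⟧ (π ⟨$⟩ˡ i) (π ⟨$⟩ˡ j) ⇔ ⟦ S ⟧ x y)
    (Perm.inverseʳ π) (Perm.inverseʳ π) (p (π ⟨$⟩ˡ i) (π ⟨$⟩ˡ j)))

preservesSet-sym : ∀ {n} (π : Permutation′ n) {A A′} → PreservesSet π A A′ → PreservesSet (Perm.flip π) A′ A
preservesSet-sym π {A} {A′} p i =
  ⇔.sym (subst (λ x → (π ⟨$⟩ˡ i) ∈ A ⇔ x ∈ A′) (Perm.inverseʳ π) (p (π ⟨$⟩ˡ i)))

≅ₚ-isEquivalence : ∀ {n} → IsEquivalence (_≅ₚ_ {n})
≅ₚ-isEquivalence = record
  { refl  = Perm.id , λ _ _ → ⇔.refl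
  ; sym   = λ {R} {S} (π , p) → Perm.flip π , preservesRel-sym π {R} {S} p
  ; trans = λ (π , p) (ρ , q) → π Perm.∘ₚ ρ , λ i j → ⇔.trans (p i j) (q _ _)
  }

≅ᵍ-isEquivalence : ∀ {n} → IsEquivalence (_≅ᵍ_ {n})
≅ᵍ-isEquivalence = record
  { refl  = Perm.id , (λ _ → ⇔.refl) , λ _ _ → ⇔.refl
  ; sym   = λ {(A , E)} {(A′ , E′)} (π , p , q) →
      Perm.flip π , preservesSet-sym π {A} {A′} p , preservesRel-sym π {E} {E′} q
  ; trans = λ (π , p , q) (ρ , p′ , q′) → π Perm.∘ₚ ρ
      , (λ i → ⇔.trans (p i) (p′ _)) , λ i j → ⇔.trans (q i j) (q′ _ _)
  }

posetCodes-decSetoid : ℕ → DecSetoid 0ℓ 0ℓ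
posetCodes-decSetoid n = record
  { isDecEquivalence = record { isEquivalence = ≅ₚ-isEquivalence {n} ; _≟_ = _≅ₚ?_ } }

graphCodes-decSetoid : ℕ → DecSetoid 0ℓ 0ℓ
graphCodes-decSetoid n = record
  { isDecEquivalence = record { isEquivalence = ≅ᵍ-isEquivalence {n} ; _≟_ = _≅ᵍ?_ } }

posets : ∀ n → List (FinRel n)
posets n = filter isPosetCode? (relations n)

bicolouredGraphs : ∀ n → List (GraphCode n)
bicolouredGraphs n = filter isBicolouredGraph? (graphCodes n)

p-lbl : ℕ → ℕ
p-lbl n = length (posets n)

p-unl : ℕ → ℕ
p-unl n = length (deduplicate _≅ₚ?_ (posets n))

b-lbl : ℕ → ℕ
b-lbl n = sum (map (λ i → (n C i) * 2 ^ (i * (n ∸ i))) (upTo (suc n)))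

b-unl : ℕ → ℕ
b-unl n = length (deduplicate _≅ᵍ?_ (bicolouredGraphs n))

-- The codes satisfying P, up to ≈ on the code (the proof of P is ignored).
Satisfying : (S : Setoid 0ℓ 0ℓ) → Pred (Setoid.Carrier S) 0ℓ → Setoid 0ℓ 0ℓ
Satisfying S P = On.setoid {B = Σ (Setoid.Carrier S) P} S proj₁

_HasCardinality_ : Setoid 0ℓ 0ℓ → ℕ → Set
S HasCardinality k = Bijection (≡.setoid (Fin k)) S

module _ (S : Setoid 0ℓ 0ℓ) (P : Pred (Setoid.Carrier S) 0ℓ) where
  open Setoid S using (Carrier; _≈_) renaming (sym to ≈-sym; refl to ≈-refl; trans to ≈-trans)

  lookup-injective : ∀ {ys} → Setoid-Unique.Unique S ys →
    ∀ i j → List.lookup ys i ≈ List.lookup ys j → i ≡ j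
  lookup-injective (y∉ ∷ ys!) zero    zero    eq = refl
  lookup-injective (y∉ ∷ ys!) zero    (suc j) eq = contradiction eq (All.lookup y∉ (∈-lookup j))
  lookup-injective (y∉ ∷ ys!) (suc i) zero    eq = contradiction (≈-sym eq) (All.lookup y∉ (∈-lookup i))
  lookup-injective (y∉ ∷ ys!) (suc i) (suc j) eq = cong suc (lookup-injective ys! i j eq)

  length-cardinality : ∀ {ys} → Setoid-Unique.Unique S ys → All P ys →
    (∀ x → P x → Any (x ≈_) ys) → Satisfying S P HasCardinality length ys
  length-cardinality {ys} ys! Pys cover = record
    { to        = λ i → List.lookup ys i , All.lookup Pys (∈-lookup i)
    ; cong      = λ { refl → ≈-refl }
    ; bijective = (λ {i} {j} → lookup-injective ys! i j)
        , λ (x , px) → Any.index (cover x px) , λ { refl → ≈-sym (Any.lookup-index (cover x px)) }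
    }

module _ (D : DecSetoid 0ℓ 0ℓ) {P : Pred (DecSetoid.Carrier D) 0ℓ} (P? : Decidable P) where
  open DecSetoid D using (setoid; _≈_; _≟_) renaming (sym to ≈-sym; refl to ≈-refl; trans to ≈-trans)

  deduplicate-cardinality : ∀ {xs} → (∀ x → x ∈ˡ xs) →
    Satisfying setoid P HasCardinality length (deduplicate _≟_ (filter P? xs))
  deduplicate-cardinality {xs} all = length-cardinality setoid P
    (DecSetoid-Unique.deduplicate-! D (filter P? xs))
    (All.deduplicate⁺ _≟_ (All.all-filter P? xs))
    (λ x px → Any.deduplicate⁺ _≟_ (λ y≈z x≈z → ≈-trans x≈z (≈-sym y≈z))
      (lose (∈-filter⁺ P? (all x) px) ≈-refl))

p-lbl-cardinality : ∀ n → Satisfying (≡.setoid (FinRel n)) IsPosetCode HasCardinality p-lbl n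
p-lbl-cardinality n = length-cardinality _ IsPosetCode
  (Unique.filter⁺ isPosetCode? (relations-! n))
  (All.all-filter isPosetCode? (relations n))
  (λ R → ∈-filter⁺ isPosetCode? (∈-relations R))

p-unl-cardinality : ∀ n →
  Satisfying (DecSetoid.setoid (posetCodes-decSetoid n)) IsPosetCode HasCardinality p-unl n
p-unl-cardinality n = deduplicate-cardinality (posetCodes-decSetoid n) isPosetCode? ∈-relations

b-unl-cardinality : ∀ n →
  Satisfying (DecSetoid.setoid (graphCodes-decSetoid n)) IsBicolouredGraph HasCardinality b-unl n
b-unl-cardinality n = deduplicate-cardinality (graphCodes-decSetoid n) isBicolouredGraph? ∈-graphCodes

module _ {A B D : Set} {P : Pred A 0ℓ} {Q : Pred B 0ℓ} {R : Pred D 0ℓ}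
         (P? : Decidable P) (Q? : Decidable Q) (R? : Decidable R) (f : A → B → D)
         (split : ∀ x y → R (f x y) → P x × Q y) (join : ∀ x y → P x → Q y → R (f x y)) where

  count-map : ∀ x → P x → ∀ ys → length (filter R? (map (f x) ys)) ≡ length (filter Q? ys)
  count-map x px []       = refl
  count-map x px (y ∷ ys) with R? (f x y) | Q? y
  ... | yes _ | yes _ = cong suc (count-map x px ys)
  ... | yes r | no ¬q = contradiction (proj₂ (split x y r)) ¬q
  ... | no ¬r | yes q = contradiction (join x y px q) ¬r
  ... | no _  | no _  = count-map x px ys

  count-cartesianProductWith : ∀ xs ys → length (filter R? (cartesianProductWith f xs ys)) ≡
                               length (filter P? xs) * length (filter Q? ys)
  count-cartesianProductWith []       ys = refl
  count-cartesianProductWith (x ∷ xs) ys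
    rewrite List.filter-++ R? (map (f x) ys) (cartesianProductWith f xs ys)
          | List.length-++ (filter R? (map (f x) ys)) {filter R? (cartesianProductWith f xs ys)}
          | count-cartesianProductWith xs ys
    with P? x
  ... | yes px = cong (_+ length (filter P? xs) * length (filter Q? ys)) (count-map x px ys)
  ... | no ¬px = cong (λ zs → length zs + length (filter P? xs) * length (filter Q? ys))
    (List.filter-none R? (All.map⁺ (All.universal (λ y r → ¬px (proj₁ (split x y r))) ys)))

count-cong : ∀ {A : Set} {P Q : Pred A 0ℓ} (P? : Decidable P) (Q? : Decidable Q) →
  (∀ x → P x → Q x) → (∀ x → Q x → P x) → ∀ xs → length (filter P? xs) ≡ length (filter Q? xs)
count-cong P? Q? to from xs =
  cong length (List.filter-≐ P? Q? ((λ {x} → to x) , (λ {x} → from x)) xs)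

∏ : ∀ n → (Fin n → ℕ) → ℕ
∏ zero    f = 1
∏ (suc n) f = f zero * ∏ n (f ∘ suc)

∏-cong : ∀ n {f g} → (∀ i → f i ≡ g i) → ∏ n f ≡ ∏ n g
∏-cong zero    eq = refl
∏-cong (suc n) eq = cong₂ _*_ (eq zero) (∏-cong n (eq ∘ suc))

∏-one : ∀ n → ∏ n (λ _ → 1) ≡ 1
∏-one zero    = refl
∏-one (suc n) = trans (ℕ.+-identityʳ _) (∏-one n)

count-vectors : ∀ {A : Set} (xs : List A) n {P : Fin n → Pred A 0ℓ} (P? : ∀ i → Decidable (P i)) →
  length (filter (λ v → Fin.all? (λ i → P? i (lookup v i))) (vectors xs n)) ≡
  ∏ n (λ i → length (filter (P? i) xs))
count-vectors xs zero    P? = refl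
count-vectors xs (suc n) P? = trans
  (count-cartesianProductWith (P? zero) (λ v → Fin.all? (λ i → P? (suc i) (lookup v i)))
    (λ v → Fin.all? (λ i → P? i (lookup v i))) _∷_
    (λ _ _ p → p zero , p ∘ suc) (λ { _ _ p q zero → p ; _ _ p q (suc i) → q i }) xs (vectors xs n))
  (cong (length (filter (P? zero) xs) *_) (count-vectors xs n (P? ∘ suc)))

∏-∈ : ∀ {n} (A : Subset n) c (f : Fin n → ℕ) →
  (∀ i → i ∈ A → f i ≡ c) → (∀ i → i ∉ A → f i ≡ 1) → ∏ n f ≡ c ^ ∣ A ∣
∏-∈ []          c f in-A out-A = refl
∏-∈ (true ∷ A)  c f in-A out-A = cong₂ _*_ (in-A zero here)
  (∏-∈ A c (f ∘ suc) (λ i i∈A → in-A (suc i) (there i∈A)) (λ i i∉A → out-A (suc i) (i∉A ∘ drop-there)))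
∏-∈ (false ∷ A) c f in-A out-A = trans (cong₂ _*_ (out-A zero λ ())
  (∏-∈ A c (f ∘ suc) (λ i i∈A → in-A (suc i) (there i∈A)) (λ i i∉A → out-A (suc i) (i∉A ∘ drop-there))))
  (ℕ.*-identityˡ _)

lookup-true : ∀ {n} (v : Subset n) {i} → lookup v i ≡ true → i ∈ v
lookup-true (x ∷ v) {zero}  refl = here
lookup-true (x ∷ v) {suc i} eq   = there (lookup-true v eq)

∈-lookup-true : ∀ {n} {v : Subset n} {i} → i ∈ v → lookup v i ≡ true
∈-lookup-true here        = refl
∈-lookup-true (there i∈v) = ∈-lookup-true i∈v

module _ {n : ℕ} (A : Subset n) where

  Allowed : Fin n → Fin n → Set
  Allowed i j = i ∈ A × j ∉ A

  allowed? : Decidable₂ Allowed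
  allowed? i j = i ∈? A ×-dec ¬? (j ∈? A)

  row? : ∀ i (r : Subset n) → Dec (∀ j → j ∈ r → Allowed i j)
  row? i r = Fin.all? λ j → j ∈? r →-dec allowed? i j

  entry? : ∀ i j (b : Bool) → Dec (b ≡ true → Allowed i j)
  entry? i j true  = map′ (λ a _ → a) (λ f → f refl) (allowed? i j)
  entry? i j false = yes λ ()

  count-entry⁺ : ∀ i j → Allowed i j → length (filter (entry? i j) bools) ≡ 2
  count-entry⁺ i j a = cong length (List.filter-all (entry? i j) {bools} ((λ _ → a) ∷ (λ _ → a) ∷ []))

  count-entry⁻ : ∀ i j → ¬ Allowed i j → length (filter (entry? i j) bools) ≡ 1
  count-entry⁻ i j ¬a = cong length (List.filter-reject (entry? i j) (λ f → ¬a (f refl)))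

  count-row : ∀ i → length (filter (row? i) (subsets n)) ≡ ∏ n (λ j → length (filter (entry? i j) bools))
  count-row i = trans
    (count-cong (row? i) (λ r → Fin.all? λ j → entry? i j (lookup r j))
      (λ r p j → p j ∘ lookup-true r) (λ r p j → p j ∘ ∈-lookup-true) (subsets n))
    (count-vectors bools n (entry? i))

  count-row⁺ : ∀ i → i ∈ A → length (filter (row? i) (subsets n)) ≡ 2 ^ (n ∸ ∣ A ∣)
  count-row⁺ i i∈A = trans (count-row i) (trans
    (∏-∈ (∁ A) 2 _ (λ j j∈∁A → count-entry⁺ i j (i∈A , x∈∁p⇒x∉p j∈∁A))
      (λ j j∉∁A → count-entry⁻ i j λ (_ , j∉A) → j∉∁A (x∉p⇒x∈∁p j∉A)))
    (cong (2 ^_) (∣∁p∣≡n∸∣p∣ A)))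

  count-row⁻ : ∀ i → i ∉ A → length (filter (row? i) (subsets n)) ≡ 1
  count-row⁻ i i∉A = trans (count-row i)
    (trans (∏-cong n (λ j → count-entry⁻ i j (i∉A ∘ proj₁))) (∏-one n))

  count-edges : length (filter (λ E → isBicolouredGraph? (A , E)) (relations n)) ≡
                2 ^ (∣ A ∣ * (n ∸ ∣ A ∣))
  count-edges = begin
    length (filter (λ E → isBicolouredGraph? (A , E)) (relations n))  ≡⟨ count-vectors (subsets n) n row? ⟩
    ∏ n (λ i → length (filter (row? i) (subsets n)))                  ≡⟨ ∏-∈ A _ _ count-row⁺ count-row⁻ ⟩
    (2 ^ (n ∸ ∣ A ∣)) ^ ∣ A ∣                                         ≡⟨ ℕ.^-*-assoc 2 (n ∸ ∣ A ∣) ∣ A ∣ ⟩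
    2 ^ ((n ∸ ∣ A ∣) * ∣ A ∣)                                         ≡⟨ cong (2 ^_) (ℕ.*-comm (n ∸ ∣ A ∣) ∣ A ∣) ⟩
    2 ^ (∣ A ∣ * (n ∸ ∣ A ∣))                                         ∎
    where open ≡-Reasoning

count-filter-map : ∀ {A B : Set} {P : Pred B 0ℓ} (P? : Decidable P) (f : A → B) xs →
  length (filter P? (map f xs)) ≡ length (filter (P? ∘ f) xs)
count-filter-map P? f []       = refl
count-filter-map P? f (x ∷ xs) with does (P? (f x))
... | true  = cong suc (count-filter-map P? f xs)
... | false = count-filter-map P? f xs

count-cartesianProduct : ∀ {A B : Set} {P : Pred (A × B) 0ℓ} (P? : Decidable P) xs ys →
  length (filter P? (cartesianProduct xs ys)) ≡
  sum (map (λ x → length (filter (λ y → P? (x , y)) ys)) xs)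
count-cartesianProduct P? []       ys = refl
count-cartesianProduct P? (x ∷ xs) ys = trans
  (cong length (List.filter-++ P? (map (x ,_) ys) (cartesianProduct xs ys)))
  (trans (List.length-++ (filter P? (map (x ,_) ys)))
    (cong₂ _+_ (count-filter-map P? (x ,_) ys) (count-cartesianProduct P? xs ys)))

nC0≡1 : ∀ n → n C 0 ≡ 1
nC0≡1 n = trans (nCk≡nC[n∸k] {0} {n} z≤n) (nCn≡1 n)

∑ : ℕ → (ℕ → ℕ) → ℕ
∑ n f = sum (applyUpTo f n)

∑-cong : ∀ n {f g} → (∀ i → f i ≡ g i) → ∑ n f ≡ ∑ n g
∑-cong zero    eq = refl
∑-cong (suc n) eq = cong₂ _+_ (eq 0) (∑-cong n (eq ∘ suc))

∑-+ : ∀ n f g → ∑ n (λ i → f i + g i) ≡ ∑ n f + ∑ n g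
∑-+ zero    f g = refl
∑-+ (suc n) f g = trans (cong ((f 0 + g 0) +_) (∑-+ n (f ∘ suc) (g ∘ suc)))
  (interchange (f 0) (g 0) (∑ n (f ∘ suc)) (∑ n (g ∘ suc)))

∑-last : ∀ n f → ∑ (suc n) f ≡ ∑ n f + f n
∑-last zero    f = ℕ.+-comm (f 0) 0
∑-last (suc n) f = trans (cong (f 0 +_) (∑-last n (f ∘ suc))) (sym (ℕ.+-assoc (f 0) _ _))

∑-binomial-suc : ∀ n (g : ℕ → ℕ) → ∑ (2 + n) (λ i → (suc n C i) * g i) ≡
  ∑ (suc n) (λ i → (n C i) * g (suc i)) + ∑ (suc n) (λ i → (n C i) * g i)
∑-binomial-suc n g = begin
  (suc n C 0) * g 0 + ∑ (suc n) (λ i → (suc n C suc i) * g (suc i))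
    ≡⟨ cong₂ _+_ (cong (_* g 0) (trans (nC0≡1 (suc n)) (sym (nC0≡1 n)))) (∑-cong (suc n) λ i → trans
         (cong (_* g (suc i)) (sym (nCk+nC[k+1]≡[n+1]C[k+1] n i))) (ℕ.*-distribʳ-+ (g (suc i)) (n C i) _)) ⟩
  h 0 + ∑ (suc n) (λ i → (n C i) * g (suc i) + h (suc i))
    ≡⟨ cong (h 0 +_) (∑-+ (suc n) (λ i → (n C i) * g (suc i)) (h ∘ suc)) ⟩
  h 0 + (a + ∑ (suc n) (h ∘ suc))
    ≡⟨ x∙yz≈y∙xz (h 0) a _ ⟩
  a + ∑ (2 + n) h
    ≡⟨ cong (a +_) (∑-last (suc n) h) ⟩
  a + (∑ (suc n) h + (n C suc n) * g (suc n))
    ≡⟨ cong (λ c → a + (∑ (suc n) h + c * g (suc n))) (k>n⇒nCk≡0 (ℕ.n<1+n n)) ⟩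
  a + (∑ (suc n) h + 0)
    ≡⟨ cong (a +_) (ℕ.+-identityʳ _) ⟩
  a + ∑ (suc n) h ∎
  where
  open ≡-Reasoning
  h = λ i → (n C i) * g i
  a = ∑ (suc n) (λ i → (n C i) * g (suc i))

sum-subsets : ∀ n (g : ℕ → ℕ) →
  sum (map (λ A → g ∣ A ∣) (subsets n)) ≡ ∑ (suc n) (λ i → (n C i) * g i)
sum-subsets zero    g = cong (_+ 0) (sym (ℕ.*-identityˡ (g 0)))
sum-subsets (suc n) g = begin
  sum (map G (map (true ∷_) Xs ++ (map (false ∷_) Xs ++ [])))
    ≡⟨ cong (λ zs → sum (map G (map (true ∷_) Xs ++ zs))) (List.++-identityʳ _) ⟩
  sum (map G (map (true ∷_) Xs ++ map (false ∷_) Xs))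
    ≡⟨ cong sum (List.map-++ G (map (true ∷_) Xs) (map (false ∷_) Xs)) ⟩
  sum (map G (map (true ∷_) Xs) ++ map G (map (false ∷_) Xs))
    ≡⟨ sum-++ (map G (map (true ∷_) Xs)) _ ⟩
  sum (map G (map (true ∷_) Xs)) + sum (map G (map (false ∷_) Xs))
    ≡⟨ cong₂ (λ us vs → sum us + sum vs) (sym (List.map-∘ Xs)) (sym (List.map-∘ Xs)) ⟩
  sum (map (λ A → g (suc ∣ A ∣)) Xs) + sum (map (λ A → g ∣ A ∣) Xs)
    ≡⟨ cong₂ _+_ (sum-subsets n (g ∘ suc)) (sum-subsets n g) ⟩
  ∑ (suc n) (λ i → (n C i) * g (suc i)) + ∑ (suc n) (λ i → (n C i) * g i)
    ≡⟨ sym (∑-binomial-suc n g) ⟩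
  ∑ (2 + n) (λ i → (suc n C i) * g i) ∎
  where
  open ≡-Reasoning
  Xs = subsets n
  G : Subset (suc n) → ℕ
  G A = g ∣ A ∣

length-bicolouredGraphs : ∀ n → length (bicolouredGraphs n) ≡ b-lbl n
length-bicolouredGraphs n = begin
  length (bicolouredGraphs n)
    ≡⟨ count-cartesianProduct isBicolouredGraph? (subsets n) (relations n) ⟩
  sum (map (λ A → length (filter (λ E → isBicolouredGraph? (A , E)) (relations n))) (subsets n))
    ≡⟨ cong sum (List.map-cong count-edges (subsets n)) ⟩
  sum (map (λ A → 2 ^ (∣ A ∣ * (n ∸ ∣ A ∣))) (subsets n))
    ≡⟨ sum-subsets n (λ i → 2 ^ (i * (n ∸ i))) ⟩
  ∑ (suc n) (λ i → (n C i) * 2 ^ (i * (n ∸ i)))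
    ≡⟨ cong sum (sym (List.map-upTo (λ i → (n C i) * 2 ^ (i * (n ∸ i))) (suc n))) ⟩
  b-lbl n ∎
  where open ≡-Reasoning

b-lbl-cardinality : ∀ n → Satisfying (≡.setoid (GraphCode n)) IsBicolouredGraph HasCardinality b-lbl n
b-lbl-cardinality n = subst
  (λ k → Satisfying (≡.setoid (GraphCode n)) IsBicolouredGraph HasCardinality k) (length-bicolouredGraphs n)
  (length-cardinality _ IsBicolouredGraph
    (Unique.filter⁺ isBicolouredGraph? (graphCodes-! n))
    (All.all-filter isBicolouredGraph? (graphCodes n))
    (λ G → ∈-filter⁺ isBicolouredGraph? (∈-graphCodes G)))

{-# OPTIONS --safe #-}
module Submission where

-- A strict order is (3+1)-free iff a < b < c implies a < y or y < c for every
-- y. Call an element middle if it is neither minimal nor maximal. Posets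
-- without middle elements are bicoloured graphs, up to the colour of isolated
-- vertices. In a poset P with middle elements let x be a middle element with
-- the largest up-set U x, and x′ one with the largest down-set. The sets
-- Y = { y | U y ⊋ U x }, Z = { y | U y = U x } and the dual Y′ of Y are
-- disjoint, so one of them has at most n/3 elements. If Z is small, any v < x
-- is determined by P - v, x and one bit for each element of Z; if Y is small,
-- an element of Z other than x is determined by the rest and one bit for each
-- element of Y; Y′ is treated dually. Hence deleting one element loses only a
-- factor 2 ^ (n/3) times a polynomial, whereas the number b n of bicoloured
-- graphs grows by a factor 2 ^ (n/2), up to 2 ^ O(log² n) in the unlabelled
-- case: there b-unl n * n ! is compared with b-lbl n by counting a matrix, up
-- to permutations of rows and columns, as a multiset of columns of its first
-- O(log n) rows followed by a multiset of the other rows.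

open import Defs
import Algebra.Properties.CommutativeMonoid.Sum
open import Data.Bool.Base using (Bool; true; false; not; _∧_; _∨_; if_then_else_)
open import Data.Bool.Properties using (¬-not) renaming (_≟_ to _≟ᵇ_)
open import Data.Empty using (⊥-elim)
open import Data.Fin.Base using (Fin; zero; suc; punchIn)
open import Data.Fin.Permutation as Perm using (Permutation′; permutation; _⟨$⟩ʳ_; _⟨$⟩ˡ_)
import Data.Fin.Properties as Fin
open import Data.Fin.Subset using (Subset; ∣_∣; ∁)
open import Data.Fin.Subset.Properties using (∣∁p∣≡n∸∣p∣; ∣p∣≤n)
open import Data.Integer.Base as ℤ using (_⊖_)
import Data.Integer.Properties as ℤ
open import Data.List.Base as List using (List; []; _∷_; [_]; _++_; map; length; filter; concatMap; allFin; applyUpTo; upTo; cartesianProduct; cartesianProductWith)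
open import Data.List.Membership.Propositional using (lose) renaming (_∈_ to _∈ˡ_)
open import Data.List.Membership.Propositional.Properties using (∈-++⁺ˡ; ∈-++⁺ʳ; ∈-map⁺; ∈-lookup; ∈-concatMap⁺; ∈-allFin; ∈-upTo⁺; ∈-filter⁺; ∈-filter⁻; ∈-cartesianProduct⁺; ∈-cartesianProductWith⁺)
import Data.List.Properties as List
import Data.List.Relation.Unary.All as All
import Data.List.Relation.Unary.All.Properties as All
import Data.List.Relation.Unary.AllPairs.Properties as AllPairs
open import Data.List.Relation.Unary.Any as Any using (Any; here; there)
import Data.List.Relation.Unary.Any.Properties as Any
import Data.List.Relation.Unary.Unique.DecSetoid.Properties as DecSetoid-Unique
import Data.List.Relation.Unary.Unique.Setoid as Setoid-Unique
open import Data.Nat.Base using (ℕ; zero; suc; _+_; _*_; _∸_; _^_; _≤_; _<_; _⊔_; _!; z≤n; s≤s; ⌊_/2⌋; ⌈_/2⌉; NonZero; >-nonZero)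
open import Data.Nat.Combinatorics using (_C_; nCk≡n!/k![n-k]!; k![n∸k]!∣n!)
open import Data.Nat.DivMod using (_/_; _%_; m≡m%n+[m/n]*n; m%n<n; m/n*n≡m; m/n*n≤m)
open import Data.Nat.Induction using (<-wellFounded)
open import Data.Nat.ListAction using (sum)
import Data.Nat.Properties as ℕ
open import Data.Nat.Tactic.RingSolver using (solve-∀)
open import Data.Product.Base using (∃-syntax; _×_; _,_; proj₁; proj₂; swap)
open import Data.Rational.Base as ℚ using (ℚ; 0ℚ; 1ℚ; ↧ₙ_; ↥_; mkℚ; toℚᵘ)
import Data.Rational.Properties as ℚ
open import Data.Rational.Unnormalised.Base as ℚᵘ using (mkℚᵘ; *<*; 1ℚᵘ)
import Data.Rational.Unnormalised.Properties as ℚᵘ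
open import Data.Sum.Base as Sum using (_⊎_; inj₁; inj₂)
open import Data.Vec.Base using (Vec; []; _∷_; lookup; tabulate)
open import Data.Vec.Properties using (lookup∘tabulate; tabulate-cong; ≡-dec)
open import Function.Base using (_∘_; const; flip; id; case_of_)
open import Function.Bundles using (_↔_; mk⇔; mk↔ₛ′; Equivalence; Inverse)
open import Function.Construct.Identity using (↔-id)
open import Function.Construct.Symmetry using (↔-sym)
open import Induction.WellFounded using (Acc; acc)
open import Level using (0ℓ)
open import Relation.Binary.Bundles using (Setoid; DecSetoid)
open import Relation.Binary.Definitions using (DecidableEquality)
open import Relation.Binary.PropositionalEquality as ≡ using (_≡_; _≢_; refl; sym; trans; cong; cong₂; subst; subst₂; setoid)
open import Relation.Binary.Structures using (IsEquivalence; IsPartialOrder)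
open import Relation.Nullary using (¬_; Dec; yes; no; does; contradiction)
open import Relation.Nullary.Decidable using (_×-dec_; _→-dec_; ¬?; dec-true; dec-false)
open import Relation.Unary using (Pred; Decidable)

-- A code has to be read off in `P - v`, where up-sets may differ from those in `P`, and without
-- knowing which `x` was used; so all `x` are tried, at the cost of a factor `n`. In the unlabelled
-- case `P - v` is known only up to isomorphism, so the codes must work for every numbering of what
-- remains.
--
-- Deletion gives `p (n + 1) ≤ b (n + 1) + K p n` and, for isolated vertices,
-- `b (n + 1) ≤ p (n + 1) + K b n`, with `K b n` negligible against `b (n + 1)`. The upper bound
-- alone yields `p = O(b)`; inserted into itself, it yields the asymptotics.
--
-- For unlabelled graphs the growth of `b` is not evident, because of automorphisms. Sorting whole
-- rows disturbs the order of the columns and conversely, so the columns are sorted by their first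
-- `t` entries only and the rows outside this block afterwards. Leaving `t` rows unsorted loses
-- `a ! / (a - t) ! ≤ n ^ t`, the source of `2 ^ O(log² n)`. The value `t ≈ 2 log n` is dictated by
-- multisets: those of size `m` from `q` elements number `q ^ m / m !`, up to a factor two, as soon
-- as `q ≥ 2 m²`.

module Σℕ = Algebra.Properties.CommutativeMonoid.Sum ℕ.+-0-commutativeMonoid

-- Counting

count : ∀ {n} → (Fin n → Bool) → ℕ
count f = Σℕ.sum (λ i → if f i then 1 else 0)

count-mono : ∀ {n} (f g : Fin n → Bool) → (∀ i → f i ≡ true → g i ≡ true) → count f ≤ count g
count-mono {zero}  f g f⇒g = z≤n
count-mono {suc n} f g f⇒g with f zero in f0 | g zero in g0
... | false | _     = ℕ.≤-trans (count-mono (f ∘ suc) (g ∘ suc) (λ i → f⇒g (suc i))) (ℕ.m≤n+m _ _)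
... | true  | true  = s≤s (count-mono (f ∘ suc) (g ∘ suc) (λ i → f⇒g (suc i)))
... | true  | false = contradiction (trans (sym g0) (f⇒g zero f0)) λ ()

count-strict : ∀ {n} (f g : Fin n → Bool) → (∀ i → f i ≡ true → g i ≡ true) →
  ∀ j → f j ≡ false → g j ≡ true → count f < count g
count-strict f g f⇒g zero fj gj rewrite fj | gj =
  s≤s (count-mono (f ∘ suc) (g ∘ suc) (λ i → f⇒g (suc i)))
count-strict f g f⇒g (suc j) fj gj with f zero in f0 | g zero in g0
... | false | false = count-strict (f ∘ suc) (g ∘ suc) (λ i → f⇒g (suc i)) j fj gj
... | false | true  = ℕ.m≤n⇒m≤1+n (count-strict (f ∘ suc) (g ∘ suc) (λ i → f⇒g (suc i)) j fj gj)
... | true  | true  = s≤s (count-strict (f ∘ suc) (g ∘ suc) (λ i → f⇒g (suc i)) j fj gj)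
... | true  | false = contradiction (trans (sym g0) (f⇒g zero f0)) λ ()

count-≤n : ∀ {n} (f : Fin n → Bool) → count f ≤ n
count-≤n {zero}  f = z≤n
count-≤n {suc n} f with f zero
... | true  = s≤s (count-≤n (f ∘ suc))
... | false = ℕ.m≤n⇒m≤1+n (count-≤n (f ∘ suc))

count-permute : ∀ {n} (f : Fin n → Bool) (π : Permutation′ n) → count f ≡ count (λ i → f (π ⟨$⟩ʳ i))
count-permute f π = Σℕ.sum-permute (λ i → if f i then 1 else 0) π

count-disjoint : ∀ {n} (f g h : Fin n → Bool) →
  (∀ i → f i ≡ true → g i ≡ false × h i ≡ false) → (∀ i → g i ≡ true → h i ≡ false) →
  count f + count g + count h ≤ n
count-disjoint {zero}  f g h fgh gh = z≤n
count-disjoint {suc n} f g h fgh gh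
  with f zero in f0 | g zero in g0 | h zero in h0
     | count-disjoint (f ∘ suc) (g ∘ suc) (h ∘ suc) (λ i → fgh (suc i)) (λ i → gh (suc i))
... | true  | true  | _     | ih = contradiction (trans (sym g0) (proj₁ (fgh zero f0))) λ ()
... | true  | _     | true  | ih = contradiction (trans (sym h0) (proj₂ (fgh zero f0))) λ ()
... | _     | true  | true  | ih = contradiction (trans (sym h0) (gh zero g0)) λ ()
... | true  | false | false | ih = s≤s ih
... | false | true  | false | ih rewrite ℕ.+-suc (count (f ∘ suc)) (count (g ∘ suc)) = s≤s ih
... | false | false | true  | ih rewrite ℕ.+-suc (count (f ∘ suc) + count (g ∘ suc)) (count (h ∘ suc)) = s≤s ih
... | false | false | false | ih = ℕ.m≤n⇒m≤1+n ih

-- One bit for each marked position: these lists are the only source of exponential factors in the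
-- number of codes.
fills : ∀ {n} → (Fin n → Bool) → (Fin n → Bool) → List (Subset n)
fills {zero}  w base = [ [] ]
fills {suc n} w base = if w zero
  then map (true ∷_) (fills (w ∘ suc) (base ∘ suc)) ++ map (false ∷_) (fills (w ∘ suc) (base ∘ suc))
  else map (base zero ∷_) (fills (w ∘ suc) (base ∘ suc))

length-fills : ∀ {n} (w base : Fin n → Bool) → length (fills w base) ≡ 2 ^ count w
length-fills {zero}  w base = refl
length-fills {suc n} w base with w zero
... | true  = trans (List.length-++ (map (true ∷_) (fills (w ∘ suc) (base ∘ suc))))
  (cong₂ _+_ (trans (List.length-map (true ∷_) rest) (length-fills (w ∘ suc) (base ∘ suc)))
    (trans (List.length-map (false ∷_) rest)
      (trans (length-fills (w ∘ suc) (base ∘ suc)) (sym (ℕ.+-identityʳ _)))))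
  where rest = fills (w ∘ suc) (base ∘ suc)
... | false = trans (List.length-map (base zero ∷_) (fills (w ∘ suc) (base ∘ suc)))
  (length-fills (w ∘ suc) (base ∘ suc))

∈-fills : ∀ {n} (w base f : Fin n → Bool) → (∀ i → w i ≡ false → f i ≡ base i) →
  tabulate f ∈ˡ fills w base
∈-fills {zero}  w base f agree = here refl
∈-fills {suc n} w base f agree with w zero in w0 | ∈-fills (w ∘ suc) (base ∘ suc) (f ∘ suc) (λ i → agree (suc i))
... | false | ih = subst (λ b → (b ∷ _) ∈ˡ _) (sym (agree zero w0)) (∈-map⁺ (base zero ∷_) ih)
... | true  | ih with f zero
...   | true  = ∈-++⁺ˡ (∈-map⁺ (true ∷_) ih)
...   | false = ∈-++⁺ʳ _ (∈-map⁺ (false ∷_) ih)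

does⁻ : ∀ {P : Set} (p? : Dec P) → does p? ≡ true → P
does⁻ (yes p) _ = p

-- Reconstructing an element of a (3+1)-free order

BRel : ℕ → Set
BRel n = Fin n → Fin n → Bool

module _ {n : ℕ} (L : BRel n) where

  includes? : ∀ x y → Dec (∀ w → L x w ≡ true → L y w ≡ true)
  includes? x y = Fin.all? λ w → (L x w ≟ᵇ true) →-dec (L y w ≟ᵇ true)

  incl : Fin n → Fin n → Bool
  incl x y = does (includes? x y)

  incl⁺ : ∀ {x y} → (∀ w → L x w ≡ true → L y w ≡ true) → incl x y ≡ true
  incl⁺ {x} {y} p = dec-true (includes? x y) p

  incl⁻ : ∀ {x y} → incl x y ≡ true → ∀ w → L x w ≡ true → L y w ≡ true
  incl⁻ {x} {y} = does⁻ (includes? x y)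

  ¬incl⁻ : ∀ {x y} → incl x y ≡ false → ∃[ w ] L x w ≡ true × L y w ≡ false
  ¬incl⁻ {x} {y} eq with Fin.any? (λ w → (L x w ≟ᵇ true) ×-dec (L y w ≟ᵇ false))
  ... | yes p = p
  ... | no ¬p = contradiction (trans (sym eq) (incl⁺ λ w xw → ¬-not λ yw → ¬p (w , xw , yw))) λ ()

  -- `same L x` and `larger L x` are the sets `Z` and `Y` of the overview; the dual set `Y′` is
  -- `larger (flip L) x′`.
  same : Fin n → Fin n → Bool
  same x y = incl x y ∧ incl y x

  larger : Fin n → Fin n → Bool
  larger x y = incl x y ∧ not (incl y x)

  upsets downsets : Fin n → Subset n
  upsets x = tabulate (L x)
  downsets x = tabulate (λ y → L y x)

bool-ext : ∀ {a b : Bool} → (a ≡ true → b ≡ true) → (b ≡ true → a ≡ true) → a ≡ b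
bool-ext {false} {false} f g = refl
bool-ext {false} {true}  f g = g refl
bool-ext {true}  {_}     f g = sym (f refl)

∧⁻ : ∀ {a b} → a ∧ b ≡ true → a ≡ true × b ≡ true
∧⁻ {true} {true} refl = refl , refl

∧⁺ : ∀ {a b} → a ≡ true → b ≡ true → a ∧ b ≡ true
∧⁺ refl refl = refl

-- In a strict order, (3+1)-freeness says that every element is above a or
-- below c whenever a < b < c; comparability with b is then automatic.
record IsFreeOrder {n} (L : BRel n) : Set where
  field
    irrefl : ∀ x → L x x ≢ true
    <-trans : ∀ {x y z} → L x y ≡ true → L y z ≡ true → L x z ≡ true
    free   : ∀ {a b c} → L a b ≡ true → L b c ≡ true → ∀ y → L a y ≡ true ⊎ L y c ≡ true

open IsFreeOrder

flip-free : ∀ {n} {L : BRel n} → IsFreeOrder L → IsFreeOrder (flip L)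
flip-free fr = record
  { irrefl  = irrefl fr
  ; <-trans = λ p q → <-trans fr q p
  ; free    = λ p q y → Sum.swap (free fr q p y)
  }

Middle : ∀ {n} → BRel n → Fin n → Set
Middle L x = (∃[ a ] L a x ≡ true) × (∃[ c ] L x c ≡ true)

middle? : ∀ {n} (L : BRel n) x → Dec (Middle L x)
middle? L x = Fin.any? (λ a → L a x ≟ᵇ true) ×-dec Fin.any? (λ c → L x c ≟ᵇ true)

-- Only middle elements compete. A minimal element may have a strictly larger up-set, and for a
-- middle `x` the set `larger L x` consists of such elements.
Maximal : ∀ {n} → BRel n → Fin n → Set
Maximal L x = ∀ y → Middle L y → incl L x y ≡ true → incl L y x ≡ true

Twins : ∀ {n} → BRel n → Fin n → Fin n → Set
Twins L x y = ∀ w → L x w ≡ L y w × L w x ≡ L w y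

relabel : ∀ {m n} → (Fin m → Fin n) → BRel n → BRel m
relabel f L i j = L (f i) (f j)

tail : ∀ {n} → BRel (suc n) → BRel n
tail = relabel suc

code : ∀ {n} → BRel (suc n) → Subset n × Subset n
code L = downs , ups
  where
  downs = tabulate (λ i → L (suc i) zero)
  ups = tabulate (λ i → L zero (suc i))

when : ∀ {P A : Set} → Dec P → List A → List A
when (yes _) xs = xs
when (no _)  xs = []

∈-when : ∀ {P A : Set} (p? : Dec P) → P → ∀ {x : A} {xs} → x ∈ˡ xs → x ∈ˡ when p? xs
∈-when (yes _) p x∈xs = x∈xs
∈-when (no ¬p) p x∈xs = contradiction p ¬p

length-when : ∀ {P A : Set} (p? : Dec P) {xs : List A} {m} → (P → length xs ≤ m) → length (when p? xs) ≤ m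
length-when (yes p) le = le p
length-when (no _)  le = z≤n

-- A set that is too large contributes no codes, so the bound on the number of codes holds for every
-- relation, without hypotheses.
ifSmall : ∀ {n} {A : Set} → ℕ → (Fin n → Bool) → List A → List A
ifSmall k w xs = when (count w ℕ.≤? k) xs

emptyOrSingleton : ∀ n → List (Fin n → Bool)
emptyOrSingleton n = (λ _ → false) ∷ map (λ y i → does (y Fin.≟ i)) (allFin n)

ifSmall⁺ : ∀ {n} {A : Set} k (w : Fin n → Bool) {xs} {x : A} → count w ≤ k → x ∈ˡ xs → x ∈ˡ ifSmall k w xs
ifSmall⁺ k w small x∈ = ∈-when (count w ℕ.≤? k) small x∈

-- The pairs (down-set, up-set) that a removed element v may have in P, read
-- off from P - v = L and an element x of it. twinCodes: v is a twin of x.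
-- sourceCodes: v < x is minimal and only its position relative to the
-- elements with the same up-set as x is free. levelCodes: v has the same
-- up-set as x; its down-set consists of elements with a strictly larger
-- up-set, which in P - v is visible for all of them but at most one.
module _ {n : ℕ} (k : ℕ) (L : BRel n) where

  twinCodes sourceCodes : Fin n → List (Subset n × Subset n)
  twinCodes x = [ downsets L x , upsets L x ]
  sourceCodes x = ifSmall k (same L x) (map (tabulate (λ _ → false) ,_) (fills (same L x) (not ∘ incl L x)))

  levelCodes : Fin n → (Fin n → Bool) → List (Subset n × Subset n)
  levelCodes x base = ifSmall k (larger L x) (map (_, upsets L x) (fills (larger L x) base))

  codesAt : Fin n → List (Subset n × Subset n)
  codesAt x = twinCodes x ++ sourceCodes x ++ concatMap (levelCodes x) (emptyOrSingleton n)

  codes₁ : List (Subset n × Subset n)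
  codes₁ = concatMap codesAt (allFin n)

  codesAt⊆codes₁ : ∀ {c} x → c ∈ˡ codesAt x → c ∈ˡ codes₁
  codesAt⊆codes₁ x c∈ = ∈-concatMap⁺ codesAt (lose (∈-allFin x) c∈)

count-cong-≗ : ∀ {n} {f g : Fin n → Bool} → (∀ i → f i ≡ g i) → count f ≡ count g
count-cong-≗ f≗g = Σℕ.sum-cong-≗ λ i → cong (if_then 1 else 0) (f≗g i)

fills-cong : ∀ {n} {w w′ base base′ : Fin n → Bool} → (∀ i → w i ≡ w′ i) → (∀ i → base i ≡ base′ i) →
  fills w base ≡ fills w′ base′
fills-cong {zero}  w≗ base≗ = refl
fills-cong {suc n} {base′ = base′} w≗ base≗
  rewrite w≗ zero | base≗ zero | fills-cong (λ i → w≗ (suc i)) (λ i → base≗ (suc i)) = refl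

module _ {n : ℕ} (k : ℕ) {L L′ : BRel n} (L≗ : ∀ i j → L i j ≡ L′ i j) where

  incl-cong : ∀ x y → incl L x y ≡ incl L′ x y
  incl-cong x y = bool-ext
    (λ p → incl⁺ L′ λ w q → trans (sym (L≗ y w)) (incl⁻ L p w (trans (L≗ x w) q)))
    (λ p → incl⁺ L λ w q → trans (L≗ y w) (incl⁻ L′ p w (trans (sym (L≗ x w)) q)))

  ifSmall-cong : ∀ {w w′ base base′} (f : Subset n → Subset n × Subset n) →
    (∀ i → w i ≡ w′ i) → (∀ i → base i ≡ base′ i) →
    ifSmall k w (map f (fills w base)) ≡ ifSmall k w′ (map f (fills w′ base′))
  ifSmall-cong {w} {w′} f w≗ base≗ = cong₂ (λ c xs → when (c ℕ.≤? k) (map f xs))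
    (count-cong-≗ {f = w} {w′} w≗) (fills-cong w≗ base≗)

  codesAt-cong : ∀ x → codesAt k L x ≡ codesAt k L′ x
  codesAt-cong x = cong₂ _++_
    (cong₂ (λ d u → [ d , u ]) (tabulate-cong λ y → L≗ y x) (tabulate-cong (L≗ x)))
    (cong₂ _++_ (ifSmall-cong _ (λ y → cong₂ _∧_ (incl-cong x y) (incl-cong y x)) (λ y → cong not (incl-cong x y)))
      (List.concatMap-cong (λ base → trans
        (ifSmall-cong _ (λ y → cong₂ (λ a b → a ∧ not b) (incl-cong x y) (incl-cong y x)) (λ _ → refl))
        (cong (λ u → ifSmall k (larger L′ x) (map (_, u) (fills (larger L′ x) base))) (tabulate-cong (L≗ x))))
        (emptyOrSingleton n)))

  codes₁-cong : codes₁ k L ≡ codes₁ k L′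
  codes₁-cong = List.concatMap-cong codesAt-cong (allFin n)

codes : ∀ {n} → ℕ → BRel n → List (Subset n × Subset n)
codes k L = codes₁ k L ++ map swap (codes₁ k (flip L))

-- The tail of a relabelled order agrees with the order of the chosen representative only pointwise,
-- so the list of codes must respect pointwise equality.
codes-cong : ∀ {n} (k : ℕ) {L L′ : BRel n} → (∀ i j → L i j ≡ L′ i j) → codes k L ≡ codes k L′
codes-cong k L≗ = cong₂ (λ xs ys → xs ++ map swap ys) (codes₁-cong k L≗) (codes₁-cong k (λ i j → L≗ j i))

module _ {n : ℕ} (k : ℕ) (L : BRel (suc n)) where

  private Q = tail L

  twin-code : ∀ i → Twins L (suc i) zero → code L ∈ˡ codes₁ k Q
  twin-code i tw = codesAt⊆codes₁ k Q i (here (cong₂ _,_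
    (tabulate-cong λ j → sym (proj₂ (tw (suc j)))) (tabulate-cong λ j → sym (proj₁ (tw (suc j))))))

  -- The up-set of 0 strictly contains that of `x`, so by maximality 0 is not middle, hence minimal;
  -- then up-set inclusions among the others are the same in `Q` and in `L`. If `x < d` but not
  -- `y < d`, freeness applied to `0 < x < d` gives `0 < y`. If the up-set of `y` strictly contains
  -- that of `x`, then `0 < y` would make `y` middle, against maximality.
  source-code : IsFreeOrder L → ∀ i → Maximal L (suc i) → L zero (suc i) ≡ true → Middle L (suc i) →
    count (same L (suc i)) ≤ k → code L ∈ˡ codes₁ k Q
  source-code fr i max 0<x (_ , c , x<c) small = codesAt⊆codes₁ k Q i
    (∈-++⁺ʳ (twinCodes k Q i) (∈-++⁺ˡ (ifSmall⁺ k (same Q i)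
      (ℕ.≤-trans (count-mono (same Q i) (same L (suc i) ∘ suc)
        (λ j → subst (λ b → b ≡ true) (cong₂ _∧_ (incl≡ i j) (incl≡ j i))))
        (ℕ.≤-trans (ℕ.m≤n+m _ _) small))
      (subst (_∈ˡ map (tabulate (λ _ → false) ,_) (fills (same Q i) (not ∘ incl Q i)))
        (cong (_, tabulate (λ j → L zero (suc j))) (tabulate-cong λ j → sym (¬-not (minimal (suc j)))))
        (∈-map⁺ (tabulate (λ _ → false) ,_) (∈-fills (same Q i) (not ∘ incl Q i) (λ j → L zero (suc j)) agree))))))
    where
    minimal : ∀ w → L w zero ≢ true
    minimal w w<0 = irrefl fr (suc i) (incl⁻ L (max zero ((w , w<0) , (suc i , 0<x))
      (incl⁺ L λ u x<u → <-trans fr 0<x x<u)) (suc i) 0<x)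
    incl≡ : ∀ i j → incl Q i j ≡ incl L (suc i) (suc j)
    incl≡ i j = bool-ext
      (λ p → incl⁺ L λ { zero q → contradiction q (minimal (suc i)) ; (suc w) q → incl⁻ Q p w q })
      (λ p → incl⁺ Q λ w q → incl⁻ L p (suc w) q)
    agree : ∀ j → same Q i j ≡ false → L zero (suc j) ≡ not (incl Q i j)
    agree j differ with incl Q i j in eq
    ... | false = case ¬incl⁻ L (trans (sym (incl≡ i j)) eq) of λ (d , x<d , y≮d) →
      Sum.[ (λ 0<y → 0<y) , (λ y<d → contradiction (trans (sym y≮d) y<d) λ ()) ]′ (free fr 0<x x<d (suc j))
    ... | true  = ¬-not λ 0<y → contradiction
      (trans (sym differ) (trans (incl≡ j i) (max (suc j)
        ((zero , 0<y) , c , incl⁻ L (trans (sym (incl≡ i j)) eq) c x<c) (trans (sym (incl≡ i j)) eq)))) λ ()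

  -- Everything below 0 has a strictly larger up-set than `x` and is therefore minimal. Deleting 0
  -- hides the strictness only for an element whose up-set is that of `x` together with 0; two such
  -- elements are minimal with equal up-sets, hence twins.
  level-code : IsFreeOrder L → (∀ x y → Twins L x y → x ≡ y) → ∀ i → Maximal L (suc i) →
    same L (suc i) zero ≡ true → count (larger L (suc i)) ≤ k → code L ∈ˡ codes₁ k Q
  level-code fr noTwins i max same₀ small = codesAt⊆codes₁ k Q i
    (∈-++⁺ʳ (twinCodes k Q i) (∈-++⁺ʳ (sourceCodes k Q i)
      (∈-concatMap⁺ (levelCodes k Q i) (lose (proj₁ (proj₂ chosen)) (ifSmall⁺ k (larger Q i) small′
        (subst (_∈ˡ map (_, upsets Q i) (fills (larger Q i) (proj₁ chosen)))
          (cong (tabulate (λ j → L (suc j) zero) ,_) (tabulate-cong λ j → bool-ext (x⊆0 (suc j)) (0⊆x (suc j))))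
          (∈-map⁺ (_, upsets Q i) (∈-fills (larger Q i) (proj₁ chosen) (λ j → L (suc j) zero) (proj₂ (proj₂ chosen))))))))))
    where
    x⊆0 : ∀ w → L (suc i) w ≡ true → L zero w ≡ true
    x⊆0 = incl⁻ L (proj₁ (∧⁻ same₀))
    0⊆x : ∀ w → L zero w ≡ true → L (suc i) w ≡ true
    0⊆x = incl⁻ L (proj₂ (∧⁻ {incl L (suc i) zero} same₀))
    x≮0 : L (suc i) zero ≢ true
    x≮0 p = irrefl fr zero (x⊆0 zero p)
    incl→ : ∀ j → incl Q i j ≡ true → incl L (suc i) (suc j) ≡ true
    incl→ j p = incl⁺ L λ { zero q → contradiction q x≮0 ; (suc w) q → incl⁻ Q p w q }
    incl← : ∀ {i j} → incl L (suc i) (suc j) ≡ true → incl Q i j ≡ true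
    incl← p = incl⁺ Q λ w q → incl⁻ L p (suc w) q
    small′ : count (larger Q i) ≤ k
    small′ = ℕ.≤-trans (count-mono (larger Q i) (larger L (suc i) ∘ suc) (λ j p → let (p , q) = ∧⁻ {incl Q i j} p in
      ∧⁺ (incl→ j p) (cong not (¬-not λ r → contradiction (trans (sym q) (cong not (incl← r))) λ ()))))
      (ℕ.≤-trans (ℕ.m≤n+m _ _) small)
    below : ∀ j → L (suc j) zero ≡ true → incl L (suc i) (suc j) ≡ true
    below j y<0 = incl⁺ L λ w x<w → <-trans fr y<0 (x⊆0 w x<w)
    below-minimal : ∀ j → L (suc j) zero ≡ true → ∀ a → L a (suc j) ≡ false
    below-minimal j y<0 a = ¬-not λ a<y → x≮0
      (incl⁻ L (max (suc j) ((a , a<y) , zero , y<0) (below j y<0)) zero y<0)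
    hidden : ∀ j → L (suc j) zero ≡ true → larger Q i j ≡ false → incl Q j i ≡ true
    hidden j y<0 p with incl Q i j in eq | incl Q j i | p
    ... | true  | true  | _ = refl
    ... | false | _     | _ = contradiction (trans (sym eq) (incl← (below j y<0))) λ ()
    hidden⊆ : ∀ j j′ → L (suc j) zero ≡ true → larger Q i j ≡ false → L (suc j′) zero ≡ true →
      ∀ w → L (suc j) w ≡ true → L (suc j′) w ≡ true
    hidden⊆ j j′ y<0 p y′<0 zero    q = y′<0
    hidden⊆ j j′ y<0 p y′<0 (suc w) q = incl⁻ L (below j′ y′<0) (suc w) (incl⁻ Q (hidden j y<0 p) w q)
    hidden-unique : ∀ j j′ → L (suc j) zero ≡ true → larger Q i j ≡ false →
      L (suc j′) zero ≡ true → larger Q i j′ ≡ false → j ≡ j′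
    hidden-unique j j′ p q p′ q′ = Fin.suc-injective (noTwins (suc j) (suc j′) λ w →
      bool-ext (hidden⊆ j j′ p q p′ w) (hidden⊆ j′ j p′ q′ p w) ,
      trans (below-minimal j p w) (sym (below-minimal j′ p′ w)))
    chosen : ∃[ base ] (base ∈ˡ emptyOrSingleton n) × (∀ j → larger Q i j ≡ false → L (suc j) zero ≡ base j)
    chosen with Fin.any? (λ j → (L (suc j) zero ≟ᵇ true) ×-dec (larger Q i j ≟ᵇ false))
    ... | no none = (λ _ → false) , here refl , λ j p → ¬-not λ q → none (j , q , p)
    ... | yes (y , p , q) = _ , there (∈-map⁺ (λ y i → does (y Fin.≟ i)) (∈-allFin y)) , agree
      where
      agree : ∀ j → larger Q i j ≡ false → L (suc j) zero ≡ does (y Fin.≟ j)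
      agree j q′ with y Fin.≟ j
      ... | yes refl = p
      ... | no y≢j   = ¬-not λ p′ → y≢j (hidden-unique y j p q p′ q′)

-- Invariance under relabelling and removable elements

⟨$⟩ʳ-injective : ∀ {n} (π : Permutation′ n) {x y} → π ⟨$⟩ʳ x ≡ π ⟨$⟩ʳ y → x ≡ y
⟨$⟩ʳ-injective π eq = trans (sym (Perm.inverseˡ π)) (trans (cong (π ⟨$⟩ˡ_) eq) (Perm.inverseˡ π))

relabel-free : ∀ {m n} (f : Fin m → Fin n) {L : BRel n} → IsFreeOrder L → IsFreeOrder (relabel f L)
relabel-free f fr = record
  { irrefl  = λ x → irrefl fr (f x)
  ; <-trans = <-trans fr
  ; free    = λ p q y → free fr p q (f y)
  }

module _ {n : ℕ} (L : BRel n) (π : Permutation′ n) where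

  private
    L′ = relabel (π ⟨$⟩ʳ_) L

    πʳ∘πˡ : ∀ x → π ⟨$⟩ʳ (π ⟨$⟩ˡ x) ≡ x
    πʳ∘πˡ x = Perm.inverseʳ π

  relabel-incl : ∀ x y → incl L′ x y ≡ incl L (π ⟨$⟩ʳ x) (π ⟨$⟩ʳ y)
  relabel-incl x y = bool-ext
    (λ p → incl⁺ L λ w q → subst (λ w → L (π ⟨$⟩ʳ y) w ≡ true) (πʳ∘πˡ w)
      (incl⁻ L′ p (π ⟨$⟩ˡ w) (subst (λ w → L (π ⟨$⟩ʳ x) w ≡ true) (sym (πʳ∘πˡ w)) q)))
    (λ p → incl⁺ L′ λ w → incl⁻ L p (π ⟨$⟩ʳ w))

  relabel-middle : ∀ {x} → Middle L′ x → Middle L (π ⟨$⟩ʳ x)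
  relabel-middle ((a , p) , (c , q)) = (_ , p) , (_ , q)

  relabel-maximal : ∀ {x} → Maximal L (π ⟨$⟩ʳ x) → Maximal L′ x
  relabel-maximal {x} max y mid p = trans (relabel-incl y x)
    (max (π ⟨$⟩ʳ y) (relabel-middle mid) (trans (sym (relabel-incl x y)) p))

  relabel-twins : ∀ {x y} → Twins L′ x y → Twins L (π ⟨$⟩ʳ x) (π ⟨$⟩ʳ y)
  relabel-twins {x} {y} tw w = subst (λ w → L (π ⟨$⟩ʳ x) w ≡ L (π ⟨$⟩ʳ y) w × L w (π ⟨$⟩ʳ x) ≡ L w (π ⟨$⟩ʳ y))
    (πʳ∘πˡ w) (tw (π ⟨$⟩ˡ w))

  private
    count-relabel : ∀ (g : Bool → Bool → Bool) x →
      count (λ y → g (incl L′ x y) (incl L′ y x)) ≡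
      count (λ y → g (incl L (π ⟨$⟩ʳ x) y) (incl L y (π ⟨$⟩ʳ x)))
    count-relabel g x = trans
      (Σℕ.sum-cong-≗ λ y → cong (if_then 1 else 0) (cong₂ g (relabel-incl x y) (relabel-incl y x)))
      (sym (count-permute _ π))

  count-same : ∀ x → count (same L′ x) ≡ count (same L (π ⟨$⟩ʳ x))
  count-same = count-relabel _∧_

  count-larger : ∀ x → count (larger L′ x) ≡ count (larger L (π ⟨$⟩ʳ x))
  count-larger = count-relabel (λ a b → a ∧ not b)

Removable : ∀ {n} → (BRel n → List (Subset n × Subset n)) → BRel (suc n) → Fin (suc n) → Set
Removable cs L v = ∀ π → π ⟨$⟩ʳ zero ≡ v →
  code (relabel (π ⟨$⟩ʳ_) L) ∈ˡ cs (tail (relabel (π ⟨$⟩ʳ_) L))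

labelled-suc : ∀ {n} (π : Permutation′ (suc n)) {x} → π ⟨$⟩ʳ zero ≢ x → ∃[ i ] π ⟨$⟩ʳ suc i ≡ x
labelled-suc π {x} 0↛x with π ⟨$⟩ˡ x in eq
... | zero  = contradiction (trans (cong (π ⟨$⟩ʳ_) (sym eq)) (Perm.inverseʳ π)) 0↛x
... | suc i = i , trans (cong (π ⟨$⟩ʳ_) (sym eq)) (Perm.inverseʳ π)

module _ {n : ℕ} (k : ℕ) (L : BRel (suc n)) (fr : IsFreeOrder L) where

  twin-removable : ∀ x z → z ≢ x → Twins L x z → Removable (codes₁ k) L z
  twin-removable x z z≢x tw π refl with labelled-suc π z≢x
  ... | i , refl = twin-code k (relabel (π ⟨$⟩ʳ_) L) i (λ w → tw (π ⟨$⟩ʳ w))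

  source-removable : ∀ x v → Maximal L x → Middle L x → L v x ≡ true → count (same L x) ≤ k →
    Removable (codes₁ k) L v
  source-removable x v max (_ , c , x<c) v<x small π refl with labelled-suc π {x} (λ eq → irrefl fr x (subst (λ v → L v x ≡ true) eq v<x))
  ... | i , refl = source-code k (relabel (π ⟨$⟩ʳ_) L) (relabel-free _ fr) i
    (relabel-maximal L π max) v<x
    ((zero , v<x) , π ⟨$⟩ˡ c , subst (λ c → L x c ≡ true) (sym (Perm.inverseʳ π)) x<c)
    (subst (_≤ k) (sym (count-same L π (suc i))) small)

  level-removable : (∀ x y → Twins L x y → x ≡ y) → ∀ x z → z ≢ x → Maximal L x →
    same L x z ≡ true → count (larger L x) ≤ k → Removable (codes₁ k) L z
  level-removable noTwins x z z≢x max same-xz small π refl with labelled-suc π z≢x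
  ... | i , refl = level-code k (relabel (π ⟨$⟩ʳ_) L) (relabel-free _ fr)
    (λ x y tw → ⟨$⟩ʳ-injective π (noTwins _ _ (relabel-twins L π tw))) i
    (relabel-maximal L π max)
    (trans (cong₂ _∧_ (relabel-incl L π (suc i) zero) (relabel-incl L π zero (suc i))) same-xz)
    (subst (_≤ k) (sym (count-larger L π (suc i))) small)

-- Existence of a removable element

count-unique : ∀ {n} (f : Fin n → Bool) x → (∀ z → f z ≡ true → z ≡ x) → count f ≤ 1
count-unique {suc n} f zero uniq = ℕ.+-mono-≤ {if f zero then 1 else 0} {1} {_} {0} (le (f zero)) (ℕ.≤-reflexive none)
  where
  le : ∀ b → (if b then 1 else 0) ≤ 1
  le true = s≤s z≤n
  le false = z≤n
  none : count (f ∘ suc) ≡ 0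
  none = trans (Σℕ.sum-cong-≗ λ i → cong (if_then 1 else 0) (¬-not λ p → contradiction (uniq (suc i) p) λ ()))
    (Σℕ.sum-replicate-zero n)
count-unique {suc n} f (suc x) uniq
  rewrite ¬-not {f zero} (λ p → contradiction (uniq zero p) λ ()) =
  count-unique (f ∘ suc) x (λ z p → Fin.suc-injective (uniq (suc z) p))

-- The recursion climbs through middle elements with ever more elements above them. Where it stops,
-- a strict inclusion of up-sets would again raise the count.
maximal-middle : ∀ {n} (L : BRel n) x → Middle L x → ∃[ y ] Middle L y × Maximal L y
maximal-middle {n} L x mid = go x mid (<-wellFounded _)
  where
  go : ∀ x → Middle L x → Acc _<_ (n ∸ count (L x)) → ∃[ y ] Middle L y × Maximal L y
  go x mid (acc rec) with Fin.any? (λ y → middle? L y ×-dec (count (L x) ℕ.<? count (L y)))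
  ... | yes (y , mid′ , lt) = go y mid′ (rec (ℕ.∸-monoʳ-< lt (count-≤n (L y))))
  ... | no none = x , mid , λ y mid′ x⊆y → ¬-not λ y⊈x → case ¬incl⁻ L {y} {x} y⊈x of λ (w , yw , xw) →
    none (y , mid′ , count-strict (L x) (L y) (incl⁻ L {x} {y} x⊆y) w xw yw)

module _ {n : ℕ} (k : ℕ) (1≤k : 1 ≤ k) where

  module _ (L : BRel (suc n)) (fr : IsFreeOrder L) (noTwins : ∀ x y → Twins L x y → x ≡ y)
           (x : Fin (suc n)) (mid : Middle L x) (max : Maximal L x) where

    small-same : count (same L x) ≤ k → ∃[ v ] Removable (codes₁ k) L v
    small-same small = let ((v , v<x) , _) = mid in v , source-removable k L fr x v max mid v<x small

    small-larger : count (larger L x) ≤ k → ∃[ v ] Removable (codes₁ k) L v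
    small-larger small with Fin.any? (λ z → ¬? (z Fin.≟ x) ×-dec (same L x z ≟ᵇ true))
    ... | yes (z , z≢x , s) = z , level-removable k L fr noTwins x z z≢x max s small
    -- No other element shares the up-set of `x`, so `Z` has at most one element and something below
    -- `x` can be removed instead; this is where `1 ≤ k` enters.
    ... | no none = small-same (ℕ.≤-trans (count-unique (same L x) x only-x) 1≤k)
      where
      only-x : ∀ z → same L x z ≡ true → z ≡ x
      only-x z s with z Fin.≟ x
      ... | yes z≡x = z≡x
      ... | no z≢x  = contradiction (z , z≢x , s) none

  codes₁-removable : ∀ {L : BRel (suc n)} → ∃[ v ] Removable (codes₁ k) L v → ∃[ v ] Removable (codes k) L v
  codes₁-removable (v , r) = v , λ π eq → ∈-++⁺ˡ (r π eq)

  flip-removable : ∀ {L : BRel (suc n)} → ∃[ v ] Removable (codes₁ k) (flip L) v → ∃[ v ] Removable (codes k) L v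
  flip-removable {L} (v , r) = v , λ π eq → ∈-++⁺ʳ (codes₁ k _) (∈-map⁺ swap (r π eq))

  -- A twin is removable without further ado, so twins may be excluded, as `level-code` demands.
  -- Three disjoint sets among `suc n` elements cannot all have more than `k` elements, and each of
  -- them, if small, makes some element removable.
  removable : suc n < suc k + suc k + suc k → (L : BRel (suc n)) → IsFreeOrder L → ∀ x → Middle L x →
    ∃[ v ] Removable (codes k) L v
  removable n<3k L fr x mid
    with Fin.any? (λ x → Fin.any? λ z → ¬? (z Fin.≟ x) ×-dec
      Fin.all? λ w → (L x w ≟ᵇ L z w) ×-dec (L w x ≟ᵇ L w z))
  ... | yes (x , z , z≢x , tw) = codes₁-removable {L} (z , twin-removable k L fr x z z≢x tw)
  ... | no none = cases (maximal-middle L x mid) (maximal-middle (flip L) x (swap mid))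
    where
    noTwins : ∀ x y → Twins L x y → x ≡ y
    noTwins x y tw with y Fin.≟ x
    ... | yes y≡x = sym y≡x
    ... | no y≢x  = contradiction (x , y , y≢x , tw) none
    cases : ∃[ y ] Middle L y × Maximal L y → ∃[ y ] Middle (flip L) y × Maximal (flip L) y →
      ∃[ v ] Removable (codes k) L v
    cases (x , mid , max) (x′ , mid′ , max′)
      with count (larger L x) ℕ.≤? k | count (same L x) ℕ.≤? k | count (larger (flip L) x′) ℕ.≤? k
    ... | yes p | _ | _ = codes₁-removable {L} (small-larger L fr noTwins x mid max p)
    ... | no _ | yes p | _ = codes₁-removable {L} (small-same L fr noTwins x mid max p)
    ... | no _ | no _ | yes p = flip-removable {L}
      (small-larger (flip L) (flip-free fr) (λ x y tw → noTwins x y (λ w → swap (tw w))) x′ mid′ max′ p)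
    ... | no p | no q | no r = contradiction
      (count-disjoint (larger L x) (same L x) (larger (flip L) x′)
        (λ y l → ¬-not (λ s → contradiction (trans (sym (proj₂ (∧⁻ {incl L x y} l))) (cong not (proj₂ (∧⁻ {incl L x y} s)))) λ ())
               , ¬-not (disjoint y (proj₁ (∧⁻ l))))
        (λ y s → ¬-not (disjoint y (proj₁ (∧⁻ s)))))
      (ℕ.<⇒≱ (ℕ.<-≤-trans n<3k (ℕ.+-mono-≤ (ℕ.+-mono-≤ (ℕ.≰⇒> p) (ℕ.≰⇒> q)) (ℕ.≰⇒> r))))
      where
      -- A common `y` would have elements above it (those above `x`) and below it (those below
      -- `x′`), so it would be middle; maximality of `x′` then rules out a strictly larger down-set.
      disjoint : ∀ y → incl L x y ≡ true → larger (flip L) x′ y ≢ true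
      disjoint y x⊆y l =
        let (x′⊆y , y⊈x′) = ∧⁻ {incl (flip L) x′ y} l
            (_ , a , ax′) = mid′
            (_ , c , xc)  = mid in
        contradiction (trans (sym y⊈x′) (cong not (max′ y
          ((c , incl⁻ L {x} {y} x⊆y c xc) , (a , incl⁻ (flip L) {x′} {y} x′⊆y a ax′)) x′⊆y))) λ ()

-- The number of codes

length-concatMap-≤ : ∀ {A B : Set} (f : A → List B) m → (∀ x → length (f x) ≤ m) →
  ∀ xs → length (concatMap f xs) ≤ length xs * m
length-concatMap-≤ f m f≤m []       = z≤n
length-concatMap-≤ f m f≤m (x ∷ xs) = ℕ.≤-trans (ℕ.≤-reflexive (List.length-++ (f x)))
  (ℕ.+-mono-≤ (f≤m x) (length-concatMap-≤ f m f≤m xs))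

-- One summand for the order and one for its dual: each of the `n` elements gives one twin code, at
-- most `2 ^ k` source codes, and at most `2 ^ k` level codes for each of `suc n` bases.
codesBound : ℕ → ℕ → ℕ
codesBound k n = n * (1 + (2 ^ k + suc n * 2 ^ k)) + n * (1 + (2 ^ k + suc n * 2 ^ k))

module _ {n : ℕ} (k : ℕ) where

  length-ifSmall : ∀ (w base : Fin n → Bool) (f : Subset n → Subset n × Subset n) →
    length (ifSmall k w (map f (fills w base))) ≤ 2 ^ k
  length-ifSmall w base f = length-when (count w ℕ.≤? k) λ small → ℕ.≤-trans
    (ℕ.≤-reflexive (trans (List.length-map f (fills w base)) (length-fills w base))) (ℕ.^-monoʳ-≤ 2 small)

  length-codes₁ : ∀ (L : BRel n) → length (codes₁ k L) ≤ n * (1 + (2 ^ k + suc n * 2 ^ k))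
  length-codes₁ L = subst (λ m → length (codes₁ k L) ≤ m * (1 + (2 ^ k + suc n * 2 ^ k))) (List.length-tabulate {n = n} (λ i → i))
    (length-concatMap-≤ (codesAt k L) _ (λ x → s≤s (ℕ.≤-trans
      (ℕ.≤-reflexive (List.length-++ (sourceCodes k L x)))
      (ℕ.+-mono-≤ (length-ifSmall (same L x) _ _)
        (subst (λ m → length (concatMap (levelCodes k L x) (emptyOrSingleton n)) ≤ m * 2 ^ k)
          (cong suc (trans (List.length-map _ (allFin n)) (List.length-tabulate {n = n} (λ i → i))))
          (length-concatMap-≤ (levelCodes k L x) (2 ^ k) (λ base → length-ifSmall (larger L x) base _) (emptyOrSingleton n))))))
      (allFin n))

  length-codes : ∀ (L : BRel n) → length (codes k L) ≤ codesBound k n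
  length-codes L = ℕ.≤-trans (ℕ.≤-reflexive (trans (List.length-++ (codes₁ k L))
    (cong (length (codes₁ k L) +_) (List.length-map swap (codes₁ k (flip L))))))
    (ℕ.+-mono-≤ (length-codes₁ L) (length-codes₁ (flip L)))

-- Transversals and their sizes

-- With propositional equality this describes the labelled lists, with isomorphism the unlabelled
-- ones, so that one comparison lemma serves both.
record Transversal (S : Setoid 0ℓ 0ℓ) (P : Setoid.Carrier S → Set) (xs : List (Setoid.Carrier S)) : Set where
  open Setoid S using (_≈_)
  field
    unique   : Setoid-Unique.Unique S xs
    sound    : ∀ {x} → x ∈ˡ xs → P x
    complete : ∀ x → P x → ∃[ y ] y ∈ˡ xs × x ≈ y

open Transversal

-- The injection is a relation: an image merely has to exist, and repetitions in `ys` only weaken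
-- the bound. `B` may live at any level because graphs will also be counted by classes, which are
-- predicates.
length-≤ : ∀ {ℓ} (S : Setoid 0ℓ 0ℓ) {B : Set ℓ} {xs : List (Setoid.Carrier S)} {ys : List B}
  (ρ : Setoid.Carrier S → B → Set) → Setoid-Unique.Unique S xs →
  (∀ {x} → x ∈ˡ xs → ∃[ y ] y ∈ˡ ys × ρ x y) →
  (∀ {x x′ y} → ρ x y → ρ x′ y → Setoid._≈_ S x x′) → length xs ≤ length ys
length-≤ S {xs = xs} {ys} ρ xs! image injective = Fin.injective⇒≤ {f = f} f-injective
  where
  f : Fin (length xs) → Fin (length ys)
  f i = Any.index (proj₁ (proj₂ (image (∈-lookup i))))
  f-ρ : ∀ i → ρ (List.lookup xs i) (List.lookup ys (f i))
  f-ρ i = let (y , y∈ys , r) = image (∈-lookup i) in subst (ρ (List.lookup xs i)) (Any.lookup-index y∈ys) r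
  f-injective : ∀ {i j} → f i ≡ f j → i ≡ j
  f-injective {i} {j} eq = lookup-injective S (λ _ → ℕ) xs! i j
    (injective (f-ρ i) (subst (λ l → ρ (List.lookup xs j) (List.lookup ys l)) (sym eq) (f-ρ j)))

length-split : ∀ {A : Set} {P : Pred A 0ℓ} (P? : Decidable P) xs →
  length xs ≡ length (filter P? xs) + length (filter (¬? ∘ P?) xs)
length-split P? [] = refl
length-split P? (x ∷ xs) with P? x
... | yes _ = cong suc (length-split P? xs)
... | no _  = trans (cong suc (length-split P? xs)) (sym (ℕ.+-suc _ _))

filter-unique : ∀ (S : Setoid 0ℓ 0ℓ) {P : Pred (Setoid.Carrier S) 0ℓ} (P? : Decidable P) {xs} →
  Setoid-Unique.Unique S xs → Setoid-Unique.Unique S (filter P? xs)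
filter-unique S P? = AllPairs.filter⁺ P?

labelled-transversal : ∀ {A : Set} {P : Pred A 0ℓ} (P? : Decidable P) {xs} →
  Setoid-Unique.Unique (setoid A) xs → (∀ x → x ∈ˡ xs) → Transversal (setoid A) P (filter P? xs)
labelled-transversal {A} P? {xs} xs! all = record
  { unique   = filter-unique (setoid A) P? xs!
  ; sound    = λ x∈ → proj₂ (∈-filter⁻ P? {xs = xs} x∈)
  ; complete = λ x px → x , ∈-filter⁺ P? (all x) px , refl
  }

unlabelled-transversal : ∀ (D : DecSetoid 0ℓ 0ℓ) {P : Pred (DecSetoid.Carrier D) 0ℓ} (P? : Decidable P) {xs} →
  (∀ x → x ∈ˡ xs) → Transversal (DecSetoid.setoid D) P (List.deduplicate (DecSetoid._≟_ D) (filter P? xs))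
unlabelled-transversal D {P} P? {xs} all = record
  { unique   = DecSetoid-Unique.deduplicate-! D (filter P? xs)
  ; sound    = All.lookup (All.deduplicate⁺ _≟_ (All.all-filter P? xs))
  ; complete = λ x px → locate (Any.deduplicate⁺ _≟_ (λ y≈z x≈z → ≈-trans x≈z (≈-sym y≈z))
      (lose (∈-filter⁺ P? (all x) px) ≈-refl))
  }
  where
  open DecSetoid D using (_≈_; _≟_) renaming (sym to ≈-sym; refl to ≈-refl; trans to ≈-trans)
  locate : ∀ {x ys} → Any (x ≈_) ys → ∃[ y ] y ∈ˡ ys × x ≈ y
  locate (here p)  = _ , here refl , p
  locate (there p) = let (y , y∈ , q) = locate p in y , there y∈ , q

posetSetoid : ℕ → Setoid 0ℓ 0ℓ
posetSetoid n = DecSetoid.setoid (posetCodes-decSetoid n)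
graphSetoid : ℕ → Setoid 0ℓ 0ℓ
graphSetoid n = DecSetoid.setoid (graphCodes-decSetoid n)

posets-lbl : ∀ n → Transversal (setoid (FinRel n)) IsPosetCode (posets n)
posets-lbl n = labelled-transversal isPosetCode? (relations-! n) ∈-relations

graphs-lbl : ∀ n → Transversal (setoid (GraphCode n)) IsBicolouredGraph (bicolouredGraphs n)
graphs-lbl n = labelled-transversal isBicolouredGraph? (graphCodes-! n) ∈-graphCodes

posets-unl : ∀ n → Transversal (posetSetoid n) IsPosetCode (List.deduplicate _≅ₚ?_ (posets n))
posets-unl n = unlabelled-transversal (posetCodes-decSetoid n) isPosetCode? ∈-relations

graphs-unl : ∀ n → Transversal (graphSetoid n) IsBicolouredGraph (List.deduplicate _≅ᵍ?_ (bicolouredGraphs n))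
graphs-unl n = unlabelled-transversal (graphCodes-decSetoid n) isBicolouredGraph? ∈-graphCodes

-- Posets, strict orders and bicoloured graphs

entry : ∀ {n} → FinRel n → BRel n
entry R i j = lookup (lookup R i) j

fromEntries : ∀ {n} → BRel n → FinRel n
fromEntries L = tabulate λ i → tabulate (L i)

entry-fromEntries : ∀ {n} (L : BRel n) i j → entry (fromEntries L) i j ≡ L i j
entry-fromEntries L i j = trans (cong (λ r → lookup r j) (lookup∘tabulate (λ i → tabulate (L i)) i)) (lookup∘tabulate (L i) j)

lookup-ext : ∀ {A : Set} {n} {u v : Vec A n} → (∀ i → lookup u i ≡ lookup v i) → u ≡ v
lookup-ext {u = []}    {[]}    eq = refl
lookup-ext {u = x ∷ u} {y ∷ v} eq = cong₂ _∷_ (eq zero) (lookup-ext (λ i → eq (suc i)))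

entry-ext : ∀ {n} {R S : FinRel n} → (∀ i j → entry R i j ≡ entry S i j) → R ≡ S
entry-ext eq = lookup-ext λ i → lookup-ext (eq i)

⟦⟧⁺ : ∀ {n} (R : FinRel n) {i j} → entry R i j ≡ true → ⟦ R ⟧ i j
⟦⟧⁺ R {i} = lookup-true (lookup R i)

⟦⟧⁻ : ∀ {n} (R : FinRel n) {i j} → ⟦ R ⟧ i j → entry R i j ≡ true
⟦⟧⁻ R = ∈-lookup-true

preserves⁻ : ∀ {n} (π : Permutation′ n) {R S} → PreservesRel π R S →
  ∀ i j → entry R i j ≡ entry S (π ⟨$⟩ʳ i) (π ⟨$⟩ʳ j)
preserves⁻ π {R} {S} pres i j = bool-ext
  (λ p → ⟦⟧⁻ S (Equivalence.to (pres i j) (⟦⟧⁺ R p))) (λ p → ⟦⟧⁻ R (Equivalence.from (pres i j) (⟦⟧⁺ S p)))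

preserves⁺ : ∀ {n} (π : Permutation′ n) {R S} →
  (∀ i j → entry R i j ≡ entry S (π ⟨$⟩ʳ i) (π ⟨$⟩ʳ j)) → PreservesRel π R S
preserves⁺ π {R} {S} eq i j = mk⇔
  (λ p → ⟦⟧⁺ S (trans (sym (eq i j)) (⟦⟧⁻ R p))) (λ p → ⟦⟧⁺ R (trans (eq i j) (⟦⟧⁻ S p)))

strict : ∀ {n} → FinRel n → BRel n
strict R i j = not (does (i Fin.≟ j)) ∧ entry R i j

reflexive : ∀ {n} → BRel n → FinRel n
reflexive L = fromEntries λ i j → does (i Fin.≟ j) ∨ L i j

strict⁻ : ∀ {n} (R : FinRel n) {i j} → strict R i j ≡ true → i ≢ j × ⟦ R ⟧ i j
strict⁻ R {i} {j} p with i Fin.≟ j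
... | no i≢j = i≢j , ⟦⟧⁺ R p

strict⁺ : ∀ {n} (R : FinRel n) {i j} → i ≢ j → ⟦ R ⟧ i j → strict R i j ≡ true
strict⁺ R {i} {j} i≢j p rewrite dec-false (i Fin.≟ j) i≢j = ⟦⟧⁻ R p

strict-free : ∀ {n} (R : FinRel n) → IsPosetCode R → IsFreeOrder (strict R)
strict-free R (po , fr) = record
  { irrefl  = λ x p → proj₁ (strict⁻ R p) refl
  ; <-trans = tr
  ; free    = λ {a} {b} {c} p q y → frees a b c p q y
  }
  where
  module po = IsPartialOrder po
  tr : ∀ {x y z} → strict R x y ≡ true → strict R y z ≡ true → strict R x z ≡ true
  tr p q = let (x≢y , x≤y) = strict⁻ R p ; (y≢z , y≤z) = strict⁻ R q in
    strict⁺ R (λ { refl → x≢y (po.antisym x≤y y≤z) }) (po.trans x≤y y≤z)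
  frees : ∀ a b c → strict R a b ≡ true → strict R b c ≡ true → ∀ y → strict R a y ≡ true ⊎ strict R y c ≡ true
  frees a b c p q y with strict R a y ≟ᵇ true | strict R y c ≟ᵇ true
  ... | yes r | _     = inj₁ r
  ... | no _  | yes r = inj₂ r
  -- Failing both alternatives, `y` is incomparable to `a`, `b` and `c`, as any comparability would
  -- give `a ≤ y` or `y ≤ c` by transitivity. Equality `a = y` is no escape, since it gives `y < c`,
  -- and dually for `y = c`.
  ... | no a≮y | no y≮c = let (a≢b , a≤b) = strict⁻ R p ; (b≢c , b≤c) = strict⁻ R q in
    ⊥-elim (fr (a , b , c , y , (a≤b , a≢b) , (b≤c , b≢c) ,
      ((λ y≤a → y≰c (po.trans y≤a (po.trans a≤b b≤c))) , a≰y) ,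
      ((λ y≤b → y≰c (po.trans y≤b b≤c)) , λ b≤y → a≰y (po.trans a≤b b≤y)) ,
      y≰c , λ c≤y → a≰y (po.trans a≤b (po.trans b≤c c≤y))))
    where
    a≰y : ¬ ⟦ R ⟧ a y
    a≰y a≤y with a Fin.≟ y
    ... | yes refl = y≮c (tr p q)
    ... | no a≢y   = a≮y (⟦⟧⁻ R a≤y)
    y≰c : ¬ ⟦ R ⟧ y c
    y≰c y≤c with y Fin.≟ c
    ... | yes refl = a≮y (tr p q)
    ... | no _     = y≮c (⟦⟧⁻ R y≤c)

strict-reflexive : ∀ {n} {L : BRel n} → IsFreeOrder L → ∀ i j → strict (reflexive L) i j ≡ L i j
strict-reflexive {L = L} fr i j
  rewrite entry-fromEntries (λ i j → does (i Fin.≟ j) ∨ L i j) i j with i Fin.≟ j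
... | yes refl = sym (¬-not (IsFreeOrder.irrefl fr i))
... | no _     = refl

reflexive⁻ : ∀ {n} (L : BRel n) {i j} → ⟦ reflexive L ⟧ i j → i ≡ j ⊎ L i j ≡ true
reflexive⁻ L {i} {j} p with i Fin.≟ j | trans (sym (entry-fromEntries (λ i j → does (i Fin.≟ j) ∨ L i j) i j)) (⟦⟧⁻ (reflexive L) p)
... | yes i≡j | _ = inj₁ i≡j
... | no _    | q = inj₂ q

reflexive-refl : ∀ {n} (L : BRel n) i → ⟦ reflexive L ⟧ i i
reflexive-refl L i = ⟦⟧⁺ (reflexive L) (trans (entry-fromEntries (λ i j → does (i Fin.≟ j) ∨ L i j) i i)
  (cong (_∨ L i i) (dec-true (i Fin.≟ i) refl)))

reflexive-incl : ∀ {n} (L : BRel n) {i j} → L i j ≡ true → ⟦ reflexive L ⟧ i j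
reflexive-incl L {i} {j} p = ⟦⟧⁺ (reflexive L) (trans (entry-fromEntries (λ i j → does (i Fin.≟ j) ∨ L i j) i j) (lem (does (i Fin.≟ j))))
  where
  lem : ∀ b → b ∨ L i j ≡ true
  lem true  = refl
  lem false = p

reflexive-isPoset : ∀ {n} {L : BRel n} → IsFreeOrder L → IsPosetCode (reflexive L)
reflexive-isPoset {L = L} fr = record
  { isPreorder = record
    { isEquivalence = ≡.isEquivalence
    ; reflexive     = λ { refl → reflexive-refl L _ }
    ; trans         = tr
    }
  ; antisym = anti
  } , λ { (a , b , c , d , (a≤b , a≢b) , (b≤c , b≢c) , (d≰a , a≰d) , _ , (d≰c , c≰d)) →
      Sum.[ (λ p → a≰d (reflexive-incl L p)) , (λ p → d≰c (reflexive-incl L p)) ]′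
        (IsFreeOrder.free fr (lt a≤b a≢b) (lt b≤c b≢c) d) }
  where
  lt : ∀ {i j} → ⟦ reflexive L ⟧ i j → i ≢ j → L i j ≡ true
  lt p i≢j = Sum.[ (λ i≡j → contradiction i≡j i≢j) , (λ q → q) ]′ (reflexive⁻ L p)
  tr : ∀ {x y z} → ⟦ reflexive L ⟧ x y → ⟦ reflexive L ⟧ y z → ⟦ reflexive L ⟧ x z
  tr p q with reflexive⁻ L p | reflexive⁻ L q
  ... | inj₁ refl | _         = q
  ... | inj₂ _    | inj₁ refl = p
  ... | inj₂ p′   | inj₂ q′   = reflexive-incl L (IsFreeOrder.<-trans fr p′ q′)
  anti : ∀ {x y} → ⟦ reflexive L ⟧ x y → ⟦ reflexive L ⟧ y x → x ≡ y
  anti p q with reflexive⁻ L p | reflexive⁻ L q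
  ... | inj₁ x≡y | _        = x≡y
  ... | inj₂ _   | inj₁ y≡x = sym y≡x
  ... | inj₂ p′  | inj₂ q′  = contradiction (IsFreeOrder.<-trans fr p′ q′) (IsFreeOrder.irrefl fr _)

strict-preserves : ∀ {n} (π : Permutation′ n) {R S} → IsPosetCode R → IsPosetCode S →
  (∀ i j → strict R i j ≡ strict S (π ⟨$⟩ʳ i) (π ⟨$⟩ʳ j)) → PreservesRel π R S
strict-preserves π {R} {S} pR pS eq = preserves⁺ π {R} {S} entries
  where
  entries : ∀ i j → entry R i j ≡ entry S (π ⟨$⟩ʳ i) (π ⟨$⟩ʳ j)
  entries i j with i Fin.≟ j | π ⟨$⟩ʳ i Fin.≟ π ⟨$⟩ʳ j | eq i j
  ... | yes refl | _       | _ = trans (⟦⟧⁻ R (IsPartialOrder.refl (proj₁ pR))) (sym (⟦⟧⁻ S (IsPartialOrder.refl (proj₁ pS))))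
  ... | no i≢j   | yes π≡  | _ = contradiction (⟨$⟩ʳ-injective π π≡) i≢j
  ... | no _     | no _    | e = e

preserves-id : ∀ {n} {R S : FinRel n} → PreservesRel Perm.id R S → R ≡ S
preserves-id {R = R} {S} pres = entry-ext (preserves⁻ Perm.id {R} {S} pres)

preserves-strict : ∀ {n} (π : Permutation′ n) {R S} → PreservesRel π R S →
  ∀ i j → strict R i j ≡ strict S (π ⟨$⟩ʳ i) (π ⟨$⟩ʳ j)
preserves-strict π {R} {S} pres i j = cong₂ _∧_ (cong not (bool-ext
  (λ p → dec-true (_ Fin.≟ _) (cong (π ⟨$⟩ʳ_) (does⁻ (i Fin.≟ j) p)))
  (λ p → dec-true (i Fin.≟ j) (⟨$⟩ʳ-injective π (does⁻ (_ Fin.≟ _) p)))))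
  (preserves⁻ π {R} {S} pres i j)

-- Posets without middle elements as bicoloured graphs

HasMiddle : ∀ {n} → FinRel n → Set
HasMiddle R = ∃[ x ] Middle (strict R) x

hasMiddle? : ∀ {n} (R : FinRel n) → Dec (HasMiddle R)
hasMiddle? R = Fin.any? (middle? (strict R))

isMinimal? : ∀ {n} (R : FinRel n) i → Dec (∀ a → strict R a i ≡ false)
isMinimal? R i = Fin.all? λ a → strict R a i ≟ᵇ false

-- An element comparable to no other could take either colour; being minimal, it goes to `A`. The
-- poset is recovered from the edges alone.
toGraph : ∀ {n} → FinRel n → GraphCode n
toGraph R = tabulate (λ i → does (isMinimal? R i)) , fromEntries (strict R)

toGraph-isBicoloured : ∀ {n} (R : FinRel n) → ¬ HasMiddle R → IsBicolouredGraph (toGraph R)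
toGraph-isBicoloured R flat i j p =
  lookup-true A (trans (lookup∘tabulate _ i) (dec-true (isMinimal? R i)
    λ a → ¬-not λ a<i → flat (i , (a , a<i) , (j , i<j)))) ,
  λ j∈A → contradiction (trans (sym i<j)
    (does⁻ (isMinimal? R j) (trans (sym (lookup∘tabulate _ j)) (∈-lookup-true j∈A)) i)) λ ()
  where
  A = tabulate (λ i → does (isMinimal? R i))
  i<j : strict R i j ≡ true
  i<j = trans (sym (entry-fromEntries (strict R) i j)) (⟦⟧⁻ (fromEntries (strict R)) p)

toGraph-reflects : ∀ {n} (π : Permutation′ n) {R S} → IsPosetCode R → IsPosetCode S →
  PreservesRel π (proj₂ (toGraph R)) (proj₂ (toGraph S)) → PreservesRel π R S
toGraph-reflects π {R} {S} pR pS pres = strict-preserves π {R} {S} pR pS λ i j → trans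
  (sym (entry-fromEntries (strict R) i j))
  (trans (preserves⁻ π {fromEntries (strict R)} {fromEntries (strict S)} pres i j) (entry-fromEntries (strict S) _ _))

toPoset : ∀ {n} → GraphCode n → FinRel n
toPoset (A , E) = reflexive (entry E)

edge : ∀ {n} ((A , E) : GraphCode n) → IsBicolouredGraph (A , E) →
  ∀ {i j} → entry E i j ≡ true → lookup A i ≡ true × lookup A j ≡ false
edge (A , E) bc {i} {j} p = let (i∈A , j∉A) = bc i j (⟦⟧⁺ E p) in
  ∈-lookup-true i∈A , ¬-not λ q → j∉A (lookup-true A q)

bicoloured-free : ∀ {n} ((A , E) : GraphCode n) → IsBicolouredGraph (A , E) → IsFreeOrder (entry E)
bicoloured-free G bc = record
  { irrefl  = λ x p → noPath p p
  ; <-trans = λ p q → contradiction q (noPath p)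
  ; free    = λ p q → contradiction q (noPath p)
  }
  where
  noPath : ∀ {x y z} → entry (proj₂ G) x y ≡ true → entry (proj₂ G) y z ≢ true
  noPath p q = contradiction (trans (sym (proj₂ (edge G bc p))) (proj₁ (edge G bc q))) λ ()

-- An isolated vertex of A is the only obstruction to recovering A from E.
IsolatedAt : ∀ {n} → GraphCode n → Fin n → Set
IsolatedAt (A , E) i = lookup A i ≡ true × ∀ j → entry E i j ≡ false

HasIsolated : ∀ {n} → GraphCode n → Set
HasIsolated G = ∃[ i ] IsolatedAt G i

hasIsolated? : ∀ {n} (G : GraphCode n) → Dec (HasIsolated G)
hasIsolated? (A , E) = Fin.any? λ i → (lookup A i ≟ᵇ true) ×-dec Fin.all? λ j → entry E i j ≟ᵇ false

source⁺ : ∀ {n} ((A , E) : GraphCode n) → ¬ HasIsolated (A , E) → ∀ {i} → lookup A i ≡ true → ∃[ j ] entry E i j ≡ true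
source⁺ (A , E) noIso {i} p with Fin.any? (λ j → entry E i j ≟ᵇ true)
... | yes q = q
... | no ¬q = contradiction (i , p , λ j → ¬-not λ e → ¬q (j , e)) noIso

-- Without isolated vertices in `A`, lying in `A` means having an outgoing edge, which an
-- isomorphism of the posets preserves.
toPoset-reflects : ∀ {n} (π : Permutation′ n) {G H : GraphCode n} →
  IsBicolouredGraph G → IsBicolouredGraph H → ¬ HasIsolated G → ¬ HasIsolated H →
  PreservesRel π (toPoset G) (toPoset H) →
  (∀ i → lookup (proj₁ G) i ≡ lookup (proj₁ H) (π ⟨$⟩ʳ i)) ×
  (∀ i j → entry (proj₂ G) i j ≡ entry (proj₂ H) (π ⟨$⟩ʳ i) (π ⟨$⟩ʳ j))
toPoset-reflects π {G} {H} bG bH isoG isoH pres = (λ i → bool-ext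
    (λ p → let (j , e) = source⁺ G isoG p in proj₁ (edge H bH (trans (sym (edges i j)) e)))
    (λ p → let (j , e) = source⁺ H isoH p in proj₁ (edge G bG (trans (edges i (π ⟨$⟩ˡ j))
      (subst (λ j → entry (proj₂ H) (π ⟨$⟩ʳ i) j ≡ true) (sym (Perm.inverseʳ π)) e)))))
  , edges
  where
  edges : ∀ i j → entry (proj₂ G) i j ≡ entry (proj₂ H) (π ⟨$⟩ʳ i) (π ⟨$⟩ʳ j)
  edges i j = trans (sym (strict-reflexive (bicoloured-free G bG) i j))
    (trans (preserves-strict π {toPoset G} {toPoset H} pres i j) (strict-reflexive (bicoloured-free H bH) _ _))

sets⁺ : ∀ {n} (π : Permutation′ n) {A B : Subset n} → (∀ i → lookup A i ≡ lookup B (π ⟨$⟩ʳ i)) → PreservesSet π A B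
sets⁺ π {A} {B} eq i = mk⇔ (λ p → lookup-true B (trans (sym (eq i)) (∈-lookup-true p)))
  (λ p → lookup-true A (trans (eq i) (∈-lookup-true p)))

sets⁻ : ∀ {n} (π : Permutation′ n) {A B : Subset n} → PreservesSet π A B → ∀ i → lookup A i ≡ lookup B (π ⟨$⟩ʳ i)
sets⁻ π {A} {B} pres i = bool-ext (λ p → ∈-lookup-true (Equivalence.to (pres i) (lookup-true A p)))
  (λ p → ∈-lookup-true (Equivalence.from (pres i) (lookup-true B p)))

setoidOf : ∀ {A : Set} {_≈_ : A → A → Set} → IsEquivalence _≈_ → Setoid 0ℓ 0ℓ
setoidOf eq = record { isEquivalence = eq }

module _ {n : ℕ} {_≈ₚ_ : FinRel n → FinRel n → Set} {_≈ᵍ_ : GraphCode n → GraphCode n → Set}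
         (≈ₚ-eq : IsEquivalence _≈ₚ_) (≈ᵍ-eq : IsEquivalence _≈ᵍ_)
         {ps : List (FinRel n)} {gs : List (GraphCode n)}
         (tₚ : Transversal (setoidOf ≈ₚ-eq) IsPosetCode ps)
         (tᵍ : Transversal (setoidOf ≈ᵍ-eq) IsBicolouredGraph gs) where

  private
    Sₚ Sᵍ : Setoid 0ℓ 0ℓ
    Sₚ = setoidOf ≈ₚ-eq
    Sᵍ = setoidOf ≈ᵍ-eq

  -- The equivalences are parameters because the argument is the same up to equality and up to
  -- isomorphism; only `reflects` depends on the case.
  flat-≤ : (∀ {R R′} → IsPosetCode R → IsPosetCode R′ → toGraph R ≈ᵍ toGraph R′ → R ≈ₚ R′) →
    length (filter (¬? ∘ hasMiddle?) ps) ≤ length gs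
  flat-≤ reflects = length-≤ Sₚ (λ R G → IsPosetCode R × toGraph R ≈ᵍ G)
    (filter-unique Sₚ (¬? ∘ hasMiddle?) (unique tₚ))
    (λ {R} R∈ → let (R∈ps , flat) = ∈-filter⁻ (¬? ∘ hasMiddle?) {xs = ps} R∈
                    (G , G∈ , iso) = complete tᵍ (toGraph R) (toGraph-isBicoloured R flat)
                in G , G∈ , sound tₚ R∈ps , iso)
    (λ (pR , i) (pR′ , i′) → reflects pR pR′ (IsEquivalence.trans ≈ᵍ-eq i (IsEquivalence.sym ≈ᵍ-eq i′)))

  noIsolated-≤ : (∀ {G H} → IsBicolouredGraph G → IsBicolouredGraph H → ¬ HasIsolated G → ¬ HasIsolated H →
      toPoset G ≈ₚ toPoset H → G ≈ᵍ H) →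
    length (filter (¬? ∘ hasIsolated?) gs) ≤ length ps
  noIsolated-≤ reflects = length-≤ Sᵍ
    (λ G R → IsBicolouredGraph G × ¬ HasIsolated G × toPoset G ≈ₚ R)
    (filter-unique Sᵍ (¬? ∘ hasIsolated?) (unique tᵍ))
    (λ {G} G∈ → let (G∈gs , noIso) = ∈-filter⁻ (¬? ∘ hasIsolated?) {xs = gs} G∈
                    (R , R∈ , iso) = complete tₚ (toPoset G) (reflexive-isPoset (bicoloured-free G (sound tᵍ G∈gs)))
                in R , R∈ , sound tᵍ G∈gs , noIso , iso)
    (λ (bG , n , i) (bH , n′ , i′) → reflects bG bH n n′ (IsEquivalence.trans ≈ₚ-eq i (IsEquivalence.sym ≈ₚ-eq i′)))

≡⇒preserves-id : ∀ {n} {R S : FinRel n} → R ≡ S → PreservesRel Perm.id R S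
≡⇒preserves-id {R = R} refl = preserves⁺ Perm.id {R} {R} λ i j → refl

flat-lbl : ∀ n → length (filter (¬? ∘ hasMiddle?) (posets n)) ≤ b-lbl n
flat-lbl n = subst (length (filter (¬? ∘ hasMiddle?) (posets n)) ≤_) (length-bicolouredGraphs n)
  (flat-≤ ≡.isEquivalence ≡.isEquivalence (posets-lbl n) (graphs-lbl n)
    (λ {R} {R′} pR pR′ eq → preserves-id {R = R} {R′} (toGraph-reflects Perm.id {R} {R′} pR pR′
      (≡⇒preserves-id (cong proj₂ eq)))))

flat-unl : ∀ n → length (filter (¬? ∘ hasMiddle?) (List.deduplicate _≅ₚ?_ (posets n))) ≤ b-unl n
flat-unl n = flat-≤ ≅ₚ-isEquivalence ≅ᵍ-isEquivalence (posets-unl n) (graphs-unl n)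
  (λ {R} {R′} pR pR′ (π , _ , pres) → π , toGraph-reflects π {R} {R′} pR pR′ pres)

noIsolated-lbl : ∀ n → length (filter (¬? ∘ hasIsolated?) (bicolouredGraphs n)) ≤ p-lbl n
noIsolated-lbl n = noIsolated-≤ ≡.isEquivalence ≡.isEquivalence (posets-lbl n) (graphs-lbl n)
  (λ {G} {H} bG bH isoG isoH eq → let
      (sets , edges) = toPoset-reflects Perm.id {G} {H} bG bH isoG isoH (≡⇒preserves-id eq)
    in cong₂ _,_ (lookup-ext sets) (entry-ext edges))

noIsolated-unl : ∀ n → length (filter (¬? ∘ hasIsolated?) (List.deduplicate _≅ᵍ?_ (bicolouredGraphs n))) ≤ p-unl n
noIsolated-unl n = noIsolated-≤ ≅ₚ-isEquivalence ≅ᵍ-isEquivalence (posets-unl n) (graphs-unl n)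
  (λ {G} {H} bG bH isoG isoH (π , pres) → let
      (sets , edges) = toPoset-reflects π {G} {H} bG bH isoG isoH pres
    in π , sets⁺ π sets , preserves⁺ π {proj₂ G} {proj₂ H} edges)

-- Deleting an element from a poset with middle elements

∘ₚ-relabel : ∀ {n} {A : Set} (π ρ : Permutation′ n) {f g : Fin n → A} → (∀ i → f (π ⟨$⟩ʳ i) ≡ g (ρ ⟨$⟩ʳ i)) →
  ∀ i → f i ≡ g ((Perm.flip π Perm.∘ₚ ρ) ⟨$⟩ʳ i)
∘ₚ-relabel π ρ {f} eq i = trans (cong f (sym (Perm.inverseʳ π))) (eq (π ⟨$⟩ˡ i))

∘ₚ-relabel₂ : ∀ {n} (π ρ : Permutation′ n) {f g : BRel n} →
  (∀ i j → relabel (π ⟨$⟩ʳ_) f i j ≡ relabel (ρ ⟨$⟩ʳ_) g i j) →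
  ∀ i j → f i j ≡ relabel ((Perm.flip π Perm.∘ₚ ρ) ⟨$⟩ʳ_) g i j
∘ₚ-relabel₂ π ρ {f} eq i j = trans (cong₂ f (sym (Perm.inverseʳ π)) (sym (Perm.inverseʳ π))) (eq (π ⟨$⟩ˡ i) (π ⟨$⟩ˡ j))

relabel-cancel : ∀ {n} {A : Set} (π : Permutation′ n) {f g : Fin n → A} →
  (∀ i → f (π ⟨$⟩ʳ i) ≡ g (π ⟨$⟩ʳ i)) → ∀ i → f i ≡ g i
relabel-cancel π {f} {g} eq i = subst (λ i → f i ≡ g i) (Perm.inverseʳ π) (eq (π ⟨$⟩ˡ i))

relabel-cancel₂ : ∀ {n} (π : Permutation′ n) {f g : BRel n} →
  (∀ i j → relabel (π ⟨$⟩ʳ_) f i j ≡ relabel (π ⟨$⟩ʳ_) g i j) → ∀ i j → f i j ≡ g i j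
relabel-cancel₂ π {f} {g} eq i j = subst₂ (λ i j → f i j ≡ g i j) (Perm.inverseʳ π) (Perm.inverseʳ π)
  (eq (π ⟨$⟩ˡ i) (π ⟨$⟩ˡ j))

-- Labels `v` by zero and the other elements as in the representative. Since `σ` goes from the
-- deleted structure to the representative, it has to be flipped.
frame : ∀ {n} → Fin (suc n) → Permutation′ n → Permutation′ (suc n)
frame v σ = Perm.insert zero v (Perm.flip σ)

frame-suc : ∀ {n} v (σ : Permutation′ n) i → frame v σ ⟨$⟩ʳ suc i ≡ punchIn v (σ ⟨$⟩ˡ i)
frame-suc v σ i = Perm.insert-punchIn zero v (Perm.flip σ) i

tabulate-injective : ∀ {A : Set} {n} {f g : Fin n → A} → tabulate f ≡ tabulate g → ∀ i → f i ≡ g i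
tabulate-injective {f = f} {g} eq i =
  trans (sym (lookup∘tabulate f i)) (trans (cong (λ v → lookup v i) eq) (lookup∘tabulate g i))

code-determines : ∀ {n} {L L′ : BRel (suc n)} → L zero zero ≢ true → L′ zero zero ≢ true →
  (∀ i j → tail L i j ≡ tail L′ i j) → code L ≡ code L′ → ∀ i j → L i j ≡ L′ i j
code-determines irr irr′ tails eq zero    zero    = trans (¬-not irr) (sym (¬-not irr′))
code-determines irr irr′ tails eq zero    (suc j) = tabulate-injective (cong proj₂ eq) j
code-determines irr irr′ tails eq (suc i) zero    = tabulate-injective (cong proj₁ eq) i
code-determines irr irr′ tails eq (suc i) (suc j) = tails i j

-- The added one keeps the bound positive even when `suc n` is less than three.
codeSize : ℕ → ℕ
codeSize n = suc (suc n / 3)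

n<3codeSize : ∀ n → suc n < suc (codeSize n) + suc (codeSize n) + suc (codeSize n)
n<3codeSize n = begin-strict
  suc n                                ≡⟨ m≡m%n+[m/n]*n (suc n) 3 ⟩
  suc n % 3 + q * 3                    <⟨ ℕ.+-monoˡ-< (q * 3) (m%n<n (suc n) 3) ⟩
  3 + q * 3                            ≡⟨⟩
  suc q * 3                            ≤⟨ ℕ.*-monoˡ-≤ 3 (ℕ.n≤1+n (suc q)) ⟩
  suc (suc q) * 3                      ≡⟨ ℕ.*-comm (suc (suc q)) 3 ⟩
  suc (suc q) + (suc (suc q) + (suc (suc q) + 0)) ≡⟨ cong (λ z → suc (suc q) + (suc (suc q) + z)) (ℕ.+-identityʳ _) ⟩
  suc (suc q) + (suc (suc q) + suc (suc q)) ≡⟨ ℕ.+-assoc (suc (suc q)) _ _ ⟨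
  suc (suc q) + suc (suc q) + suc (suc q) ∎
  where
  open ℕ.≤-Reasoning
  q = suc n / 3

extensions : ∀ {n} → List (FinRel n) → List (FinRel n × (Subset n × Subset n))
extensions {n} = concatMap λ Q → map (Q ,_) (codes (codeSize n) (strict Q))

length-extensions : ∀ {n} (qs : List (FinRel n)) → length (extensions qs) ≤ length qs * codesBound (codeSize n) n
length-extensions {n} qs = length-concatMap-≤ (λ Q → map (Q ,_) (codes (codeSize n) (strict Q)))
  (codesBound (codeSize n) n)
  (λ Q → ℕ.≤-trans (ℕ.≤-reflexive (List.length-map (Q ,_) (codes (codeSize n) (strict Q)))) (length-codes (codeSize n) (strict Q)))
  qs

length-cartesianProductWith : ∀ {A B C : Set} (f : A → B → C) xs ys →
  length (List.cartesianProductWith f xs ys) ≡ length xs * length ys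
length-cartesianProductWith f []       ys = refl
length-cartesianProductWith f (x ∷ xs) ys = trans (List.length-++ (map (f x) ys))
  (cong₂ _+_ (List.length-map (f x) ys) (length-cartesianProductWith f xs ys))

IsExtension : ∀ {n} → Permutation′ (suc n) → FinRel (suc n) → FinRel n × (Subset n × Subset n) → Set
IsExtension π R (Q , c) =
  (∀ i j → tail (relabel (π ⟨$⟩ʳ_) (strict R)) i j ≡ strict Q i j) × code (relabel (π ⟨$⟩ʳ_) (strict R)) ≡ c

extension-determines : ∀ {n} {π ρ : Permutation′ (suc n)} {R S : FinRel (suc n)} {x} → IsExtension π R x → IsExtension ρ S x →
  ∀ i j → relabel (π ⟨$⟩ʳ_) (strict R) i j ≡ relabel (ρ ⟨$⟩ʳ_) (strict S) i j
extension-determines {R = R} {S} (t , c) (t′ , c′) = code-determines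
  (λ p → proj₁ (strict⁻ R p) refl) (λ p → proj₁ (strict⁻ S p) refl)
  (λ i j → trans (t i j) (sym (t′ i j))) (trans c (sym c′))

delete : ∀ {n} → Fin (suc n) → FinRel (suc n) → FinRel n
delete v R = reflexive (relabel (punchIn v) (strict R))

module _ {n : ℕ} (R : FinRel (suc n)) (pR : IsPosetCode R) where

  delete-isPoset : ∀ v → IsPosetCode (delete v R)
  delete-isPoset v = reflexive-isPoset (relabel-free (punchIn v) {strict R} (strict-free R pR))

  strict-delete : ∀ v i j → strict (delete v R) i j ≡ strict R (punchIn v i) (punchIn v j)
  strict-delete v = strict-reflexive (relabel-free (punchIn v) {strict R} (strict-free R pR))

  -- The element `v` is fixed before `Q` and `σ`, because a representative of the deleted poset can
  -- be looked up only once `v` is known.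
  extend : ∀ (qs : List (FinRel n)) → HasMiddle R →
    ∃[ v ] ∀ Q σ → Q ∈ˡ qs → PreservesRel σ (delete v R) Q →
      ∃[ x ] x ∈ˡ extensions qs × IsExtension (frame v σ) R x
  extend qs (x , mid) = v , λ Q σ Q∈ pres →
    (Q , code (L Q σ)) , ∈-concatMap⁺ _ (lose Q∈ (∈-map⁺ (Q ,_)
      (subst (code (L Q σ) ∈ˡ_) (codes-cong (codeSize n) (tails Q σ pres)) (proj₂ removed (frame v σ) refl)))) ,
      tails Q σ pres , refl
    where
    removed = removable (codeSize n) (s≤s z≤n) (n<3codeSize n) (strict R) (strict-free R pR) x mid
    v = proj₁ removed
    L : FinRel n → Permutation′ n → BRel (suc n)
    L Q σ = relabel (frame v σ ⟨$⟩ʳ_) (strict R)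
    tails : ∀ Q σ → PreservesRel σ (delete v R) Q → ∀ i j → tail (L Q σ) i j ≡ strict Q i j
    tails Q σ pres i j = trans (cong₂ (strict R) (frame-suc v σ i) (frame-suc v σ j))
      (trans (sym (strict-delete v (σ ⟨$⟩ˡ i) (σ ⟨$⟩ˡ j)))
      (trans (preserves-strict σ {delete v R} {Q} pres (σ ⟨$⟩ˡ i) (σ ⟨$⟩ˡ j)) (cong₂ (strict Q) (Perm.inverseʳ σ) (Perm.inverseʳ σ))))

middle-unl : ∀ n → length (filter hasMiddle? (List.deduplicate _≅ₚ?_ (posets (suc n)))) ≤
  p-unl n * codesBound (codeSize n) n
middle-unl n = ℕ.≤-trans
  (length-≤ (posetSetoid (suc n)) {ys = extensions (List.deduplicate _≅ₚ?_ (posets n))}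
    (λ R x → IsPosetCode R × ∃[ π ] IsExtension π R x)
    (filter-unique (posetSetoid (suc n)) hasMiddle? (unique (posets-unl (suc n))))
    image
    (λ {R} {S} {x} (pR , π , e) (pS , ρ , e′) → Perm.flip π Perm.∘ₚ ρ ,
      strict-preserves (Perm.flip π Perm.∘ₚ ρ) {R} {S} pR pS
        (∘ₚ-relabel₂ π ρ {strict R} {strict S} (extension-determines {π = π} {ρ} {R} {S} {x} e e′))))
  (length-extensions (List.deduplicate _≅ₚ?_ (posets n)))
  where
  image : ∀ {R} → R ∈ˡ filter hasMiddle? (List.deduplicate _≅ₚ?_ (posets (suc n))) →
    ∃[ x ] x ∈ˡ extensions (List.deduplicate _≅ₚ?_ (posets n)) × IsPosetCode R × ∃[ π ] IsExtension π R x
  image {R} R∈ =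
    let (R∈ps , mid) = ∈-filter⁻ hasMiddle? {xs = List.deduplicate _≅ₚ?_ (posets (suc n))} R∈
        pR = sound (posets-unl (suc n)) R∈ps
        (v , ext) = extend R pR (List.deduplicate _≅ₚ?_ (posets n)) mid
        (Q , Q∈ , σ , pres) = complete (posets-unl n) (delete v R) (delete-isPoset R pR v)
        (x , x∈ , e) = ext Q σ Q∈ pres
    in x , x∈ , pR , frame v σ , e

-- The factor `suc n` accounts for the label of the deleted element, which an isomorphism class
-- forgets.
middle-lbl : ∀ n → length (filter hasMiddle? (posets (suc n))) ≤ suc n * (p-lbl n * codesBound (codeSize n) n)
middle-lbl n = ℕ.≤-trans
  (length-≤ (setoid (FinRel (suc n))) {ys = cartesianProduct (allFin (suc n)) (extensions (posets n))}
    (λ R (v , x) → IsPosetCode R × IsExtension (frame v Perm.id) R x)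
    (filter-unique (setoid (FinRel (suc n))) hasMiddle? (unique (posets-lbl (suc n))))
    image
    (λ {R} {S} {(v , x)} (pR , e) (pS , e′) → preserves-id {R = R} {S} (strict-preserves Perm.id {R} {S} pR pS
      (relabel-cancel₂ (frame v Perm.id) {strict R} {strict S}
        (extension-determines {π = frame v Perm.id} {frame v Perm.id} {R} {S} {x} e e′)))))
  (ℕ.≤-trans (ℕ.≤-reflexive (trans (length-cartesianProductWith _,_ (allFin (suc n)) (extensions (posets n)))
    (cong (_* length (extensions (posets n))) (List.length-tabulate {n = suc n} (λ i → i)))))
    (ℕ.*-monoʳ-≤ (suc n) (length-extensions (posets n))))
  where
  image : ∀ {R} → R ∈ˡ filter hasMiddle? (posets (suc n)) →
    ∃[ vx ] vx ∈ˡ cartesianProduct (allFin (suc n)) (extensions (posets n)) ×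
      IsPosetCode R × IsExtension (frame (proj₁ vx) Perm.id) R (proj₂ vx)
  image {R} R∈ =
    let (R∈ps , mid) = ∈-filter⁻ hasMiddle? {xs = posets (suc n)} R∈
        pR = sound (posets-lbl (suc n)) R∈ps
        (v , ext) = extend R pR (posets n) mid
        Q∈ = ∈-filter⁺ isPosetCode? (∈-relations (delete v R)) (delete-isPoset R pR v)
        (x , x∈ , e) = ext (delete v R) Perm.id Q∈ (≡⇒preserves-id {R = delete v R} refl)
    in (v , x) , ∈-cartesianProduct⁺ (∈-allFin v) x∈ , pR , e

-- Deleting an isolated vertex from a bicoloured graph

IsolatedExtension : ∀ {n} → Permutation′ (suc n) → GraphCode (suc n) → GraphCode n → Set
IsolatedExtension π (A , E) (A′ , E′) =
  lookup A (π ⟨$⟩ʳ zero) ≡ true ×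
  (∀ j → entry E (π ⟨$⟩ʳ zero) j ≡ false) × (∀ i → entry E i (π ⟨$⟩ʳ zero) ≡ false) ×
  (∀ i → lookup A (π ⟨$⟩ʳ suc i) ≡ lookup A′ i) ×
  (∀ i j → tail (relabel (π ⟨$⟩ʳ_) (entry E)) i j ≡ entry E′ i j)

isolatedExtension-determines : ∀ {n} {π ρ : Permutation′ (suc n)} {A B E F} {H : GraphCode n} →
  IsolatedExtension π (A , E) H → IsolatedExtension ρ (B , F) H →
  (∀ i → lookup A (π ⟨$⟩ʳ i) ≡ lookup B (ρ ⟨$⟩ʳ i)) ×
  (∀ i j → relabel (π ⟨$⟩ʳ_) (entry E) i j ≡ relabel (ρ ⟨$⟩ʳ_) (entry F) i j)
isolatedExtension-determines {π = π} {ρ} {A} {B} {E} {F} (a , out , inn , as , es) (a′ , out′ , inn′ , as′ , es′) = sets , edges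
  where
  sets : ∀ i → lookup A (π ⟨$⟩ʳ i) ≡ lookup B (ρ ⟨$⟩ʳ i)
  sets zero    = trans a (sym a′)
  sets (suc i) = trans (as i) (sym (as′ i))
  edges : ∀ i j → relabel (π ⟨$⟩ʳ_) (entry E) i j ≡ relabel (ρ ⟨$⟩ʳ_) (entry F) i j
  edges zero    j       = trans (out _) (sym (out′ _))
  edges (suc i) zero    = trans (inn _) (sym (inn′ _))
  edges (suc i) (suc j) = trans (es i j) (sym (es′ i j))

deleteVertex : ∀ {n} → Fin (suc n) → GraphCode (suc n) → GraphCode n
deleteVertex v (A , E) = tabulate (λ i → lookup A (punchIn v i)) , fromEntries (relabel (punchIn v) (entry E))

module _ {n : ℕ} (G : GraphCode (suc n)) (bG : IsBicolouredGraph G) (v : Fin (suc n)) where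

  private
    A = proj₁ G
    E = proj₂ G
    A′ = proj₁ (deleteVertex v G)
    E′ = proj₂ (deleteVertex v G)
    A′≗ : ∀ i → lookup A′ i ≡ lookup A (punchIn v i)
    A′≗ = lookup∘tabulate (λ i → lookup A (punchIn v i))
    E′≗ : ∀ i j → entry E′ i j ≡ entry E (punchIn v i) (punchIn v j)
    E′≗ = entry-fromEntries (relabel (punchIn v) (entry E))

  deleteVertex-isBicoloured : IsBicolouredGraph (deleteVertex v G)
  deleteVertex-isBicoloured i j e =
    let (i∈A , j∉A) = edge G bG (trans (sym (E′≗ i j)) (⟦⟧⁻ E′ e)) in
    lookup-true A′ (trans (A′≗ i) i∈A) ,
    λ p → contradiction (trans (sym j∉A) (trans (sym (A′≗ j)) (∈-lookup-true p))) λ ()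

  isolatedExtension : IsolatedAt G v → ∀ {H σ} → PreservesSet σ A′ (proj₁ H) → PreservesRel σ E′ (proj₂ H) →
    IsolatedExtension (frame v σ) G H
  isolatedExtension (v∈A , out) {H} {σ} sets rels = v∈A , out ,
    (λ i → ¬-not λ e → contradiction (trans (sym v∈A) (proj₂ (edge G bG e))) λ ()) ,
    (λ i → trans (cong (lookup A) (frame-suc v σ i)) (trans (sym (A′≗ (σ ⟨$⟩ˡ i)))
      (trans (sets⁻ σ sets (σ ⟨$⟩ˡ i)) (cong (lookup (proj₁ H)) (Perm.inverseʳ σ))))) ,
    (λ i j → trans (cong₂ (entry E) (frame-suc v σ i) (frame-suc v σ j)) (trans (sym (E′≗ (σ ⟨$⟩ˡ i) (σ ⟨$⟩ˡ j)))
      (trans (preserves⁻ σ {E′} {proj₂ H} rels (σ ⟨$⟩ˡ i) (σ ⟨$⟩ˡ j)) (cong₂ (entry (proj₂ H)) (Perm.inverseʳ σ) (Perm.inverseʳ σ)))))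

-- The colour and all edges of the deleted vertex are known in advance, so no code accompanies the
-- smaller graph.
isolated-unl : ∀ n → length (filter hasIsolated? (List.deduplicate _≅ᵍ?_ (bicolouredGraphs (suc n)))) ≤ b-unl n
isolated-unl n = length-≤ (graphSetoid (suc n)) {ys = List.deduplicate _≅ᵍ?_ (bicolouredGraphs n)}
  (λ G H → ∃[ π ] IsolatedExtension π G H)
  (filter-unique (graphSetoid (suc n)) hasIsolated? (unique (graphs-unl (suc n))))
  image
  (λ { {A , E} {B , F} {H} (π , e) (ρ , e′) → let
      (sets , edges) = isolatedExtension-determines {π = π} {ρ} {A} {B} {E} {F} {H} e e′
      τ = Perm.flip π Perm.∘ₚ ρ
    in τ , sets⁺ τ (∘ₚ-relabel π ρ {lookup A} {lookup B} sets) ,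
       preserves⁺ τ {E} {F} (∘ₚ-relabel₂ π ρ {entry E} {entry F} edges) })
  where
  image : ∀ {G} → G ∈ˡ filter hasIsolated? (List.deduplicate _≅ᵍ?_ (bicolouredGraphs (suc n))) →
    ∃[ H ] H ∈ˡ List.deduplicate _≅ᵍ?_ (bicolouredGraphs n) × ∃[ π ] IsolatedExtension π G H
  image {G} G∈ =
    let (G∈gs , v , iso) = ∈-filter⁻ hasIsolated? {xs = List.deduplicate _≅ᵍ?_ (bicolouredGraphs (suc n))} G∈
        bG = sound (graphs-unl (suc n)) G∈gs
        (H , H∈ , σ , sets , rels) = complete (graphs-unl n) (deleteVertex v G) (deleteVertex-isBicoloured G bG v)
    in H , H∈ , frame v σ , isolatedExtension G bG v iso {H} {σ} sets rels

isolated-lbl : ∀ n → length (filter hasIsolated? (bicolouredGraphs (suc n))) ≤ suc n * b-lbl n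
isolated-lbl n = ℕ.≤-trans
  (length-≤ (setoid (GraphCode (suc n))) {ys = cartesianProduct (allFin (suc n)) (bicolouredGraphs n)}
    (λ G (v , H) → IsolatedExtension (frame v Perm.id) G H)
    (filter-unique (setoid (GraphCode (suc n))) hasIsolated? (unique (graphs-lbl (suc n))))
    image
    (λ { {A , E} {B , F} {v , H} e e′ → let
        π = frame v Perm.id
        (sets , edges) = isolatedExtension-determines {π = π} {π} {A} {B} {E} {F} {H} e e′
      in cong₂ _,_ (lookup-ext (relabel-cancel π {lookup A} {lookup B} sets))
           (entry-ext (relabel-cancel₂ π {entry E} {entry F} edges)) }))
  (ℕ.≤-reflexive (trans (length-cartesianProductWith _,_ (allFin (suc n)) (bicolouredGraphs n))
    (cong₂ _*_ (List.length-tabulate {n = suc n} (λ i → i)) (length-bicolouredGraphs n))))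
  where
  image : ∀ {G} → G ∈ˡ filter hasIsolated? (bicolouredGraphs (suc n)) →
    ∃[ vH ] vH ∈ˡ cartesianProduct (allFin (suc n)) (bicolouredGraphs n) ×
      IsolatedExtension (frame (proj₁ vH) Perm.id) G (proj₂ vH)
  image {G} G∈ =
    let (G∈gs , v , iso) = ∈-filter⁻ hasIsolated? {xs = bicolouredGraphs (suc n)} G∈
        bG = sound (graphs-lbl (suc n)) G∈gs
        H = deleteVertex v G
        H∈ = ∈-filter⁺ isBicolouredGraph? (∈-graphCodes H) (deleteVertex-isBicoloured G bG v)
    in (v , H) , ∈-cartesianProduct⁺ (∈-allFin v) H∈ ,
       isolatedExtension G bG v iso {H} {Perm.id} (sets⁺ Perm.id λ i → refl) (≡⇒preserves-id {R = proj₂ H} refl)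

-- A single factor for all four recurrences: `suc n` pays for the label of the deleted vertex, and
-- the inner `suc` also covers isolated vertices when `codesBound` vanishes.
overhead : ℕ → ℕ
overhead n = suc n * suc (codesBound (codeSize n) n)

private
  ≤overhead₁ : ∀ n p → p * codesBound (codeSize n) n ≤ suc (codesBound (codeSize n) n) * p
  ≤overhead₁ n p = ℕ.≤-trans (ℕ.≤-reflexive (ℕ.*-comm p _)) (ℕ.m≤n+m _ p)

  scale : ∀ n p x → x ≤ suc (codesBound (codeSize n) n) * p → suc n * x ≤ overhead n * p
  scale n p x x≤ = ℕ.≤-trans (ℕ.*-monoʳ-≤ (suc n) x≤) (ℕ.≤-reflexive (sym (ℕ.*-assoc (suc n) (suc (codesBound (codeSize n) n)) p)))

upper-lbl : ∀ n → p-lbl (suc n) ≤ b-lbl (suc n) + overhead n * p-lbl n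
upper-lbl n = begin
  p-lbl (suc n) ≡⟨ length-split hasMiddle? (posets (suc n)) ⟩
  length (filter hasMiddle? (posets (suc n))) + length (filter (¬? ∘ hasMiddle?) (posets (suc n)))
    ≤⟨ ℕ.+-mono-≤ (ℕ.≤-trans (middle-lbl n) (scale n _ _ (≤overhead₁ n _))) (flat-lbl (suc n)) ⟩
  overhead n * p-lbl n + b-lbl (suc n) ≡⟨ ℕ.+-comm (overhead n * p-lbl n) _ ⟩
  b-lbl (suc n) + overhead n * p-lbl n ∎
  where open ℕ.≤-Reasoning

upper-unl : ∀ n → p-unl (suc n) ≤ b-unl (suc n) + overhead n * p-unl n
upper-unl n = begin
  p-unl (suc n) ≡⟨ length-split hasMiddle? ps ⟩
  length (filter hasMiddle? ps) + length (filter (¬? ∘ hasMiddle?) ps)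
    ≤⟨ ℕ.+-mono-≤ (ℕ.≤-trans (middle-unl n) (ℕ.≤-trans (ℕ.m≤n*m _ (suc n)) (scale n _ _ (≤overhead₁ n _)))) (flat-unl (suc n)) ⟩
  overhead n * p-unl n + b-unl (suc n) ≡⟨ ℕ.+-comm (overhead n * p-unl n) _ ⟩
  b-unl (suc n) + overhead n * p-unl n ∎
  where
  open ℕ.≤-Reasoning
  ps = List.deduplicate _≅ₚ?_ (posets (suc n))

lower-lbl : ∀ n → b-lbl (suc n) ≤ p-lbl (suc n) + overhead n * b-lbl n
lower-lbl n = begin
  b-lbl (suc n) ≡⟨ length-bicolouredGraphs (suc n) ⟨
  length (bicolouredGraphs (suc n)) ≡⟨ length-split hasIsolated? (bicolouredGraphs (suc n)) ⟩
  length (filter hasIsolated? (bicolouredGraphs (suc n))) + length (filter (¬? ∘ hasIsolated?) (bicolouredGraphs (suc n)))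
    ≤⟨ ℕ.+-mono-≤ (ℕ.≤-trans (isolated-lbl n) (scale n _ _ (ℕ.m≤n*m _ (suc (codesBound (codeSize n) n))))) (noIsolated-lbl (suc n)) ⟩
  overhead n * b-lbl n + p-lbl (suc n) ≡⟨ ℕ.+-comm (overhead n * b-lbl n) _ ⟩
  p-lbl (suc n) + overhead n * b-lbl n ∎
  where open ℕ.≤-Reasoning

lower-unl : ∀ n → b-unl (suc n) ≤ p-unl (suc n) + overhead n * b-unl n
lower-unl n = begin
  b-unl (suc n) ≡⟨ length-split hasIsolated? gs ⟩
  length (filter hasIsolated? gs) + length (filter (¬? ∘ hasIsolated?) gs)
    ≤⟨ ℕ.+-mono-≤ (ℕ.≤-trans (isolated-unl n) (ℕ.≤-trans (ℕ.m≤n*m _ (suc n))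
         (scale n _ _ (ℕ.m≤n*m _ (suc (codesBound (codeSize n) n)))))) (noIsolated-unl (suc n)) ⟩
  overhead n * b-unl n + p-unl (suc n) ≡⟨ ℕ.+-comm (overhead n * b-unl n) _ ⟩
  p-unl (suc n) + overhead n * b-unl n ∎
  where
  open ℕ.≤-Reasoning
  gs = List.deduplicate _≅ᵍ?_ (bicolouredGraphs (suc n))

-- Growth of the number of bicoloured graphs

∑-mono : ∀ n {f g : ℕ → ℕ} → (∀ i → i < n → f i ≤ g i) → ∑ n f ≤ ∑ n g
∑-mono zero    f≤g = z≤n
∑-mono (suc n) f≤g = ℕ.+-mono-≤ (f≤g 0 (s≤s z≤n)) (∑-mono n λ i i<n → f≤g (suc i) (s≤s i<n))

∑-* : ∀ n c (f : ℕ → ℕ) → ∑ n (λ i → c * f i) ≡ c * ∑ n f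
∑-* zero    c f = sym (ℕ.*-zeroʳ c)
∑-* (suc n) c f = trans (cong (c * f 0 +_) (∑-* n c (f ∘ suc))) (sym (ℕ.*-distribˡ-+ c (f 0) _))

∑-const : ∀ n c → ∑ n (λ _ → c) ≡ n * c
∑-const zero    c = refl
∑-const (suc n) c = cong (c +_) (∑-const n c)

∑-term : ∀ n (f : ℕ → ℕ) i → i < n → f i ≤ ∑ n f
∑-term (suc n) f zero    _         = ℕ.m≤m+n _ _
∑-term (suc n) f (suc i) (s≤s i<n) = ℕ.≤-trans (∑-term n (f ∘ suc) i i<n) (ℕ.m≤n+m _ _)

b-lbl-∑ : ∀ n → b-lbl n ≡ ∑ (suc n) (λ i → (n C i) * 2 ^ (i * (n ∸ i)))
b-lbl-∑ n = cong sum (List.map-upTo (λ i → (n C i) * 2 ^ (i * (n ∸ i))) (suc n))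

half≤max : ∀ n i → i ≤ n → ⌊ n /2⌋ ≤ i ⊎ ⌊ n /2⌋ ≤ n ∸ i
half≤max n i i≤n with ⌊ n /2⌋ ℕ.≤? i
... | yes p = inj₁ p

... | no p  = inj₂ (ℕ.≤-trans (ℕ.⌊n/2⌋≤⌈n/2⌉ n) (ℕ.≤-trans (ℕ.≤-reflexive
    (trans (sym (ℕ.m+n∸m≡n ⌊ n /2⌋ _)) (cong (_∸ ⌊ n /2⌋) (ℕ.⌊n/2⌋+⌈n/2⌉≡n n))))
    (ℕ.∸-monoʳ-≤ n (ℕ.<⇒≤ (ℕ.≰⇒> p)))))

-- A new vertex can be put opposite the larger side, which has at least `⌊ n /2⌋` vertices, with any
-- set of neighbours there. In the sums this is Pascal's rule, with one of its two terms kept for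
-- each `i`.
b-lbl-growth : ∀ n → 2 ^ ⌊ n /2⌋ * b-lbl n ≤ b-lbl (suc n)
b-lbl-growth n = begin
  2 ^ h * b-lbl n                                       ≡⟨ cong (2 ^ h *_) (b-lbl-∑ n) ⟩
  2 ^ h * ∑ (suc n) (λ i → (n C i) * 2 ^ (i * (n ∸ i))) ≡⟨ ∑-* (suc n) (2 ^ h) (λ i → (n C i) * 2 ^ (i * (n ∸ i))) ⟨
  ∑ (suc n) (λ i → 2 ^ h * ((n C i) * 2 ^ (i * (n ∸ i)))) ≤⟨ ∑-mono (suc n) (λ { i (s≤s i≤n) → term i i≤n }) ⟩
  ∑ (suc n) (λ i → (n C i) * g (suc i) + (n C i) * g i) ≡⟨ ∑-+ (suc n) (λ i → (n C i) * g (suc i)) (λ i → (n C i) * g i) ⟩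
  ∑ (suc n) (λ i → (n C i) * g (suc i)) + ∑ (suc n) (λ i → (n C i) * g i) ≡⟨ ∑-binomial-suc n g ⟨
  ∑ (2 + n) (λ i → (suc n C i) * g i)                   ≡⟨ b-lbl-∑ (suc n) ⟨
  b-lbl (suc n)                                         ∎
  where
  open ℕ.≤-Reasoning
  h = ⌊ n /2⌋
  g : ℕ → ℕ
  g i = 2 ^ (i * (suc n ∸ i))
  swap-factor : ∀ i → 2 ^ h * ((n C i) * 2 ^ (i * (n ∸ i))) ≡ (n C i) * 2 ^ (h + i * (n ∸ i))
  swap-factor i = trans (sym (ℕ.*-assoc (2 ^ h) (n C i) _)) (trans (cong (_* 2 ^ (i * (n ∸ i))) (ℕ.*-comm (2 ^ h) (n C i)))
    (trans (ℕ.*-assoc (n C i) (2 ^ h) _) (cong ((n C i) *_) (sym (ℕ.^-distribˡ-+-* 2 h (i * (n ∸ i)))))))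
  term : ∀ i → i ≤ n → 2 ^ h * ((n C i) * 2 ^ (i * (n ∸ i))) ≤ (n C i) * g (suc i) + (n C i) * g i
  term i i≤n with half≤max n i i≤n
  ... | inj₁ h≤i = begin
    2 ^ h * ((n C i) * 2 ^ (i * (n ∸ i))) ≡⟨ swap-factor i ⟩
    (n C i) * 2 ^ (h + i * (n ∸ i))       ≤⟨ ℕ.*-monoʳ-≤ (n C i) (ℕ.^-monoʳ-≤ 2 (ℕ.+-monoˡ-≤ (i * (n ∸ i)) h≤i)) ⟩
    (n C i) * 2 ^ (i + i * (n ∸ i))       ≡⟨ cong (λ e → (n C i) * 2 ^ e)
                                               (trans (sym (ℕ.*-suc i (n ∸ i))) (cong (i *_) (sym (ℕ.+-∸-assoc 1 i≤n)))) ⟩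
    (n C i) * g i                         ≤⟨ ℕ.m≤n+m _ _ ⟩
    (n C i) * g (suc i) + (n C i) * g i   ∎
  ... | inj₂ h≤n-i = begin
    2 ^ h * ((n C i) * 2 ^ (i * (n ∸ i))) ≡⟨ swap-factor i ⟩
    (n C i) * 2 ^ (h + i * (n ∸ i))       ≤⟨ ℕ.*-monoʳ-≤ (n C i) (ℕ.^-monoʳ-≤ 2 (ℕ.+-monoˡ-≤ (i * (n ∸ i)) h≤n-i)) ⟩
    (n C i) * g (suc i)                   ≤⟨ ℕ.m≤m+n _ _ ⟩
    (n C i) * g (suc i) + (n C i) * g i   ∎

-- Labelled against unlabelled graphs

permutations : ∀ n → List (Permutation′ n)
permutations zero    = [ Perm.id ]
permutations (suc n) = cartesianProductWith (Perm.insert zero) (allFin (suc n)) (permutations n)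

length-permutations : ∀ n → length (permutations n) ≡ n !
length-permutations zero    = refl
length-permutations (suc n) = trans (length-cartesianProductWith (Perm.insert zero) (allFin (suc n)) (permutations n))
  (cong₂ _*_ (List.length-tabulate {n = suc n} (λ i → i)) (length-permutations n))

∈-permutations : ∀ {n} (π : Permutation′ n) → ∃[ ρ ] ρ ∈ˡ permutations n × (∀ i → ρ ⟨$⟩ʳ i ≡ π ⟨$⟩ʳ i)
∈-permutations {zero}  π = Perm.id , here refl , λ ()
∈-permutations {suc n} π =
  let (ρ , ρ∈ , ρ≗) = ∈-permutations (Perm.remove zero π) in
  Perm.insert zero v ρ , ∈-cartesianProductWith⁺ (Perm.insert zero) (∈-allFin v) ρ∈ ,
  λ i → trans (agree ρ ρ≗ i) (Perm.insert-remove zero π i)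
  where
  v = π ⟨$⟩ʳ zero
  agree : ∀ ρ → (∀ i → ρ ⟨$⟩ʳ i ≡ Perm.remove zero π ⟨$⟩ʳ i) →
    ∀ i → Perm.insert zero v ρ ⟨$⟩ʳ i ≡ Perm.insert zero v (Perm.remove zero π) ⟨$⟩ʳ i
  agree ρ ρ≗ zero    = refl
  agree ρ ρ≗ (suc i) = trans (Perm.insert-punchIn zero v ρ i) (trans (cong (punchIn v) (ρ≗ i))
    (sym (Perm.insert-punchIn zero v (Perm.remove zero π) i)))

-- Each labelled graph is a relabelling of its representative by one of `n !` permutations;
-- automorphisms only make this an overcount.
b-lbl≤n!*b-unl : ∀ n → b-lbl n ≤ n ! * b-unl n
b-lbl≤n!*b-unl n = subst (_≤ n ! * b-unl n) (length-bicolouredGraphs n) (ℕ.≤-trans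
  (length-≤ (setoid (GraphCode n)) {ys = cartesianProduct (permutations n) gs}
    (λ (A , E) (π , (B , F)) → (∀ i → lookup A i ≡ lookup B (π ⟨$⟩ʳ i)) × (∀ i j → entry E i j ≡ entry F (π ⟨$⟩ʳ i) (π ⟨$⟩ʳ j)))
    (unique (graphs-lbl n)) image
    (λ (a , e) (a′ , e′) → cong₂ _,_ (lookup-ext λ i → trans (a i) (sym (a′ i))) (entry-ext λ i j → trans (e i j) (sym (e′ i j)))))
  (ℕ.≤-reflexive (trans (length-cartesianProductWith _,_ (permutations n) gs) (cong (_* b-unl n) (length-permutations n)))))
  where
  gs = List.deduplicate _≅ᵍ?_ (bicolouredGraphs n)
  image : ∀ {G} → G ∈ˡ bicolouredGraphs n → ∃[ x ] x ∈ˡ cartesianProduct (permutations n) gs ×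
    (∀ i → lookup (proj₁ G) i ≡ lookup (proj₁ (proj₂ x)) (proj₁ x ⟨$⟩ʳ i)) ×
    (∀ i j → entry (proj₂ G) i j ≡ entry (proj₂ (proj₂ x)) (proj₁ x ⟨$⟩ʳ i) (proj₁ x ⟨$⟩ʳ j))
  image {G} G∈ =
    let (H , H∈ , π , sets , rels) = complete (graphs-unl n) G (sound (graphs-lbl n) G∈)
        (ρ , ρ∈ , ρ≗) = ∈-permutations π
    in (ρ , H) , ∈-cartesianProduct⁺ ρ∈ H∈ ,
      (λ i → trans (sets⁻ π sets i) (cong (lookup (proj₁ H)) (sym (ρ≗ i)))) ,
      (λ i j → trans (preserves⁻ π {proj₂ G} {proj₂ H} rels i j) (cong₂ (entry (proj₂ H)) (sym (ρ≗ i)) (sym (ρ≗ j))))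

-- Multisets

-- Vectors whose entries follow the order of `xs`, one for each multiset when `xs` has no
-- repetitions.
multisets : ∀ {A : Set} → List A → ∀ m → List (Vec A m)
multisets xs       zero    = [ [] ]
multisets []       (suc m) = []
multisets (x ∷ xs) (suc m) = map (x ∷_) (multisets (x ∷ xs) m) ++ multisets xs (suc m)

∈-multisets : ∀ {A : Set} → DecidableEquality A → ∀ xs m (f : Fin m → A) → (∀ i → f i ∈ˡ xs) →
  ∃[ π ] tabulate (λ i → f (π ⟨$⟩ʳ i)) ∈ˡ multisets xs m
∈-multisets _≟_ xs       zero    f f∈ = Perm.id , here refl
∈-multisets _≟_ []       (suc m) f f∈ with () ← f∈ zero
∈-multisets _≟_ (x ∷ xs) (suc m) f f∈ = cases (Fin.any? (λ i → f i ≟ x))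
  (∈-multisets _≟_ (x ∷ xs) m) (∈-multisets _≟_ xs (suc m) f)
  where
  cases : Dec (∃[ i ] f i ≡ x) →
    ((g : Fin m → _) → (∀ i → g i ∈ˡ x ∷ xs) → ∃[ π ] tabulate (λ i → g (π ⟨$⟩ʳ i)) ∈ˡ multisets (x ∷ xs) m) →
    ((∀ i → f i ∈ˡ xs) → ∃[ π ] tabulate (λ i → f (π ⟨$⟩ʳ i)) ∈ˡ multisets xs (suc m)) →
    ∃[ π ] tabulate (λ i → f (π ⟨$⟩ʳ i)) ∈ˡ multisets (x ∷ xs) (suc m)
  cases (yes (i , fi≡x)) fewer _ =
    let (π , v∈) = fewer (λ j → f (punchIn i j)) (λ j → f∈ (punchIn i j)) in
    Perm.insert zero i π , ∈-++⁺ˡ (subst (_∈ˡ map (x ∷_) (multisets (x ∷ xs) m))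
      (cong₂ _∷_ (sym fi≡x) (tabulate-cong λ j → cong f (sym (Perm.insert-punchIn zero i π j)))) (∈-map⁺ (x ∷_) v∈))
  cases (no none) _ smaller = let (π , v∈) = smaller f∈xs in π , ∈-++⁺ʳ _ v∈
    where
    f∈xs : ∀ i → f i ∈ˡ xs
    f∈xs i with f∈ i
    ... | here fi≡x = contradiction (i , fi≡x) none
    ... | there p   = p

-- The rising factorial `q (q + 1) ... (q + m - 1)`, which is `m !` times the number of multisets of
-- size `m` from `q` elements.
rising : ℕ → ℕ → ℕ
rising q zero    = 1
rising q (suc m) = rising q m * (q + m)

-- Splitting off the smallest factor instead of the largest exposes `rising (suc q) m`, common to
-- both branches of the recursion for multisets.
rising-suc : ∀ q m → rising q (suc m) ≡ q * rising (suc q) m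
rising-suc q zero    = trans (ℕ.*-identityˡ (q + 0)) (trans (ℕ.+-identityʳ q) (sym (ℕ.*-identityʳ q)))
rising-suc q (suc m) = trans (cong₂ _*_ (rising-suc q m) (ℕ.+-suc q m)) (ℕ.*-assoc q _ _)

length-multisets : ∀ {A : Set} (xs : List A) m → length (multisets xs m) * m ! ≡ rising (length xs) m
length-multisets xs       zero    = refl
length-multisets []       (suc m) = sym (rising-suc 0 m)
length-multisets (x ∷ xs) (suc m) = begin
  length (map (x ∷_) (multisets (x ∷ xs) m) ++ multisets xs (suc m)) * (suc m * m !)
    ≡⟨ cong (_* (suc m * m !)) (trans (List.length-++ (map (x ∷_) (multisets (x ∷ xs) m)))
         (cong (_+ Y) (List.length-map (x ∷_) (multisets (x ∷ xs) m)))) ⟩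
  (X + Y) * (suc m * m !)
    ≡⟨ distrib X Y m (m !) ⟩
  suc m * (X * m !) + Y * (suc m * m !)
    ≡⟨ cong₂ (λ u v → suc m * u + v) (length-multisets (x ∷ xs) m) (length-multisets xs (suc m)) ⟩
  suc m * rising (suc q) m + rising q (suc m)
    ≡⟨ cong (suc m * rising (suc q) m +_) (rising-suc q m) ⟩
  suc m * rising (suc q) m + q * rising (suc q) m
    ≡⟨ collect m q (rising (suc q) m) ⟩
  rising (suc q) m * (suc q + m) ∎
  where
  open ≡.≡-Reasoning
  q = length xs
  X = length (multisets (x ∷ xs) m)
  Y = length (multisets xs (suc m))
  distrib : ∀ X Y m f → (X + Y) * (suc m * f) ≡ suc m * (X * f) + Y * (suc m * f)
  distrib = solve-∀
  collect : ∀ m q r → suc m * r + q * r ≡ r * (suc q + m)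
  collect = solve-∀

-- `j` stays fixed while `m` descends, so that all factors are compared with the same `q + j`.
rising≤ : ∀ q m j → m ≤ j → rising q m ≤ (q + j) ^ m
rising≤ q zero    j _   = s≤s z≤n
rising≤ q (suc m) j m<j = ℕ.≤-trans (ℕ.*-mono-≤ (rising≤ q m j (ℕ.<⇒≤ m<j)) (ℕ.+-monoʳ-≤ q (ℕ.<⇒≤ m<j)))
  (ℕ.≤-reflexive (ℕ.*-comm _ (q + j)))

-- (1 + m/q)ʲ (1 - jm/q) ≤ 1, multiplied by q ^ (j + 1); here q = d + j * m.
bernoulli : ∀ m j d → (d + j * m + m) ^ j * d ≤ (d + j * m) ^ suc j
bernoulli m zero    d = ℕ.≤-reflexive (simplify d)
  where
  simplify : ∀ d → 1 * d ≡ (d + 0) * 1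
  simplify = solve-∀
bernoulli m (suc j) d = begin
  (q + m) * (q + m) ^ j * d       ≡⟨ swap-factors (q + m) ((q + m) ^ j) d ⟩
  -- The two sides of `(q + m) * d ≤ q * (d + m)` differ by `suc j * m * m`. Raising `d` by `m`
  -- keeps the same `q` with `j` in place of `suc j`, so the induction hypothesis applies.
  (q + m) ^ j * ((q + m) * d)     ≤⟨ ℕ.*-monoʳ-≤ ((q + m) ^ j) (ℕ.≤-trans (ℕ.m≤m+n _ (suc j * m * m)) (ℕ.≤-reflexive (expand d m j))) ⟩
  (q + m) ^ j * (q * (d + m))     ≡⟨ swap-factors′ q ((q + m) ^ j) (d + m) ⟩
  q * ((q + m) ^ j * (d + m))     ≡⟨ cong (λ z → q * ((z + m) ^ j * (d + m))) q≡ ⟩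
  q * (((d + m) + j * m + m) ^ j * (d + m)) ≤⟨ ℕ.*-monoʳ-≤ q (bernoulli m j (d + m)) ⟩
  q * ((d + m) + j * m) ^ suc j   ≡⟨ cong (λ z → q * z ^ suc j) q≡ ⟨
  q * q ^ suc j                   ∎
  where
  open ℕ.≤-Reasoning
  q = d + suc j * m
  q≡ : q ≡ (d + m) + j * m
  q≡ = sym (ℕ.+-assoc d m (j * m))
  swap-factors : ∀ a b d → a * b * d ≡ b * (a * d)
  swap-factors = solve-∀
  swap-factors′ : ∀ q b e → b * (q * e) ≡ q * (b * e)
  swap-factors′ = solve-∀
  expand : ∀ d m j → (d + suc j * m + m) * d + suc j * m * m ≡ (d + suc j * m) * (d + m)
  expand = solve-∀

-- This is `bernoulli` with `j = m`: there `d = q - m²` is at least half of `q`, whence the factor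
-- two.
power-≤ : ∀ q m → 2 * (m * m) ≤ q → 0 < q → (q + m) ^ m ≤ 2 * q ^ m
power-≤ q m 2m²≤q 0<q = ℕ.*-cancelʳ-≤ _ _ q {{>-nonZero 0<q}} (begin
  (q + m) ^ m * q            ≤⟨ ℕ.*-monoʳ-≤ ((q + m) ^ m) q≤2d ⟩
  (q + m) ^ m * (2 * d)      ≡⟨ pull ((q + m) ^ m) d ⟩
  2 * ((q + m) ^ m * d)      ≡⟨ cong (λ z → 2 * ((z + m) ^ m * d)) q≡ ⟩
  2 * ((d + m * m + m) ^ m * d) ≤⟨ ℕ.*-monoʳ-≤ 2 (bernoulli m m d) ⟩
  2 * (d + m * m) ^ suc m    ≡⟨ cong (λ z → 2 * z ^ suc m) q≡ ⟨
  2 * (q * q ^ m)            ≡⟨ rearrange q (q ^ m) ⟩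
  2 * q ^ m * q              ∎)
  where
  open ℕ.≤-Reasoning
  d = q ∸ m * m
  m²≤q : m * m ≤ q
  m²≤q = ℕ.≤-trans (ℕ.m≤n*m (m * m) 2) 2m²≤q
  q≡ : q ≡ d + m * m
  q≡ = sym (ℕ.m∸n+n≡m m²≤q)
  m²≤d : m * m ≤ d
  m²≤d = ℕ.≤-trans (ℕ.≤-reflexive (trans (sym (ℕ.+-identityʳ (m * m))) (sym (ℕ.m+n∸m≡n (m * m) _)))) (ℕ.∸-monoˡ-≤ (m * m) 2m²≤q)
  q≤2d : q ≤ 2 * d
  q≤2d = ℕ.≤-trans (ℕ.≤-reflexive q≡) (ℕ.≤-trans (ℕ.+-monoʳ-≤ d m²≤d) (ℕ.≤-reflexive (cong (d +_) (sym (ℕ.+-identityʳ d)))))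
  pull : ∀ a d → a * (2 * d) ≡ 2 * (a * d)
  pull = solve-∀
  rearrange : ∀ q r → 2 * (q * r) ≡ 2 * r * q
  rearrange = solve-∀

length-multisets-≤ : ∀ {A : Set} (xs : List A) m → 2 * (m * m) ≤ length xs → 0 < length xs →
  length (multisets xs m) * m ! ≤ 2 * length xs ^ m
length-multisets-≤ xs m 2m²≤q 0<q = ℕ.≤-trans (ℕ.≤-reflexive (length-multisets xs m))
  (ℕ.≤-trans (rising≤ (length xs) m m ℕ.≤-refl) (power-≤ (length xs) m 2m²≤q 0<q))

-- Bicoloured graphs as matrices up to row and column permutations

open Inverse using (to; from; strictlyInverseˡ; strictlyInverseʳ)

isLeft : ∀ {I J : Set} → I ⊎ J → Bool
isLeft = Sum.[ const true , const false ]′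

between : ∀ {I J : Set} → (I → J → Bool) → I ⊎ J → I ⊎ J → Bool
between M (inj₁ r) (inj₂ c) = M r c
between M _        _        = false

-- The index types are arbitrary, so that the rows can be split into a block of `t` and the rest,
-- and the rest permuted by itself.
record Realises {n} {I J : Set} (M : I → J → Bool) (G : GraphCode n) : Set where
  field
    position : Fin n ↔ (I ⊎ J)
    sides    : ∀ i → lookup (proj₁ G) i ≡ isLeft (to position i)
    edges    : ∀ i j → entry (proj₂ G) i j ≡ between M (to position i) (to position j)

open Realises

realises-unique : ∀ {n} {I J : Set} {M : I → J → Bool} {G H : GraphCode n} → Realises M G → Realises M H → G ≅ᵍ H
realises-unique {M = M} {G} {H} g h = π , sets⁺ π (λ i → trans (sides g i) (trans (cong isLeft (sym (lands i))) (sym (sides h _)))) ,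
  preserves⁺ π {proj₂ G} {proj₂ H} (λ i j → trans (edges g i j)
    (trans (cong₂ (between M) (sym (lands i)) (sym (lands j))) (sym (edges h _ _))))
  where
  roundtrip : ∀ {k l} (φ : Fin k ↔ _) (ψ : Fin l ↔ _) i → from φ (to ψ (from ψ (to φ i))) ≡ i
  roundtrip φ ψ i = trans (cong (from φ) (strictlyInverseˡ ψ (to φ i))) (strictlyInverseʳ φ i)
  π = permutation (from (position h) ∘ to (position g)) (from (position g) ∘ to (position h))
    (roundtrip (position h) (position g)) (roundtrip (position g) (position h))
  lands : ∀ i → to (position h) (π ⟨$⟩ʳ i) ≡ to (position g) i
  lands i = strictlyInverseˡ (position h) (to (position g) i)

realises-cong : ∀ {n} {I J : Set} {M N : I → J → Bool} {G : GraphCode n} → (∀ r c → M r c ≡ N r c) →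
  Realises M G → Realises N G
realises-cong {M = M} {N} M≗N g = record
  { position = position g ; sides = sides g ; edges = λ i j → trans (edges g i j) (between-cong (to (position g) i) (to (position g) j)) }
  where
  between-cong : ∀ x y → between M x y ≡ between N x y
  between-cong (inj₁ r) (inj₂ c) = M≗N r c
  between-cong (inj₁ _) (inj₁ _) = refl
  between-cong (inj₂ _) _        = refl

realises-reindex : ∀ {n} {I I′ J J′ : Set} {M : I → J → Bool} {G : GraphCode n} (α : I′ ↔ I) (β : J′ ↔ J) →
  Realises M G → Realises (λ r c → M (to α r) (to β c)) G
realises-reindex {I = I} {I′} {J} {J′} {M} α β g = record
  { position = mk↔ₛ′ (forth ∘ to (position g)) (from (position g) ∘ back)
      (λ x → trans (cong forth (strictlyInverseˡ (position g) (back x))) (forth-back x))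
      (λ i → trans (cong (from (position g)) (back-forth (to (position g) i))) (strictlyInverseʳ (position g) i))
  ; sides = λ i → trans (sides g i) (isLeft-forth (to (position g) i))
  ; edges = λ i j → trans (edges g i j) (between-forth (to (position g) i) (to (position g) j))
  }
  where
  forth : I ⊎ J → I′ ⊎ J′
  forth = Sum.map (from α) (from β)
  back : I′ ⊎ J′ → I ⊎ J
  back = Sum.map (to α) (to β)
  forth-back : ∀ x → forth (back x) ≡ x
  forth-back (inj₁ r) = cong inj₁ (strictlyInverseʳ α r)
  forth-back (inj₂ c) = cong inj₂ (strictlyInverseʳ β c)
  back-forth : ∀ x → back (forth x) ≡ x
  back-forth (inj₁ r) = cong inj₁ (strictlyInverseˡ α r)
  back-forth (inj₂ c) = cong inj₂ (strictlyInverseˡ β c)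
  isLeft-forth : ∀ x → isLeft x ≡ isLeft (forth x)
  isLeft-forth (inj₁ _) = refl
  isLeft-forth (inj₂ _) = refl
  between-forth : ∀ x y → between M x y ≡ between (λ r c → M (to α r) (to β c)) (forth x) (forth y)
  between-forth (inj₁ r) (inj₂ c) = cong₂ M (sym (strictlyInverseˡ α r)) (sym (strictlyInverseˡ β c))
  between-forth (inj₁ _) (inj₁ _) = refl
  between-forth (inj₂ _) _        = refl

side : ∀ {n} (A : Subset n) → Fin n → Fin ∣ A ∣ ⊎ Fin ∣ ∁ A ∣
side (true ∷ A)  zero    = inj₁ zero
side (true ∷ A)  (suc i) = Sum.map₁ suc (side A i)
side (false ∷ A) zero    = inj₂ zero
side (false ∷ A) (suc i) = Sum.map₂ suc (side A i)

unside : ∀ {n} (A : Subset n) → Fin ∣ A ∣ ⊎ Fin ∣ ∁ A ∣ → Fin n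
unside (true ∷ A)  (inj₁ zero)    = zero
unside (true ∷ A)  (inj₁ (suc r)) = suc (unside A (inj₁ r))
unside (true ∷ A)  (inj₂ c)       = suc (unside A (inj₂ c))
unside (false ∷ A) (inj₁ r)       = suc (unside A (inj₁ r))
unside (false ∷ A) (inj₂ zero)    = zero
unside (false ∷ A) (inj₂ (suc c)) = suc (unside A (inj₂ c))

side-unside : ∀ {n} (A : Subset n) x → side A (unside A x) ≡ x
side-unside []          (inj₁ ())
side-unside []          (inj₂ ())
side-unside (true ∷ A)  (inj₁ zero)    = refl
side-unside (true ∷ A)  (inj₁ (suc r)) = cong (Sum.map₁ suc) (side-unside A (inj₁ r))
side-unside (true ∷ A)  (inj₂ c)       = cong (Sum.map₁ suc) (side-unside A (inj₂ c))
side-unside (false ∷ A) (inj₁ r)       = cong (Sum.map₂ suc) (side-unside A (inj₁ r))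
side-unside (false ∷ A) (inj₂ zero)    = refl
side-unside (false ∷ A) (inj₂ (suc c)) = cong (Sum.map₂ suc) (side-unside A (inj₂ c))

unside-side : ∀ {n} (A : Subset n) i → unside A (side A i) ≡ i
unside-side (true ∷ A)  zero    = refl
unside-side (true ∷ A)  (suc i) with side A i | unside-side A i
... | inj₁ _ | eq = cong suc eq
... | inj₂ _ | eq = cong suc eq
unside-side (false ∷ A) zero    = refl
unside-side (false ∷ A) (suc i) with side A i | unside-side A i
... | inj₁ _ | eq = cong suc eq
... | inj₂ _ | eq = cong suc eq

lookup-side : ∀ {n} (A : Subset n) i → lookup A i ≡ isLeft (side A i)
lookup-side (true ∷ A)  zero    = refl
lookup-side (true ∷ A)  (suc i) with side A i | lookup-side A i
... | inj₁ _ | eq = eq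
... | inj₂ _ | eq = eq
lookup-side (false ∷ A) zero    = refl
lookup-side (false ∷ A) (suc i) with side A i | lookup-side A i
... | inj₁ _ | eq = eq
... | inj₂ _ | eq = eq

matrix : ∀ {n} ((A , E) : GraphCode n) → Fin ∣ A ∣ → Fin ∣ ∁ A ∣ → Bool
matrix (A , E) r c = entry E (unside A (inj₁ r)) (unside A (inj₂ c))

realises-matrix : ∀ {n} (G : GraphCode n) → IsBicolouredGraph G → Realises (matrix G) G
realises-matrix G@(A , E) bG = record
  { position = mk↔ₛ′ (side A) (unside A) (side-unside A) (unside-side A)
  ; sides    = lookup-side A
  ; edges    = λ i j → trans (cong₂ (entry E) (sym (unside-side A i)) (sym (unside-side A j))) (unsided (side A i) (side A j))
  }
  where
  left : ∀ x → lookup A (unside A x) ≡ isLeft x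
  left x = trans (lookup-side A (unside A x)) (cong isLeft (side-unside A x))
  unsided : ∀ x y → entry E (unside A x) (unside A y) ≡ between (matrix G) x y
  unsided (inj₁ r) (inj₂ c) = refl
  unsided (inj₁ r) (inj₁ r′) = ¬-not λ e → contradiction (trans (sym (left (inj₁ r′))) (proj₂ (edge G bG e))) λ ()
  unsided (inj₂ c) y = ¬-not λ e → contradiction (trans (sym (left (inj₂ c))) (proj₁ (edge G bG e))) λ ()

-- Isomorphism classes are counted by predicates with pairwise isomorphic members. No member has to
-- be constructed, and empty or repeated classes only weaken the bound.
record Class (n : ℕ) : Set₁ where
  field
    Member   : GraphCode n → Set
    coherent : ∀ {G H} → Member G → Member H → G ≅ᵍ H

open Class

classOf : ∀ {n} {I J : Set} → (I → J → Bool) → Class n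
classOf M = record { Member = Realises M ; coherent = realises-unique }

rows : ∀ {a b} → Vec (Subset b) a → Fin a → Fin b → Bool
rows v r c = lookup (lookup v r) c

-- The first t rows are stored as a vector of columns.
stacked : ∀ {t a b} → Vec (Subset t) b × Vec (Subset b) a → Fin t ⊎ Fin a → Fin b → Bool
stacked (cols , R) (inj₁ r) c = lookup (lookup cols c) r
stacked (cols , R) (inj₂ r) c = lookup (lookup R r) c

module _ {n : ℕ} where

  -- With fewer than `t` vertices on one side there are so few matrices that all are listed;
  -- symmetry is exploited only when both sides are large.
  sparseClasses denseClasses : ℕ → ℕ → ℕ → List (Class n)
  sparseClasses t a b = map (λ v → classOf (rows v)) (vectors (subsets b) a)
  denseClasses t a b = map (λ CR → classOf (stacked CR))
    (cartesianProduct (multisets (subsets t) b) (multisets (subsets b) (a ∸ t)))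

  classesFrom : ∀ t a b → Dec (t ≤ a × t ≤ b) → List (Class n)
  classesFrom t a b (yes _) = denseClasses t a b
  classesFrom t a b (no _)  = sparseClasses t a b

  classes : ℕ → ℕ → ℕ → List (Class n)
  classes t a b = classesFrom t a b ((t ℕ.≤? a) ×-dec (t ℕ.≤? b))

  sparse-member : ∀ t {a b} {M : Fin a → Fin b → Bool} {G} → Realises M G →
    ∃[ K ] K ∈ˡ sparseClasses t a b × Member K G
  sparse-member t {a} {b} {M} g = classOf (rows v) , ∈-map⁺ (λ v → classOf (rows v)) (∈-vectors (∈-vectors ∈-bools) v) ,
    realises-cong (λ r c → sym (entries r c)) g
    where
    v = tabulate (λ r → tabulate (M r))
    entries : ∀ r c → rows v r c ≡ M r c
    entries r c = trans (cong (λ u → lookup u c) (lookup∘tabulate (λ r → tabulate (M r)) r)) (lookup∘tabulate (M r) c)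

  -- The permutation `β` sorts the columns by their first `t` entries. The permutation `α` then
  -- sorts the other rows, already rearranged by `β`, and leaves the first `t` rows alone.
  stacked-member : ∀ {t a b} {M : Fin t ⊎ Fin a → Fin b → Bool} {G : GraphCode n} → Realises M G →
    ∃[ CR ] CR ∈ˡ cartesianProduct (multisets (subsets t) b) (multisets (subsets b) a) × Realises (stacked CR) G
  stacked-member {t} {a} {b} {M} {G} g =
    let (β , C∈) = ∈-multisets (≡-dec _≟ᵇ_) (subsets t) b columns (λ c → ∈-vectors ∈-bools (columns c))
        (α , R∈) = ∈-multisets (≡-dec _≟ᵇ_) (subsets b) a (remaining β) (λ r → ∈-vectors ∈-bools (remaining β r))
    in _ , ∈-cartesianProduct⁺ C∈ R∈ , realises-cong (entries β α) (realises-reindex (fixed α) β g)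
    where
    columns : Fin b → Subset t
    columns c = tabulate (λ r → M (inj₁ r) c)
    remaining : Permutation′ b → Fin a → Subset b
    remaining β r = tabulate (λ c → M (inj₂ r) (β ⟨$⟩ʳ c))
    fixed : Permutation′ a → (Fin t ⊎ Fin a) ↔ (Fin t ⊎ Fin a)
    fixed α = mk↔ₛ′ (Sum.map₂ (to α)) (Sum.map₂ (from α))
      (λ { (inj₁ _) → refl ; (inj₂ r) → cong inj₂ (strictlyInverseˡ α r) })
      (λ { (inj₁ _) → refl ; (inj₂ r) → cong inj₂ (strictlyInverseʳ α r) })
    entries : ∀ β α r c → M (to (fixed α) r) (to β c) ≡
      stacked (tabulate (λ c → columns (β ⟨$⟩ʳ c)) , tabulate (λ r → remaining β (α ⟨$⟩ʳ r))) r c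
    entries β α (inj₁ r) c = sym (trans (cong (λ u → lookup u r) (lookup∘tabulate (λ c → columns (β ⟨$⟩ʳ c)) c))
      (lookup∘tabulate (λ r → M (inj₁ r) (β ⟨$⟩ʳ c)) r))
    entries β α (inj₂ r) c = sym (trans (cong (λ u → lookup u c) (lookup∘tabulate (λ r → remaining β (α ⟨$⟩ʳ r)) r))
      (lookup∘tabulate (λ c → M (inj₂ (α ⟨$⟩ʳ r)) (β ⟨$⟩ʳ c)) c))

  dense-member : ∀ {t a b} {M : Fin a → Fin b → Bool} {G} → t ≤ a → Realises M G →
    ∃[ K ] K ∈ˡ denseClasses t a b × Member K G
  dense-member {t} {a} {b} {M} {G} t≤a g =
    let (CR , CR∈ , g′) = stacked-member {t} {a ∸ t} (realises-reindex (↔-sym (Fin.+↔⊎ {t})) (↔-id _) cast)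
    in classOf (stacked CR) , ∈-map⁺ (λ CR → classOf (stacked CR)) CR∈ , g′
    where
    cast : Realises (λ r → subst (λ a → Fin a → Fin b → Bool) (sym (ℕ.m+[n∸m]≡n t≤a)) M r) G
    cast = castTo (sym (ℕ.m+[n∸m]≡n t≤a))
      where
      castTo : ∀ {a′} (eq : a ≡ a′) → Realises (subst (λ a → Fin a → Fin b → Bool) eq M) G
      castTo refl = g

  classes-member : ∀ t {a b} {M : Fin a → Fin b → Bool} {G} → Realises M G → ∃[ K ] K ∈ˡ classes t a b × Member K G
  classes-member t {a} {b} {G = G} g = cases ((t ℕ.≤? a) ×-dec (t ℕ.≤? b))
    where
    cases : ∀ d → ∃[ K ] K ∈ˡ classesFrom t a b d × Member K G
    cases (yes (t≤a , _)) = dense-member t≤a g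
    cases (no _)          = sparse-member t g

allClasses : ℕ → ∀ n → List (Class n)
allClasses t n = concatMap (λ a → classes t a (n ∸ a)) (upTo (suc n))

b-unl≤classes : ∀ t n → b-unl n ≤ length (allClasses t n)
b-unl≤classes t n = length-≤ (graphSetoid n) {xs = List.deduplicate _≅ᵍ?_ (bicolouredGraphs n)} {allClasses t n}
  (λ G K → Member K G) (unique (graphs-unl n)) image (λ {_} {_} {K} → coherent K)
  where
  image : ∀ {G} → G ∈ˡ List.deduplicate _≅ᵍ?_ (bicolouredGraphs n) → ∃[ K ] K ∈ˡ allClasses t n × Member K G
  image {G@(A , E)} G∈ =
    let (K , K∈ , m) = classes-member t {∣ A ∣} {∣ ∁ A ∣} (realises-matrix G (sound (graphs-unl n) G∈))
    in K , ∈-concatMap⁺ (λ a → classes t a (n ∸ a)) (lose (∈-upTo⁺ (s≤s (∣p∣≤n A)))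
         (subst (λ b → K ∈ˡ classes t ∣ A ∣ b) (∣∁p∣≡n∸∣p∣ A) K∈)) , m

-- The size of the lists of classes

length-vectors : ∀ {A : Set} (xs : List A) n → length (vectors xs n) ≡ length xs ^ n
length-vectors xs zero    = refl
length-vectors xs (suc n) = trans (length-cartesianProductWith _∷_ xs (vectors xs n)) (cong (length xs *_) (length-vectors xs n))

binomial-! : ∀ n k → k ≤ n → (n C k) * (k ! * (n ∸ k) !) ≡ n !
binomial-! n k k≤n = trans (cong (_* (k ! * (n ∸ k) !)) (nCk≡n!/k![n-k]! k≤n)) (m/n*n≡m (k![n∸k]!∣n! k≤n))
  where instance _ = k ℕ.!* (n ∸ k) !≢0

falling-≤ : ∀ n t c → t + c ≤ n → (t + c) ! ≤ n ^ t * c !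
falling-≤ n zero    c _   = ℕ.≤-reflexive (sym (ℕ.*-identityˡ (c !)))
falling-≤ n (suc t) c t≤n = ℕ.≤-trans (ℕ.*-mono-≤ t≤n (falling-≤ n t c (ℕ.<⇒≤ t≤n))) (ℕ.≤-reflexive (sym (ℕ.*-assoc n (n ^ t) (c !))))

length-subsets : ∀ n → length (subsets n) ≡ 2 ^ n
length-subsets = length-vectors bools

length-concatMap-applyUpTo : ∀ {ℓ} {A : Set ℓ} (f : ℕ → List A) (g : ℕ → ℕ) m →
  length (concatMap f (applyUpTo g m)) ≡ ∑ m (λ i → length (f (g i)))
length-concatMap-applyUpTo f g zero    = refl
length-concatMap-applyUpTo f g (suc m) = trans (List.length-++ (f (g 0)))
  (cong (length (f (g 0)) +_) (length-concatMap-applyUpTo f (g ∘ suc) m))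

module _ {n : ℕ} (t : ℕ) (2n²≤2^t : 2 * (n * n) ≤ 2 ^ t) where

  -- Each of the two multiset estimates loses a factor two, together 4. Sorting only `a ∸ t` rows
  -- saves `(a ∸ t) !` instead of `a !`, which loses at most `n ^ t`.
  length-dense : ∀ a → a ≤ n → t ≤ a → t ≤ n ∸ a →
    length (denseClasses {n} t a (n ∸ a)) * n ! ≤ 4 * n ^ t * ((n C a) * 2 ^ (a * (n ∸ a)))
  length-dense a a≤n t≤a t≤b = begin
    length (denseClasses {n} t a b) * n !
      ≡⟨ cong₂ _*_ (trans (List.length-map _ (cartesianProduct (multisets (subsets t) b) (multisets (subsets b) c)))
           (length-cartesianProductWith _,_ (multisets (subsets t) b) (multisets (subsets b) c)))
           (sym (binomial-! n a a≤n)) ⟩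
    X * Y * ((n C a) * (a ! * b !))
      ≡⟨ shuffle X Y (n C a) (a !) (b !) ⟩
    (n C a) * ((X * b !) * (Y * a !))
      ≤⟨ ℕ.*-monoʳ-≤ (n C a) (ℕ.*-mono-≤ X≤ (ℕ.≤-trans (ℕ.*-monoʳ-≤ Y a!≤)
           (ℕ.≤-trans (ℕ.≤-reflexive (swap′ Y (n ^ t) (c !))) (ℕ.*-monoʳ-≤ (n ^ t) Y≤)))) ⟩
    (n C a) * ((2 * 2 ^ (t * b)) * (n ^ t * (2 * 2 ^ (b * c))))
      ≡⟨ collect (n C a) (n ^ t) (2 ^ (t * b)) (2 ^ (b * c)) ⟩
    4 * n ^ t * ((n C a) * (2 ^ (t * b) * 2 ^ (b * c)))
      ≡⟨ cong (λ e → 4 * n ^ t * ((n C a) * e)) (trans (sym (ℕ.^-distribˡ-+-* 2 (t * b) (b * c))) (cong (2 ^_) exponent)) ⟩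
    4 * n ^ t * ((n C a) * 2 ^ (a * b)) ∎
    where
    open ℕ.≤-Reasoning
    b = n ∸ a
    c = a ∸ t
    X = length (multisets (subsets t) b)
    Y = length (multisets (subsets b) c)
    shuffle : ∀ X Y k f g → X * Y * (k * (f * g)) ≡ k * ((X * g) * (Y * f))
    shuffle = solve-∀
    swap′ : ∀ Y p f → Y * (p * f) ≡ p * (Y * f)
    swap′ = solve-∀
    collect : ∀ k p u v → k * ((2 * u) * (p * (2 * v))) ≡ 4 * p * (k * (u * v))
    collect = solve-∀
    2m²≤ : ∀ m s → m ≤ n → t ≤ s → 2 * (m * m) ≤ length (subsets s)
    2m²≤ m s m≤n t≤s = ℕ.≤-trans (ℕ.*-monoʳ-≤ 2 (ℕ.*-mono-≤ m≤n m≤n)) (ℕ.≤-trans 2n²≤2^t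
      (ℕ.≤-trans (ℕ.^-monoʳ-≤ 2 t≤s) (ℕ.≤-reflexive (sym (length-subsets s)))))
    0<subsets : ∀ s → 0 < length (subsets s)
    0<subsets s = subst (0 <_) (sym (length-subsets s)) (ℕ.m^n>0 2 s)
    X≤ : X * b ! ≤ 2 * 2 ^ (t * b)
    X≤ = ℕ.≤-trans (length-multisets-≤ (subsets t) b (2m²≤ b t (ℕ.m∸n≤m n a) ℕ.≤-refl) (0<subsets t))
      (ℕ.≤-reflexive (cong (2 *_) (trans (cong (_^ b) (length-subsets t)) (ℕ.^-*-assoc 2 t b))))
    -- Here `t ≤ b` makes the possible rows numerous enough for the multiset estimate.
    Y≤ : Y * c ! ≤ 2 * 2 ^ (b * c)
    Y≤ = ℕ.≤-trans (length-multisets-≤ (subsets b) c (2m²≤ c b (ℕ.≤-trans (ℕ.m∸n≤m a t) a≤n) t≤b) (0<subsets b))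
      (ℕ.≤-reflexive (cong (2 *_) (trans (cong (_^ c) (length-subsets b)) (ℕ.^-*-assoc 2 b c))))
    a≡ : t + c ≡ a
    a≡ = ℕ.m+[n∸m]≡n t≤a
    a!≤ : a ! ≤ n ^ t * c !
    a!≤ = subst (λ k → k ! ≤ n ^ t * c !) a≡ (falling-≤ n t c (subst (_≤ n) (sym a≡) a≤n))
    exponent : t * b + b * c ≡ a * b
    exponent = trans (cong (t * b +_) (ℕ.*-comm b c)) (trans (sym (ℕ.*-distribʳ-+ b t c)) (cong (_* b) a≡))

  -- When a side has fewer than `t` vertices, a matrix has at most `t * n` entries, against about a
  -- quarter of `n * n` in the balanced case.
  length-sparse : ∀ a → a ≤ n → ¬ (t ≤ a × t ≤ n ∸ a) → length (sparseClasses {n} t a (n ∸ a)) ≤ 2 ^ (t * n)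
  length-sparse a a≤n unbalanced = begin
    length (sparseClasses {n} t a b) ≡⟨ trans (List.length-map _ (vectors (subsets b) a)) (length-vectors (subsets b) a) ⟩
    length (subsets b) ^ a           ≡⟨ trans (cong (_^ a) (length-subsets b)) (ℕ.^-*-assoc 2 b a) ⟩
    2 ^ (b * a)                      ≤⟨ ℕ.^-monoʳ-≤ 2 small ⟩
    2 ^ (t * n)                      ∎
    where
    open ℕ.≤-Reasoning
    b = n ∸ a
    small : b * a ≤ t * n
    small with t ℕ.≤? b
    ... | no t≰b  = ℕ.*-mono-≤ (ℕ.<⇒≤ (ℕ.≰⇒> t≰b)) a≤n
    ... | yes t≤b = ℕ.≤-trans (ℕ.≤-reflexive (ℕ.*-comm b a))
      (ℕ.*-mono-≤ (ℕ.<⇒≤ (ℕ.≰⇒> (λ t≤a → unbalanced (t≤a , t≤b)))) (ℕ.m∸n≤m n a))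

  length-classes : ∀ a → a ≤ n → length (classes {n} t a (n ∸ a)) * n ! ≤
    4 * n ^ t * ((n C a) * 2 ^ (a * (n ∸ a))) + n ! * 2 ^ (t * n)
  length-classes a a≤n = cases ((t ℕ.≤? a) ×-dec (t ℕ.≤? n ∸ a))
    where
    cases : ∀ d → length (classesFrom {n} t a (n ∸ a) d) * n ! ≤
      4 * n ^ t * ((n C a) * 2 ^ (a * (n ∸ a))) + n ! * 2 ^ (t * n)
    cases (yes (t≤a , t≤b)) = ℕ.≤-trans (length-dense a a≤n t≤a t≤b) (ℕ.m≤m+n _ _)
    cases (no unbalanced)   = ℕ.≤-trans (ℕ.*-monoˡ-≤ (n !) (length-sparse a a≤n unbalanced))
      (ℕ.≤-trans (ℕ.≤-reflexive (ℕ.*-comm (2 ^ (t * n)) (n !))) (ℕ.m≤n+m _ _))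

  b-unl-upper : b-unl n * n ! ≤ 4 * n ^ t * b-lbl n + suc n * (n ! * 2 ^ (t * n))
  b-unl-upper = begin
    b-unl n * n !                      ≤⟨ ℕ.*-monoˡ-≤ (n !) (b-unl≤classes t n) ⟩
    length (allClasses t n) * n !      ≡⟨ cong (_* n !) (length-concatMap-applyUpTo (λ a → classes {n} t a (n ∸ a)) id (suc n)) ⟩
    ∑ (suc n) len * n !                ≡⟨ ℕ.*-comm (∑ (suc n) len) (n !) ⟩
    n ! * ∑ (suc n) len                ≡⟨ ∑-* (suc n) (n !) len ⟨
    ∑ (suc n) (λ a → n ! * len a)      ≤⟨ ∑-mono (suc n) (λ { a (s≤s a≤n) →
                                              ℕ.≤-trans (ℕ.≤-reflexive (ℕ.*-comm (n !) (len a))) (length-classes a a≤n) }) ⟩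
    ∑ (suc n) (λ a → 4 * n ^ t * term a + rest) ≡⟨ ∑-+ (suc n) (λ a → 4 * n ^ t * term a) (λ _ → rest) ⟩
    ∑ (suc n) (λ a → 4 * n ^ t * term a) + ∑ (suc n) (λ _ → rest)
      ≡⟨ cong₂ _+_ (trans (∑-* (suc n) (4 * n ^ t) term) (cong (4 * n ^ t *_) (sym (b-lbl-∑ n)))) (∑-const (suc n) rest) ⟩
    4 * n ^ t * b-lbl n + suc n * rest ∎
    where
    open ℕ.≤-Reasoning
    len term : ℕ → ℕ
    len a = length (classes {n} t a (n ∸ a))
    term a = (n C a) * 2 ^ (a * (n ∸ a))
    rest = n ! * 2 ^ (t * n)

-- Superpolynomial growth

log-bounds : ∀ n → ∃[ ℓ ] suc n ≤ 2 ^ ℓ × 2 ^ ℓ ≤ 2 * suc n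
log-bounds zero = 0 , s≤s z≤n , s≤s z≤n
log-bounds (suc n) with log-bounds n
... | ℓ , lower , upper with suc (suc n) ℕ.≤? 2 ^ ℓ
...   | yes p = ℓ , p , ℕ.≤-trans upper (ℕ.*-monoʳ-≤ 2 (ℕ.n≤1+n (suc n)))
...   | no p  = suc ℓ , (begin
    suc (suc n)   ≤⟨ s≤s lower ⟩
    1 + 2 ^ ℓ     ≤⟨ ℕ.+-monoˡ-≤ (2 ^ ℓ) (ℕ.m^n>0 2 ℓ) ⟩
    2 ^ ℓ + 2 ^ ℓ ≡⟨ cong (2 ^ ℓ +_) (ℕ.+-identityʳ (2 ^ ℓ)) ⟨
    2 ^ suc ℓ     ∎) , ℕ.*-monoʳ-≤ 2 (ℕ.<⇒≤ (ℕ.≰⇒> p))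
  where open ℕ.≤-Reasoning

-- The exponents in the bound for `m * overhead n * Q` apart from `m` and `k` sum to
-- `2 ℓ² + 5 ℓ + 9`; a further `ℓ` bounds `m`, and 3 absorbs the rounding in `k` and `⌊ n /2⌋`.
slack : ℕ → ℕ
slack ℓ = 2 * (ℓ * ℓ) + 6 * ℓ + 12

slack-suc : ∀ ℓ → slack (suc ℓ) ≤ 2 * slack ℓ
slack-suc ℓ = ℕ.≤-trans (ℕ.m≤m+n (slack (suc ℓ)) (2 * (ℓ * ℓ) + 2 * ℓ + 4)) (ℕ.≤-reflexive (doubles ℓ))
  where
  doubles : ∀ ℓ → (2 * (suc ℓ * suc ℓ) + 6 * suc ℓ + 12) + (2 * (ℓ * ℓ) + 2 * ℓ + 4) ≡ 2 * (2 * (ℓ * ℓ) + 6 * ℓ + 12)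
  doubles = solve-∀

-- The constant is twice twelve because `2 ^ ℓ` can be twice as large as the number of vertices. At
-- 15 the claim is `13248 ≤ 32768`; from there on the left side at most doubles.
24slack≤2^ : ∀ x → 24 * slack (x + 15) ≤ 2 ^ (x + 15)
24slack≤2^ zero    = ℕ.≤ᵇ⇒≤ (24 * slack 15) (2 ^ 15) _
24slack≤2^ (suc x) = begin
  24 * slack (suc x + 15)   ≤⟨ ℕ.*-monoʳ-≤ 24 (slack-suc (x + 15)) ⟩
  24 * (2 * slack (x + 15)) ≡⟨ swap-2 (slack (x + 15)) ⟩
  2 * (24 * slack (x + 15)) ≤⟨ ℕ.*-monoʳ-≤ 2 (24slack≤2^ x) ⟩
  2 ^ (suc x + 15)          ∎
  where
  open ℕ.≤-Reasoning
  swap-2 : ∀ s → 24 * (2 * s) ≡ 2 * (24 * s)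
  swap-2 = solve-∀

n≤2h+1 : ∀ n → n ≤ 2 * ⌊ n /2⌋ + 1
n≤2h+1 zero          = z≤n
n≤2h+1 (suc zero)    = s≤s z≤n
n≤2h+1 (suc (suc n)) = ℕ.≤-trans (s≤s (s≤s (n≤2h+1 n))) (ℕ.≤-reflexive (shift ⌊ n /2⌋))
  where
  shift : ∀ h → suc (suc (2 * h + 1)) ≡ 2 * suc h + 1
  shift = solve-∀

m≤2^m : ∀ m → m ≤ 2 ^ m
m≤2^m m = ℕ.<⇒≤ (lt m)
  where
  lt : ∀ m → m < 2 ^ m
  lt zero    = s≤s z≤n
  lt (suc m) = ℕ.≤-trans (ℕ.+-mono-≤ (ℕ.m^n>0 2 m) (lt m)) (ℕ.≤-reflexive (cong (2 ^ m +_) (sym (ℕ.+-identityʳ (2 ^ m)))))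

-- ℓ plays the role of ⌈log₂ n⌉; the last hypothesis says that n is large.
module Large (m n ℓ : ℕ) (m≤ℓ : m ≤ ℓ) (0<n : 0 < n) (n≤2^ℓ : n ≤ 2 ^ ℓ) (12slack≤n : 12 * slack ℓ ≤ n) where

  open ℕ.≤-Reasoning

  private
    h k t L K : ℕ
    h = ⌊ n /2⌋
    k = codeSize n
    -- Gives `2 ^ t = 2 * (L * L)`, which is at least `2 * (n * n)`, as the multiset estimate
    -- requires.
    t = 2 * ℓ + 1
    L = 2 ^ ℓ
    K = 2 ^ k

    1≤L : 1 ≤ L
    1≤L = ℕ.m^n>0 2 ℓ
    1≤K : 1 ≤ K
    1≤K = ℕ.m^n>0 2 k
    suc-n≤ : suc n ≤ 2 * L
    suc-n≤ = ℕ.≤-trans (ℕ.+-mono-≤ 1≤L n≤2^ℓ) (ℕ.≤-reflexive (cong (L +_) (sym (ℕ.+-identityʳ L))))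

  overhead≤ : overhead n ≤ 2 ^ (k + 3 * ℓ + 5)
  overhead≤ = begin
    suc n * suc (n * W + n * W)         ≤⟨ ℕ.*-mono-≤ suc-n≤ (ℕ.+-mono-≤ (ℕ.*-mono-≤ (ℕ.*-mono-≤ 1≤K 1≤L) 1≤L)
                                             (ℕ.+-mono-≤ (ℕ.*-mono-≤ n≤2^ℓ W≤) (ℕ.*-mono-≤ n≤2^ℓ W≤))) ⟩
    -- The left side equals `18 * K * L ^ 3`; adding 14 such terms rounds the constant up to
    -- `2 ^ 5`.
    2 * L * (K * L * L + (L * (4 * (K * L)) + L * (4 * (K * L)))) ≤⟨ ℕ.m≤m+n _ (14 * (L * (K * L * L))) ⟩
    2 * L * (K * L * L + (L * (4 * (K * L)) + L * (4 * (K * L)))) + 14 * (L * (K * L * L)) ≡⟨ collect K L ⟩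
    K * (L * (L * L)) * 32              ≡⟨ cong (λ z → K * z * 32) cube ⟩
    K * 2 ^ (3 * ℓ) * 2 ^ 5             ≡⟨ cong (_* 2 ^ 5) (ℕ.^-distribˡ-+-* 2 k (3 * ℓ)) ⟨
    2 ^ (k + 3 * ℓ) * 2 ^ 5             ≡⟨ ℕ.^-distribˡ-+-* 2 (k + 3 * ℓ) 5 ⟨
    2 ^ (k + 3 * ℓ + 5)                 ∎
    where
    W = 1 + (K + suc n * K)
    collect : ∀ K L → 2 * L * (K * L * L + (L * (4 * (K * L)) + L * (4 * (K * L)))) + 14 * (L * (K * L * L)) ≡ K * (L * (L * L)) * 32
    collect = solve-∀
    cube : L * (L * L) ≡ 2 ^ (3 * ℓ)
    cube = trans (cong (λ z → L * (L * z)) (sym (ℕ.*-identityʳ L))) (trans (ℕ.^-*-assoc 2 ℓ 3) (cong (2 ^_) (ℕ.*-comm ℓ 3)))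
    W≤ : W ≤ 4 * (K * L)
    W≤ = ℕ.≤-trans (ℕ.+-mono-≤ (ℕ.*-mono-≤ 1≤K 1≤L) (ℕ.+-mono-≤ (ℕ.m≤m*n K L {{>-nonZero 1≤L}}) (ℕ.*-monoˡ-≤ K suc-n≤)))
      (ℕ.≤-reflexive (collectW K L))
      where
      collectW : ∀ K L → K * L + (K * L + 2 * L * K) ≡ 4 * (K * L)
      collectW = solve-∀

  -- The heart of the comparison of `n / 3` with `n / 2`. After multiplication by six,
  -- `6 k ≤ 2 n + 8` and `3 n ≤ 6 h + 3` leave room of size `n` for six times the other terms.
  exponent≤ : m + k + (2 * (ℓ * ℓ) + 5 * ℓ + 9) ≤ h
  exponent≤ = ℕ.*-cancelˡ-≤ 6 (ℕ.+-cancelʳ-≤ 3 _ _ (begin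
    6 * (m + k + e) + 3                 ≡⟨ split m k e ⟩
    6 * (m + e) + (2 * (3 * k) + 3)     ≤⟨ ℕ.+-monoʳ-≤ (6 * (m + e)) (ℕ.+-monoˡ-≤ 3 (ℕ.*-monoʳ-≤ 2 3k≤)) ⟩
    6 * (m + e) + (2 * (n + 4) + 3)     ≤⟨ ℕ.m≤m+n _ 7 ⟩
    6 * (m + e) + (2 * (n + 4) + 3) + 7 ≡⟨ regroup (m + e) n ⟩
    6 * (m + e + 3) + 2 * n             ≤⟨ ℕ.+-monoˡ-≤ (2 * n) (ℕ.≤-trans (ℕ.*-monoʳ-≤ 6 m+e≤)
                                             (ℕ.≤-trans (ℕ.*-monoˡ-≤ (slack ℓ) {6} {12} (ℕ.m≤m+n 6 6)) 12slack≤n)) ⟩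
    n + 2 * n                           ≡⟨⟩
    3 * n                               ≤⟨ ℕ.*-monoʳ-≤ 3 (n≤2h+1 n) ⟩
    3 * (2 * h + 1)                     ≡⟨ triple h ⟩
    6 * h + 3                           ∎))
    where
    e = 2 * (ℓ * ℓ) + 5 * ℓ + 9
    split : ∀ m k e → 6 * (m + k + e) + 3 ≡ 6 * (m + e) + (2 * (3 * k) + 3)
    split = solve-∀
    regroup : ∀ a n → 6 * a + (2 * (n + 4) + 3) + 7 ≡ 6 * (a + 3) + 2 * n
    regroup = solve-∀
    triple : ∀ h → 3 * (2 * h + 1) ≡ 6 * h + 3
    triple = solve-∀
    m+e≤ : m + e + 3 ≤ slack ℓ
    m+e≤ = ℕ.≤-trans (ℕ.+-monoˡ-≤ 3 (ℕ.+-monoˡ-≤ e m≤ℓ)) (ℕ.≤-reflexive (total ℓ))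
      where
      total : ∀ ℓ → ℓ + (2 * (ℓ * ℓ) + 5 * ℓ + 9) + 3 ≡ 2 * (ℓ * ℓ) + 6 * ℓ + 12
      total = solve-∀
    3k≤ : 3 * k ≤ n + 4
    3k≤ = ℕ.≤-trans (ℕ.≤-reflexive (ℕ.*-comm 3 k)) (ℕ.≤-trans (ℕ.+-monoʳ-≤ 3 (m/n*n≤m (suc n) 3)) (ℕ.≤-reflexive (ℕ.+-comm 4 n)))

  10ℓ+4≤h : 10 * ℓ + 4 ≤ h
  10ℓ+4≤h = ℕ.*-cancelˡ-≤ 2 (ℕ.+-cancelʳ-≤ 1 _ _ (begin
    2 * (10 * ℓ + 4) + 1                                                ≤⟨ ℕ.m≤m+n _ (24 * (ℓ * ℓ) + 52 * ℓ + 135) ⟩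
    2 * (10 * ℓ + 4) + 1 + (24 * (ℓ * ℓ) + 52 * ℓ + 135)                ≡⟨ total ℓ ⟩
    12 * slack ℓ                                                        ≤⟨ 12slack≤n ⟩
    n                                                                   ≤⟨ n≤2h+1 n ⟩
    2 * h + 1                                                           ∎))
    where
    total : ∀ ℓ → 2 * (10 * ℓ + 4) + 1 + (24 * (ℓ * ℓ) + 52 * ℓ + 135) ≡ 12 * (2 * (ℓ * ℓ) + 6 * ℓ + 12)
    total = solve-∀

  -- The left side is an exponent for `suc n * (n ! * 2 ^ (t * n))`, of order `n log n`, while
  -- `h * h` is quadratic in `n`.
  square-exponent≤ : suc ℓ + (ℓ * n + t * n) ≤ h * h
  square-exponent≤ = begin
    suc ℓ + (ℓ * n + t * n)                             ≡⟨ factor ℓ n ⟩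
    suc ℓ + (3 * ℓ + 1) * n                             ≤⟨ ℕ.+-monoʳ-≤ (suc ℓ) (ℕ.*-monoʳ-≤ (3 * ℓ + 1) (n≤2h+1 n)) ⟩
    suc ℓ + (3 * ℓ + 1) * (2 * h + 1)                   ≡⟨ expand ℓ h ⟩
    (4 * ℓ + 2) * 1 + (6 * ℓ + 2) * h                   ≤⟨ ℕ.+-monoˡ-≤ ((6 * ℓ + 2) * h) (ℕ.*-monoʳ-≤ (4 * ℓ + 2) 1≤h) ⟩
    (4 * ℓ + 2) * h + (6 * ℓ + 2) * h                   ≡⟨ total ℓ h ⟩
    (10 * ℓ + 4) * h                                    ≤⟨ ℕ.*-monoˡ-≤ h 10ℓ+4≤h ⟩
    h * h                                               ∎
    where
    1≤h : 1 ≤ h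
    1≤h = ℕ.≤-trans (ℕ.≤-trans (s≤s z≤n) (ℕ.m≤n+m 4 (10 * ℓ))) 10ℓ+4≤h
    factor : ∀ ℓ n → suc ℓ + (ℓ * n + (2 * ℓ + 1) * n) ≡ suc ℓ + (3 * ℓ + 1) * n
    factor = solve-∀
    expand : ∀ ℓ h → suc ℓ + (3 * ℓ + 1) * (2 * h + 1) ≡ (4 * ℓ + 2) * 1 + (6 * ℓ + 2) * h
    expand = solve-∀
    total : ∀ ℓ h → (4 * ℓ + 2) * h + (6 * ℓ + 2) * h ≡ (10 * ℓ + 4) * h
    total = solve-∀

  2^h²≤b-lbl : 2 ^ (h * h) ≤ b-lbl n
  2^h²≤b-lbl = begin
    2 ^ (h * h)               ≤⟨ ℕ.^-monoʳ-≤ 2 (ℕ.*-monoʳ-≤ h h≤n∸h) ⟩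
    2 ^ (h * (n ∸ h))         ≤⟨ ℕ.m≤n*m _ (n C h) {{nCh≢0}} ⟩
    (n C h) * 2 ^ (h * (n ∸ h)) ≤⟨ ∑-term (suc n) (λ i → (n C i) * 2 ^ (i * (n ∸ i))) h (s≤s h≤n) ⟩
    ∑ (suc n) (λ i → (n C i) * 2 ^ (i * (n ∸ i))) ≡⟨ b-lbl-∑ n ⟨
    b-lbl n                   ∎
    where
    h≤n : h ≤ n
    h≤n = ℕ.⌊n/2⌋≤n n
    h≤n∸h : h ≤ n ∸ h
    h≤n∸h = ℕ.≤-trans (ℕ.⌊n/2⌋≤⌈n/2⌉ n) (ℕ.≤-reflexive
      (trans (sym (ℕ.m+n∸m≡n h ⌈ n /2⌉)) (cong (_∸ h) (ℕ.⌊n/2⌋+⌈n/2⌉≡n n))))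
    nCh≢0 : NonZero (n C h)
    nCh≢0 = ℕ.m*n≢0⇒m≢0 (n C h) {{subst NonZero (sym (binomial-! n h h≤n)) (n ℕ.!≢0)}}

  rest≤b-lbl : suc n * (n ! * 2 ^ (t * n)) ≤ b-lbl n
  rest≤b-lbl = begin
    suc n * (n ! * 2 ^ (t * n))             ≤⟨ ℕ.*-mono-≤ suc-n≤ (ℕ.*-monoˡ-≤ (2 ^ (t * n)) n!≤) ⟩
    2 ^ suc ℓ * (2 ^ (ℓ * n) * 2 ^ (t * n)) ≡⟨ cong (2 ^ suc ℓ *_) (ℕ.^-distribˡ-+-* 2 (ℓ * n) (t * n)) ⟨
    2 ^ suc ℓ * 2 ^ (ℓ * n + t * n)         ≡⟨ ℕ.^-distribˡ-+-* 2 (suc ℓ) (ℓ * n + t * n) ⟨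
    2 ^ (suc ℓ + (ℓ * n + t * n))           ≤⟨ ℕ.^-monoʳ-≤ 2 square-exponent≤ ⟩
    2 ^ (h * h)                             ≤⟨ 2^h²≤b-lbl ⟩
    b-lbl n                                 ∎
    where
    n!≤ : n ! ≤ 2 ^ (ℓ * n)
    n!≤ = begin
      n !           ≡⟨ cong _! (ℕ.+-identityʳ n) ⟨
      (n + 0) !     ≤⟨ falling-≤ n n 0 (ℕ.≤-reflexive (ℕ.+-identityʳ n)) ⟩
      n ^ n * 1     ≡⟨ ℕ.*-identityʳ (n ^ n) ⟩
      n ^ n         ≤⟨ ℕ.^-monoˡ-≤ n n≤2^ℓ ⟩
      (2 ^ ℓ) ^ n   ≡⟨ ℕ.^-*-assoc 2 ℓ n ⟩
      2 ^ (ℓ * n)   ∎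

  private
    Q : ℕ
    -- The loss in `b-unl-growth`: `5 * n ^ t` from the passage to labelled graphs, where the sparse
    -- classes raise 4 to 5, and `suc n` from the quotient of consecutive factorials.
    Q = 5 * n ^ t * suc n

    instance
      n≢0 : NonZero n
      n≢0 = >-nonZero 0<n
      n^t≢0 : NonZero (n ^ t)
      n^t≢0 = ℕ.m^n≢0 n t
      Q≢0 : NonZero Q
      Q≢0 = ℕ.m*n≢0 (5 * n ^ t) (suc n) {{ℕ.m*n≢0 5 (n ^ t)}}

    2n²≤2^t : 2 * (n * n) ≤ 2 ^ t
    2n²≤2^t = begin
      2 * (n * n)     ≤⟨ ℕ.*-monoʳ-≤ 2 (ℕ.*-mono-≤ n≤2^ℓ n≤2^ℓ) ⟩
      2 * (L * L)     ≡⟨ cong (2 *_) (ℕ.^-distribˡ-+-* 2 ℓ ℓ) ⟨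
      2 ^ suc (ℓ + ℓ) ≡⟨ cong (2 ^_) (double ℓ) ⟩
      2 ^ t           ∎
      where
      double : ∀ ℓ → suc (ℓ + ℓ) ≡ 2 * ℓ + 1
      double = solve-∀

    Q≤ : Q ≤ 2 ^ (ℓ * t + ℓ + 4)
    Q≤ = begin
      5 * n ^ t * suc n                  ≤⟨ ℕ.*-mono-≤ (ℕ.*-mono-≤ {5} {8} (ℕ.m≤m+n 5 3) (ℕ.^-monoˡ-≤ t n≤2^ℓ)) suc-n≤ ⟩
      8 * L ^ t * (2 * L)                ≡⟨ cong (λ z → 8 * z * (2 * L)) (ℕ.^-*-assoc 2 ℓ t) ⟩
      8 * 2 ^ (ℓ * t) * (2 * L)          ≡⟨ collect (2 ^ (ℓ * t)) L ⟩
      2 ^ (ℓ * t) * L * 2 ^ 4            ≡⟨ cong (_* 2 ^ 4) (ℕ.^-distribˡ-+-* 2 (ℓ * t) ℓ) ⟨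
      2 ^ (ℓ * t + ℓ) * 2 ^ 4            ≡⟨ ℕ.^-distribˡ-+-* 2 (ℓ * t + ℓ) 4 ⟨
      2 ^ (ℓ * t + ℓ + 4)                ∎
      where
      collect : ∀ x L → 8 * x * (2 * L) ≡ x * L * 16
      collect = solve-∀

  m*overhead*Q≤ : m * overhead n * Q ≤ 2 ^ h
  m*overhead*Q≤ = begin
    m * overhead n * Q                                      ≤⟨ ℕ.*-mono-≤ (ℕ.*-mono-≤ (m≤2^m m) overhead≤) Q≤ ⟩
    2 ^ m * 2 ^ (k + 3 * ℓ + 5) * 2 ^ (ℓ * t + ℓ + 4)       ≡⟨ cong (_* 2 ^ (ℓ * t + ℓ + 4)) (ℕ.^-distribˡ-+-* 2 m (k + 3 * ℓ + 5)) ⟨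
    2 ^ (m + (k + 3 * ℓ + 5)) * 2 ^ (ℓ * t + ℓ + 4)         ≡⟨ ℕ.^-distribˡ-+-* 2 (m + (k + 3 * ℓ + 5)) (ℓ * t + ℓ + 4) ⟨
    2 ^ (m + (k + 3 * ℓ + 5) + (ℓ * t + ℓ + 4))             ≡⟨ cong (2 ^_) (total m k ℓ) ⟩
    2 ^ (m + k + (2 * (ℓ * ℓ) + 5 * ℓ + 9))                 ≤⟨ ℕ.^-monoʳ-≤ 2 exponent≤ ⟩
    2 ^ h                                                   ∎
    where
    total : ∀ m k ℓ → m + (k + 3 * ℓ + 5) + (ℓ * (2 * ℓ + 1) + ℓ + 4) ≡ m + k + (2 * (ℓ * ℓ) + 5 * ℓ + 9)
    total = solve-∀

  growth-lbl : m * (overhead n * b-lbl n) ≤ b-lbl (suc n)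
  growth-lbl = begin
    m * (overhead n * b-lbl n) ≡⟨ ℕ.*-assoc m (overhead n) (b-lbl n) ⟨
    m * overhead n * b-lbl n   ≤⟨ ℕ.*-monoˡ-≤ (b-lbl n) (ℕ.≤-trans (ℕ.m≤m*n (m * overhead n) Q) m*overhead*Q≤) ⟩
    2 ^ h * b-lbl n            ≤⟨ b-lbl-growth n ⟩
    b-lbl (suc n)              ∎

  b-unl*n!≤ : b-unl n * n ! ≤ 5 * n ^ t * b-lbl n
  b-unl*n!≤ = begin
    b-unl n * n !                                         ≤⟨ b-unl-upper t 2n²≤2^t ⟩
    4 * n ^ t * b-lbl n + suc n * (n ! * 2 ^ (t * n))     ≤⟨ ℕ.+-monoʳ-≤ (4 * n ^ t * b-lbl n)
                                                               (ℕ.≤-trans rest≤b-lbl (ℕ.m≤n*m (b-lbl n) (n ^ t))) ⟩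
    4 * n ^ t * b-lbl n + n ^ t * b-lbl n                 ≡⟨ five (n ^ t) (b-lbl n) ⟩
    5 * n ^ t * b-lbl n                                   ∎
    where
    five : ∀ x y → 4 * x * y + x * y ≡ 5 * x * y
    five = solve-∀

  -- The growth is borrowed from labelled graphs: `b-unl*n!≤` leads to them, and `b-lbl≤n!*b-unl`
  -- leads back at size `suc n`.
  b-unl-growth : 2 ^ h * b-unl n ≤ Q * b-unl (suc n)
  b-unl-growth = ℕ.*-cancelʳ-≤ _ _ (n !) {{n ℕ.!≢0}} (begin
    2 ^ h * b-unl n * n !                      ≡⟨ ℕ.*-assoc (2 ^ h) (b-unl n) (n !) ⟩
    2 ^ h * (b-unl n * n !)                    ≤⟨ ℕ.*-monoʳ-≤ (2 ^ h) b-unl*n!≤ ⟩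
    2 ^ h * (5 * n ^ t * b-lbl n)              ≡⟨ swap-factors (2 ^ h) (5 * n ^ t) (b-lbl n) ⟩
    5 * n ^ t * (2 ^ h * b-lbl n)              ≤⟨ ℕ.*-monoʳ-≤ (5 * n ^ t) (ℕ.≤-trans (b-lbl-growth n) (b-lbl≤n!*b-unl (suc n))) ⟩
    5 * n ^ t * (suc n * n ! * b-unl (suc n))  ≡⟨ regroup (5 * n ^ t) (suc n) (n !) (b-unl (suc n)) ⟩
    5 * n ^ t * suc n * b-unl (suc n) * n !    ∎)
    where
    swap-factors : ∀ a b c → a * (b * c) ≡ b * (a * c)
    swap-factors = solve-∀
    regroup : ∀ a b c d → a * (b * c * d) ≡ a * b * d * c
    regroup = solve-∀

  growth-unl : m * (overhead n * b-unl n) ≤ b-unl (suc n)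
  growth-unl = ℕ.*-cancelˡ-≤ Q (begin
    Q * (m * (overhead n * b-unl n)) ≡⟨ regroup Q m (overhead n) (b-unl n) ⟩
    m * overhead n * Q * b-unl n     ≤⟨ ℕ.*-monoˡ-≤ (b-unl n) m*overhead*Q≤ ⟩
    2 ^ h * b-unl n                  ≤⟨ b-unl-growth ⟩
    Q * b-unl (suc n)                ∎)
    where
    regroup : ∀ q m o b → q * (m * (o * b)) ≡ m * o * q * b
    regroup = solve-∀

large : ∀ m → ∃[ N ] (∀ n → N ≤ n → m * (overhead n * b-lbl n) ≤ b-lbl (suc n) × m * (overhead n * b-unl n) ≤ b-unl (suc n))
-- This forces `m + 15 ≤ ℓ`: the `m` for the hypothesis `m ≤ ℓ`, the 15 for `24slack≤2^`.
large m = 2 ^ (m + 15) , λ { zero le → contradiction (ℕ.≤-trans (ℕ.m^n>0 2 (m + 15)) le) λ () ; (suc n) le → bounds n le }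
  where
  bounds : ∀ n → 2 ^ (m + 15) ≤ suc n → _ × _
  bounds n le = let
      (ℓ , lower , upper) = log-bounds n
      m+15≤ℓ = ℕ.≮⇒≥ (λ ℓ<m+15 → ℕ.<⇒≱ (ℕ.^-monoʳ-< 2 (s≤s (s≤s z≤n)) ℓ<m+15) (ℕ.≤-trans le lower))
      m≤ℓ = ℕ.≤-trans (ℕ.m≤m+n m 15) m+15≤ℓ
      15≤ℓ = ℕ.≤-trans (ℕ.m≤n+m 15 m) m+15≤ℓ
      24slack≤ = subst (λ ℓ → 24 * slack ℓ ≤ 2 ^ ℓ) (ℕ.m∸n+n≡m 15≤ℓ) (24slack≤2^ (ℓ ∸ 15))
      12slack≤ = ℕ.*-cancelˡ-≤ {12 * slack ℓ} {suc n} 2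
        (ℕ.≤-trans (ℕ.≤-reflexive (sym (ℕ.*-assoc 2 12 (slack ℓ)))) (ℕ.≤-trans 24slack≤ upper))
    in Large.growth-lbl m (suc n) ℓ m≤ℓ (s≤s z≤n) lower 12slack≤ , Large.growth-unl m (suc n) ℓ m≤ℓ (s≤s z≤n) lower 12slack≤

-- Asymptotic equivalence

∣⊖∣-≤ : ∀ {f g d} → f ≤ g + d → g ≤ f + d → ℤ.∣ f ⊖ g ∣ ≤ d
∣⊖∣-≤ {f} {g} {d} f≤ g≤ with ℕ.≤-total g f
... | inj₁ g≤f rewrite ℤ.⊖-≥ g≤f = ℕ.m≤n+o⇒m∸n≤o f g f≤
... | inj₂ f≤g rewrite ℤ.∣m⊖n∣≡∣n⊖m∣ f g | ℤ.⊖-≥ f≤g = ℕ.m≤n+o⇒m∸n≤o g f g≤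

numerator-≥1 : ∀ {ε} → 0ℚ ℚ.< ε → ∃[ a ] ↥ ε ≡ ℤ.+ suc a
numerator-≥1 {mkℚ (ℤ.+ suc a) _ _} _ = a , refl
numerator-≥1 {mkℚ (ℤ.+ zero) _ _} (ℚ.*<* (ℤ.+<+ ()))
numerator-≥1 {mkℚ ℤ.-[1+ _ ] _ _} (ℚ.*<* ())

-- A positive `ε` has numerator at least one, so it is at least `1 / ↧ₙ ε`, and it suffices that
-- `d / g` is below that.
ratio-close : ∀ f g d (ε : ℚ) → 0ℚ ℚ.< ε → (g≢0 : NonZero g) → f ≤ g + d → g ≤ f + d → ↧ₙ ε * d < g →
  ℚ.∣ ℚ._/_ (ℤ.+ f) g {{g≢0}} ℚ.- 1ℚ ∣ ℚ.< ε
ratio-close f (suc g) d ε@record{} 0<ε g≢0 f≤ g≤ close = ℚ.toℚᵘ-cancel-< (ℚᵘ.<-respˡ-≃ (ℚᵘ.≃-sym unnormalise) (*<* bound))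
  where
  x = mkℚᵘ (ℤ.+ f) g
  unnormalise : toℚᵘ ℚ.∣ (ℤ.+ f) ℚ./ suc g ℚ.- 1ℚ ∣ ℚᵘ.≃ ℚᵘ.∣ x ℚᵘ.- 1ℚᵘ ∣
  unnormalise = ℚᵘ.≃-trans (ℚ.toℚᵘ-homo-∣-∣ ((ℤ.+ f) ℚ./ suc g ℚ.- 1ℚ)) (ℚᵘ.∣-∣-cong
    (ℚᵘ.≃-trans (ℚ.toℚᵘ-homo-+ ((ℤ.+ f) ℚ./ suc g) (ℚ.- 1ℚ))
      (ℚᵘ.+-cong {toℚᵘ ((ℤ.+ f) ℚ./ suc g)} {x} {toℚᵘ (ℚ.- 1ℚ)} {ℚᵘ.- 1ℚᵘ} (ℚ.toℚᵘ-fromℚᵘ x) ℚᵘ.≃-refl)))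
  numerator : ℚᵘ.↥ (x ℚᵘ.- 1ℚᵘ) ≡ f ⊖ suc g
  numerator = cong₂ ℤ._+_ (ℤ.*-identityʳ (ℤ.+ f)) (ℤ.-1*i≡-i (ℤ.+ suc g))
  a = proj₁ (numerator-≥1 0<ε)
  bound : ℤ.+ ℤ.∣ ℚᵘ.↥ (x ℚᵘ.- 1ℚᵘ) ∣ ℤ.* ℤ.+ ↧ₙ ε ℤ.< ↥ ε ℤ.* ℤ.+ suc (g * 1)
  bound rewrite numerator | proj₂ (numerator-≥1 {ε} 0<ε) | ℕ.*-identityʳ g =
    subst₂ ℤ._<_ (ℤ.pos-* ℤ.∣ f ⊖ suc g ∣ (↧ₙ ε)) (ℤ.pos-* (suc a) (suc g)) (ℤ.+<+ (begin-strict
      ℤ.∣ f ⊖ suc g ∣ * ↧ₙ ε ≤⟨ ℕ.*-monoˡ-≤ (↧ₙ ε) (∣⊖∣-≤ f≤ g≤) ⟩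
      d * ↧ₙ ε               ≡⟨ ℕ.*-comm d (↧ₙ ε) ⟩
      ↧ₙ ε * d               <⟨ close ⟩
      suc g                  ≤⟨ ℕ.m≤n*m (suc g) (suc a) ⟩
      suc a * suc g          ∎))
    where open ℕ.≤-Reasoning

module _ {p b K : ℕ → ℕ} (b>0 : ∀ n → 0 < b n)
         (upper : ∀ n → p (suc n) ≤ b (suc n) + K n * p n)
         (lower : ∀ n → b (suc n) ≤ p (suc n) + K n * b n)
         (growth : ∀ m → ∃[ N ] (∀ n → N ≤ n → m * (K n * b n) ≤ b (suc n))) where

  -- p = O(b), because the correction in the upper bound is at most half of b.
  bounded : ∃[ c ] ∃[ N ] (∀ n → N ≤ n → p n ≤ c * b n)
  bounded = 2 * c , N , λ n N≤n → subst (λ n → p n ≤ 2 * c * b n) (ℕ.m∸n+n≡m N≤n) (go (n ∸ N))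
    where
    open ℕ.≤-Reasoning
    N = proj₁ (growth 2)
    -- At `N` it suffices that `p N ≤ c` and `1 ≤ b N`; in the induction `1 ≤ c` lets the main term
    -- `b (suc n)` fit into one of the two halves of `2 * c * b (suc n)`.
    c = suc (p N)
    go : ∀ k → p (k + N) ≤ 2 * c * b (k + N)
    go zero = begin
      p N            ≤⟨ ℕ.n≤1+n (p N) ⟩
      c              ≤⟨ ℕ.m≤n*m c 2 ⟩
      2 * c          ≤⟨ ℕ.m≤m*n (2 * c) (b N) {{>-nonZero (b>0 N)}} ⟩
      2 * c * b N    ∎
    go (suc k) = begin
      p (suc n)                                      ≤⟨ upper n ⟩
      b (suc n) + K n * p n                   ≤⟨ ℕ.+-monoʳ-≤ (b (suc n)) (ℕ.*-monoʳ-≤ (K n) (go k)) ⟩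
      b (suc n) + K n * (2 * c * b n)         ≡⟨ cong (b (suc n) +_) (pull (K n) c (b n)) ⟩
      b (suc n) + c * (2 * (K n * b n))       ≤⟨ ℕ.+-mono-≤ (ℕ.m≤n*m (b (suc n)) c) (ℕ.*-monoʳ-≤ c (proj₂ (growth 2) n (ℕ.m≤n+m N k))) ⟩
      c * b (suc n) + c * b (suc n)                  ≡⟨ double c (b (suc n)) ⟩
      2 * c * b (suc n)                              ∎
      where
      n = k + N
      pull : ∀ o c b → o * (2 * c * b) ≡ c * (2 * (o * b))
      pull = solve-∀
      double : ∀ c b → c * b + c * b ≡ 2 * c * b
      double = solve-∀

  -- Once `p ≤ c * b`, the error in either direction is at most `suc c * (K n * b n)`, and `growth`
  -- pushes this below any fixed fraction of `b (suc n)`.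
  asymptotic : p ∼ b
  asymptotic ε 0<ε = suc (N ⊔ M) , λ { (suc n) (s≤s N⊔M≤n) → >-nonZero (b>0 (suc n)) ,
    close n (ℕ.≤-trans (ℕ.m≤m⊔n N M) N⊔M≤n) (ℕ.≤-trans (ℕ.m≤n⊔m N M) N⊔M≤n) }
    where
    open ℕ.≤-Reasoning
    c = proj₁ bounded
    N = proj₁ (proj₂ bounded)
    q = ↧ₙ ε
    -- The factor `q * suc c` is what `ratio-close` needs for the error `d`; the 2 turns the weak
    -- inequality from `growth` into a strict one, as `b (suc n)` is positive.
    m = 2 * (q * suc c)
    M = proj₁ (growth m)
    close : ∀ n → N ≤ n → M ≤ n →
      ℚ.∣ ℚ._/_ (ℤ.+ p (suc n)) (b (suc n)) {{>-nonZero (b>0 (suc n))}} ℚ.- 1ℚ ∣ ℚ.< ε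
    close n N≤n M≤n = ratio-close (p (suc n)) (b (suc n)) d ε 0<ε (>-nonZero (b>0 (suc n)))
      (ℕ.≤-trans (upper n) (ℕ.+-monoʳ-≤ (b (suc n)) (begin
        K n * p n            ≤⟨ ℕ.*-monoʳ-≤ (K n) (proj₂ (proj₂ bounded) n N≤n) ⟩
        K n * (c * b n)      ≡⟨ pull (K n) c (b n) ⟩
        c * (K n * b n)      ≤⟨ ℕ.m≤n+m (c * (K n * b n)) (K n * b n) ⟩
        d                           ∎)))
      (ℕ.≤-trans (lower n) (ℕ.+-monoʳ-≤ (p (suc n)) (ℕ.m≤m+n (K n * b n) _)))
      (ℕ.*-cancelˡ-< 2 _ _ (begin-strict
        2 * (q * d)                         ≡⟨ regroup q c (K n * b n) ⟩
        m * (K n * b n)              ≤⟨ proj₂ (growth m) n M≤n ⟩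
        b (suc n)                           <⟨ ℕ.m<m+n (b (suc n)) (b>0 (suc n)) ⟩
        b (suc n) + b (suc n)               ≡⟨ cong (b (suc n) +_) (ℕ.+-identityʳ _) ⟨
        2 * b (suc n)                       ∎))
      where
      d = suc c * (K n * b n)
      pull : ∀ o c b → o * (c * b) ≡ c * (o * b)
      pull = solve-∀
      regroup : ∀ q c x → 2 * (q * (suc c * x)) ≡ 2 * (q * suc c) * x
      regroup = solve-∀

b-lbl>0 : ∀ n → 0 < b-lbl n
b-lbl>0 n = begin-strict
  0                                            <⟨ ℕ.m^n>0 2 0 ⟩
  1                                            ≡⟨ cong (_* 2 ^ (0 * n)) (nC0≡1 n) ⟨
  (n C 0) * 2 ^ (0 * (n ∸ 0))                  ≤⟨ ∑-term (suc n) (λ i → (n C i) * 2 ^ (i * (n ∸ i))) 0 (s≤s z≤n) ⟩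
  ∑ (suc n) (λ i → (n C i) * 2 ^ (i * (n ∸ i))) ≡⟨ b-lbl-∑ n ⟨
  b-lbl n                                      ∎
  where open ℕ.≤-Reasoning

b-unl>0 : ∀ n → 0 < b-unl n
b-unl>0 n with b-unl n | b-lbl≤n!*b-unl n
... | zero  | le = contradiction (ℕ.≤-trans (b-lbl>0 n) (ℕ.≤-trans le (ℕ.≤-reflexive (ℕ.*-zeroʳ (n !))))) λ ()
... | suc _ | _  = s≤s z≤n

theorem5p4 : (p-lbl ∼ b-lbl) × (p-unl ∼ b-unl)
theorem5p4 =
  asymptotic {p-lbl} {b-lbl} {overhead} b-lbl>0 upper-lbl lower-lbl (λ m → let (N , g) = large m in N , λ n N≤n → proj₁ (g n N≤n)) ,
  asymptotic {p-unl} {b-unl} {overhead} b-unl>0 upper-unl lower-unl (λ m → let (N , g) = large m in N , λ n N≤n → proj₂ (g n N≤n))
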